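{- Let $(W,S)$ be a finite irreducible Coxeter system, $N$ the length of its longest element $w_\circ$, $p=p_1\cdots p_m\in S^m$ a word, and $\mathbf{A}\in\mathbb{R}^{(m-N)\times m}$. If $\mathbf{A}$ is a chirotopal realization of the subword complex $\Delta_W(p)$, then there exist a parameter tensor $\mathcal{P}_{\mathbf{A}}=(p^i{}_{s,k})_{(i,s,k)\in[N]\times S\times\{0,\dots,d-1\}}$ (for some $d\ge1$) and $m$ real numbers $x_i>0$, $i\in[m]$, such that (i) $i<j$ and $p_i=p_j$ implies $x_i<x_j$, and (ii) for every occurrence $\{z_1<\dots<z_N\}\subseteq[m]$ in $p$ of each reduced word $v=p_{z_1}\cdots p_{z_N}$ of $w_\circ$ which is a subword of $p$, the following equality holds: \[ \operatorname{sign}\Big(\sum_{\mathfrak{z}\in\mathfrak{Z}_{\alpha_v}}\det[\mathcal{P}_{\mathbf{A}}]_{\mathfrak{z}}\;\mathsf{S}_{\Lambda_{\mathfrak{z}},\Omega_v}(x_{z_1},\dots,x_{z_N})\Big)=\sigma(v)\,\tau(v). \]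
   Context: Setting. $S=\{s_1<\dots<s_n\}$; $\mathcal{R}(w_\circ)$ is the set of reduced words of $w_\circ$ (words of length $N$ in $S$ representing $w_\circ$); $(m_{i,j})$ is the Coxeter matrix. An occurrence of a word $v=v_1\cdots v_N$ in $p$ is a set of positions $z_1<\dots<z_N$ with $p_{z_1}\cdots p_{z_N}=v$. Subword complex. $\Delta_W(p)$ is the simplicial complex on $[m]$ whose facets are the complements in $[m]$ of the occurrences in $p$ of reduced words of $w_\circ$. Chirotopal realization. Let $\mathbf{A}\in\mathbb{R}^{(m-N)\times m}$ be a vector configuration of maximal rank $m-N$ (columns labeled by $[m]$). A Gale transform of $\mathbf{A}$ is a matrix $\mathbf{B}\in\mathbb{R}^{N\times m}$ of rank $N$ whose row span equals the right kernel of $\mathbf{A}$. For a facet $C$ of $\Delta_W(p)$, its dual simplicial cone is the cone spanned by the columns of $\mathbf{B}$ indexed by $[m]\setminus C$. $\mathbf{A}$ is a chirotopal realization of $\Delta_W(p)$ if, for a Gale transform $\mathbf{B}$ of $\mathbf{A}$: (B) for every facet $C$ the columns of $\mathbf{B}$ indexed by $[m]\setminus C$ are linearly independent; (F) whenever two facets intersect along a ridge (a common codimension-one face), the interiors of their dual simplicial cones intersect. Signs. The $S$-sign of a word $v$ is $\sigma(v)=(-1)^{\operatorname{inv}(v)}$, where $\operatorname{inv}(v)$ is the number of pairs $a<b$ with $v_b<v_a$. The $T$-sign function $\tau:\mathcal{R}(w_\circ)\to\{\pm1\}$ is the function satisfying $\tau(w)=(-1)^{m_{i,j}-1}\tau(w')$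 whenever $w,w'$ are related by a braid move of length $m_{i,j}$ (replacing a factor $s_is_js_i\cdots$ of length $m_{i,j}$ by $s_js_is_j\cdots$ of the same length); it exists and is unique up to a global sign, which is fixed by requiring $\tau=+1$ on the lexicographically first reduced word of $w_\circ$ occurring as a subword in $(s_1\cdots s_n)^\infty$. The product $\sigma(v)\tau(v)$ is called the punctual sign of $v$. Parameter tensor and minors. A parameter tensor is a real array $\mathcal{P}=(p^i{}_{s,k})$ with $(i,s,k)\in[N]\times S\times\{0,\dots,d-1\}$, regarded as an $N\times nd$ matrix with rows indexed by $i$ and columns indexed by pairs $(s,k)$ in lexicographic order. For $v=v_1\cdots v_N$ let $\{v\}_i:=\{j\in[N]:v_j=s_i\}$, $c_i:=\#\{v\}_i$, $\alpha_v:=(c_1,\dots,c_n)$ and $\Omega_v:=(\{v\}_1,\dots,\{v\}_n)$. $\mathfrak{Z}_{\alpha_v}$ is the collection of subsets $\mathfrak{z}\subseteq S\times\{0,\dots,d-1\}$ containing exactly $c_i$ elements with first coordinate $s_i$ for every $i\in[n]$. $[\mathcal{P}]_{\mathfrak{z}}$ is the $N\times N$ submatrix of $\mathcal{P}$ with columns $\mathfrak{z}$ in increasing lexicographic order. $\Lambda_{\mathfrak{z}}=(\lambda^{\mathfrak{z},1},\dots,\lambda^{\mathfrak{z},n})$, where $\lambda^{\mathfrak{z},i}$ is obtained by listing the second coordinates of the elements of $\mathfrak{z}$ with first coordinate $s_i$ in decreasing order and subtracting $c_i-j$ from the entry at position $j$. Schur functions. For a partition $\lambda=(\lambda_1\ge\dots\ge\lambda_r\ge0)$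 and an ordered index set $J$ with $\#J=r$, $\mathsf{s}_{\lambda,J}$ is the polynomial \[\mathsf{s}_{\lambda,J}:=\frac{\det\big(y_j^{\,i-1+\lambda_{r-i+1}}\big)_{(i,j)\in[r]\times J}}{\det\big(y_j^{\,i-1}\big)_{(i,j)\in[r]\times J}}.\] The partial Schur function in variables $y_1,\dots,y_N$ is $\mathsf{S}_{\Lambda_{\mathfrak{z}},\Omega_v}(y_1,\dots,y_N):=\prod_{i=1}^n\mathsf{s}_{\lambda^{\mathfrak{z},i},\{v\}_i}$. -}

module Defs where

open import Level using (Level; _⊔_; suc)
open import Algebra.Bundles using (CommutativeRing; Group; Semiring)
import Algebra.Definitions.RawSemiring as RawSemiringDefinitions
open import Data.Fin.Base as Fin using (Fin; toℕ; opposite; punchIn)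
import Data.Fin.Properties as Fin
open import Data.Fin.Subset using (Subset; _∈_; _∉_; ∣_∣; ∁; _∩_; ⋃; ⁅_⁆)
open import Data.Integer.Base using (ℤ; 0ℤ; 1ℤ; -1ℤ)
open import Data.List.Base as List using (List; []; _∷_; _++_; length)
open import Data.Nat.Base as ℕ using (ℕ; zero; _∸_)
import Data.Nat.Properties as ℕ
open import Data.Product.Base using (_×_; _,_; proj₁; proj₂; ∃; Σ-syntax; ∃-syntax; uncurry)
open import Data.Product.Relation.Binary.Lex.Strict using (×-Lex; ×-decidable)
open import Data.Sign.Base as Sign using (Sign)
open import Data.Vec.Base as Vec using (Vec; lookup; toList)
open import Data.Vec.Relation.Binary.Lex.Strict using (Lex-≤)
open import Data.Vec.Relation.Unary.Linked using (Linked; linked?)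
open import Function.Base using (_∘_)
open import Function.Bundles using (_⇔_; Inverse)
open import Relation.Binary.Core using (Rel)
open import Relation.Binary.Definitions using (Decidable; tri<; tri≈; tri>)
open import Relation.Binary.Structures using (IsStrictTotalOrder)
open import Relation.Binary.Construct.Closure.Equivalence using (EqClosure)
open import Relation.Binary.Construct.Closure.ReflexiveTransitive using (Star)
open import Relation.Binary.PropositionalEquality.Core using (_≡_; _≢_)
import Relation.Binary.PropositionalEquality.Properties as ≡
open import Relation.Nullary.Decidable using (_×-dec_)
open import Relation.Nullary.Negation.Core using (¬_)

-- The real numbers, characterised (uniquely up to isomorphism) as a
-- Dedekind-complete ordered field.  The order is trichotomous, as it is
-- classically.

record CompleteOrderedField (a ℓ₁ ℓ₂ : Level) : Set (suc (a ⊔ ℓ₁ ⊔ ℓ₂)) where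
  infix 4 _<_ _≤_
  infix 8 _⁻¹
  infixl 7 _÷_

  field
    commutativeRing : CommutativeRing a ℓ₁

  open CommutativeRing commutativeRing public
  open RawSemiringDefinitions (Semiring.rawSemiring semiring) public using (_^_; sum; product)

  field
    _<_                : Rel Carrier ℓ₂
    isStrictTotalOrder : IsStrictTotalOrder _≈_ _<_
    0<1                : 0# < 1#
    +-monoʳ-<          : ∀ x {y z} → y < z → x + y < x + z
    *-pos              : ∀ {x y} → 0# < x → 0# < y → 0# < x * y
    inverse            : ∀ {x} → ¬ x ≈ 0# → ∃[ y ] x * y ≈ 1#

  open IsStrictTotalOrder isStrictTotalOrder public using (compare)

  _≤_ : Rel Carrier ℓ₂
  x ≤ y = ¬ (y < x)

  UpperBound : (Carrier → Set (a ⊔ ℓ₁ ⊔ ℓ₂)) → Carrier → Set (a ⊔ ℓ₁ ⊔ ℓ₂)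
  UpperBound P u = ∀ x → P x → x ≤ u

  field
    supremum : (P : Carrier → Set (a ⊔ ℓ₁ ⊔ ℓ₂)) → ∃ P → ∃ (UpperBound P) →
               ∃[ s ] UpperBound P s × (∀ u → UpperBound P u → s ≤ u)

  -- Totalised by 0⁻¹ = 0; it is only ever applied to nonzero elements.
  _⁻¹ : Carrier → Carrier
  x ⁻¹ with compare x 0#
  ... | tri< _ x≉0 _ = proj₁ (inverse x≉0)
  ... | tri≈ _ _ _   = 0#
  ... | tri> _ x≉0 _ = proj₁ (inverse x≉0)

  _÷_ : Carrier → Carrier → Carrier
  x ÷ y = x * y ⁻¹

  sign : Carrier → ℤ
  sign x with compare 0# x
  ... | tri< _ _ _ = 1ℤ
  ... | tri≈ _ _ _ = 0ℤ
  ... | tri> _ _ _ = -1ℤ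

  sumList : List Carrier → Carrier
  sumList = List.foldr _+_ 0#

module LinearAlgebra {a ℓ₁ ℓ₂} (ℝ : CompleteOrderedField a ℓ₁ ℓ₂) where
  open CompleteOrderedField ℝ

  Matrix : ℕ → ℕ → Set a
  Matrix r k = Fin r → Fin k → Carrier

  -- Laplace expansion along the first row.
  det : ∀ {r} → Matrix r r → Carrier
  det {zero}    M = 1#
  det {ℕ.suc r} M = sum λ j →
    (- 1#) ^ toℕ j * M Fin.zero j * det (λ i k → M (Fin.suc i) (punchIn j k))

  module _ {r k : ℕ} (M : Matrix r k) where

    columnCombination : (Fin k → Carrier) → Fin r → Carrier
    columnCombination c i = sum λ j → c j * M i j

    SupportedOn : Subset k → (Fin k → Carrier) → Set ℓ₁
    SupportedOn Z c = ∀ j → j ∉ Z → c j ≈ 0#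

    IndependentColumns : Subset k → Set (a ⊔ ℓ₁)
    IndependentColumns Z =
      ∀ c → SupportedOn Z c → (∀ i → columnCombination c i ≈ 0#) → ∀ j → c j ≈ 0#

    HasRank : ℕ → Set (a ⊔ ℓ₁)
    HasRank ρ = (∃[ Z ] ∣ Z ∣ ≡ ρ × IndependentColumns Z)
              × (∀ Z → IndependentColumns Z → ∣ Z ∣ ℕ.≤ ρ)

    InKernel : (Fin k → Carrier) → Set ℓ₁
    InKernel y = ∀ i → sum (λ j → M i j * y j) ≈ 0#

    InRowSpan : (Fin k → Carrier) → Set (a ⊔ ℓ₁)
    InRowSpan y = Σ[ c ∈ (Fin r → Carrier) ] ∀ j → y j ≈ sum (λ i → c i * M i j)

    InCone : Subset k → (Fin r → Carrier) → Set (a ⊔ ℓ₁ ⊔ ℓ₂)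
    InCone Z x = ∃[ c ] (∀ j → 0# ≤ c j) × SupportedOn Z c
                      × (∀ i → x i ≈ columnCombination c i)

  -- Topological interior in ℝʳ, using the open boxes (balls of the
  -- maximum norm) as neighbourhoods.
  Interior : ∀ {r p} → ((Fin r → Carrier) → Set p) → (Fin r → Carrier) → Set (a ⊔ ℓ₂ ⊔ p)
  Interior X x = ∃[ ε ] 0# < ε
    × (∀ y → (∀ i → x i - ε < y i × y i < x i + ε) → X y)

  IsGaleTransform : ∀ {r N k} → Matrix r k → Matrix N k → Set (a ⊔ ℓ₁)
  IsGaleTransform {N = N} A B = HasRank B N × (∀ y → InRowSpan B y ⇔ InKernel A y)

-- The entry 0 stands for ∞.
record IsCoxeterMatrix {n} (M : Fin n → Fin n → ℕ) : Set where
  field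
    diagonal    : ∀ i → M i i ≡ 1
    symmetric   : ∀ i j → M i j ≡ M j i
    offDiagonal : ∀ {i j} → i ≢ j → M i j ≢ 1

-- Deletion of a relator (sᵢ sⱼ)^mᵢⱼ from a word.  As sᵢ sᵢ is a relator,
-- the monoid presented by these relations is the Coxeter group.
data RelatorDeletion {n} (M : Fin n → Fin n → ℕ) : Rel (List (Fin n)) Level.zero where
  delete : ∀ u i j v →
    RelatorDeletion M
      (u ++ List.concat (List.replicate (M i j) (i ∷ j ∷ [])) ++ v) (u ++ v)

record CoxeterSystem (c ℓ : Level) : Set (suc (c ⊔ ℓ)) where
  field
    group           : Group c ℓ
    n               : ℕ
    mat             : Fin n → Fin n → ℕ
    isCoxeterMatrix : IsCoxeterMatrix mat
    generator       : Fin n → Group.Carrier group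

  open Group group public using (_≈_; _∙_; ε) renaming (Carrier to Element)

  S : Set
  S = Fin n

  ⟦_⟧ : List S → Element
  ⟦_⟧ = List.foldr (λ i w → generator i ∙ w) ε

  field
    generates    : ∀ w → ∃[ u ] ⟦ u ⟧ ≈ w
    presentation : ∀ u v → (⟦ u ⟧ ≈ ⟦ v ⟧) ⇔ EqClosure (RelatorDeletion mat) u v

  IsFinite : Set (c ⊔ ℓ)
  IsFinite = ∃[ k ] Inverse (≡.setoid (Fin k)) (Group.setoid group)

  -- Connectedness of the Coxeter graph, whose edges are the pairs with
  -- mᵢⱼ ≥ 3 (including ∞).
  IsIrreducible : Set
  IsIrreducible = ∀ i j → Star (λ i j → i ≢ j × mat i j ≢ 2) i j

  HasLength : Element → ℕ → Set ℓ
  HasLength w k = (∃[ u ] length u ≡ k × ⟦ u ⟧ ≈ w)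
                × (∀ u → ⟦ u ⟧ ≈ w → k ℕ.≤ length u)

  IsLongestElement : Element → ℕ → Set (c ⊔ ℓ)
  IsLongestElement w N = HasLength w N × (∀ w′ k → HasLength w′ k → k ℕ.≤ N)

  ReducedWord : Element → ∀ {N} → Vec S N → Set ℓ
  ReducedWord w {N} v = HasLength w N × ⟦ toList v ⟧ ≈ w

inversions : ∀ {n N} → Vec (Fin n) N → ℕ
inversions {N = N} v = length (List.filter
  (λ (a , b) → (a Fin.<? b) ×-dec (lookup v b Fin.<? lookup v a))
  (List.cartesianProduct (List.allFin N) (List.allFin N)))

-1^ : ℕ → Sign
-1^ zero      = Sign.+
-1^ (ℕ.suc k) = Sign.opposite (-1^ k)

σ : ∀ {n N} → Vec (Fin n) N → Sign
σ v = -1^ (inversions v)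

alternating : ∀ {A : Set} → ℕ → A → A → List A
alternating zero      i j = []
alternating (ℕ.suc k) i j = i ∷ alternating k j i

module TSign {c ℓ} (W : CoxeterSystem c ℓ) where
  open CoxeterSystem W

  BraidMove : S → S → ∀ {N} → Vec S N → Vec S N → Set
  BraidMove i j v v′ = i ≢ j × (∃[ x ] ∃[ y ]
      toList v  ≡ x ++ alternating (mat i j) i j ++ y
    × toList v′ ≡ x ++ alternating (mat i j) j i ++ y)

  -- Occurrences of v in the infinite word (s₁⋯sₙ)^∞, whose k-th letter
  -- (counting from 0) is the one with index k mod n.
  OccursInPeriodicWord : ∀ {N} → Vec S N → Vec ℕ N → Set
  OccursInPeriodicWord v f = Linked ℕ._<_ f
    × (∀ j → ∃[ q ] lookup f j ≡ q ℕ.* n ℕ.+ toℕ (lookup v j))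

  -- Occurrences are compared lexicographically by their positions.
  FirstReducedWord : Element → ∀ {N} → Vec S N → Set ℓ
  FirstReducedWord w {N} v = ReducedWord w v × (∃[ f ] OccursInPeriodicWord v f
    × (∀ (v′ : Vec S N) f′ → ReducedWord w v′ → OccursInPeriodicWord v′ f′ → Lex-≤ _≡_ ℕ._<_ f f′))

  -- τ is a function on reduced words; its values on other words are
  -- unconstrained and never used.
  IsTSign : Element → ∀ {N} → (Vec S N → Sign) → Set ℓ
  IsTSign w τ =
      (∀ {i j v v′} → ReducedWord w v → ReducedWord w v′ → BraidMove i j v v′ →
         τ v ≡ -1^ (mat i j ∸ 1) Sign.* τ v′)
    × (∀ v → FirstReducedWord w v → τ v ≡ Sign.+)

module Subword {c ℓ} (W : CoxeterSystem c ℓ) where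
  open CoxeterSystem W

  subword : ∀ {m N} → Vec S m → Vec (Fin m) N → Vec S N
  subword p z = Vec.map (lookup p) z

  -- A set of positions is given by its increasing enumeration.
  IsOccurrence : Element → ∀ {m N} → Vec S m → Vec (Fin m) N → Set ℓ
  IsOccurrence w p z = Linked Fin._<_ z × ReducedWord w (subword p z)

  IsFacet : Element → ℕ → ∀ {m} → Vec S m → Subset m → Set ℓ
  IsFacet w N {m} p C = Σ[ z ∈ Vec (Fin m) N ] IsOccurrence w p z
    × C ≡ ∁ (⋃ (toList (Vec.map ⁅_⁆ z)))

  -- All facets have the same cardinality, and the intersection of two
  -- facets is a face.
  MeetInRidge : ∀ {m} → Subset m → Subset m → Set
  MeetInRidge C C′ = ℕ.suc ∣ C ∩ C′ ∣ ≡ ∣ C ∣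

  module _ {a ℓ₁ ℓ₂} (ℝ : CompleteOrderedField a ℓ₁ ℓ₂) where
    open CompleteOrderedField ℝ using (Carrier)
    open LinearAlgebra ℝ

    IsChirotopalRealization : Element → (N : ℕ) → ∀ {m} → Vec S m →
                              Matrix (m ∸ N) m → Set (a ⊔ ℓ ⊔ ℓ₁ ⊔ ℓ₂)
    IsChirotopalRealization w N {m} p A =
      HasRank A (m ∸ N) × (Σ[ B ∈ Matrix N m ] IsGaleTransform A B
        × (∀ C → IsFacet w N p C → IndependentColumns B (∁ C))
        × (∀ C C′ → IsFacet w N p C → IsFacet w N p C′ → MeetInRidge C C′ →
             ∃[ x ] Interior (InCone B (∁ C)) x × Interior (InCone B (∁ C′)) x))

infix 4 _<ₗₑₓ_ _<ₗₑₓ?_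

_<ₗₑₓ_ : ∀ {n d} → Rel (Fin n × Fin d) Level.zero
_<ₗₑₓ_ = ×-Lex _≡_ Fin._<_ Fin._<_

_<ₗₑₓ?_ : ∀ {n d} → Decidable (_<ₗₑₓ_ {n} {d})
_<ₗₑₓ?_ = ×-decidable Fin._≟_ Fin._<?_ Fin._<?_

vectors : ∀ {A : Set} → List A → ∀ k → List (Vec A k)
vectors xs zero      = Vec.[] ∷ []
vectors xs (ℕ.suc k) = List.cartesianProductWith Vec._∷_ xs (vectors xs k)

α : ∀ {n N} → Vec (Fin n) N → Fin n → ℕ
α v i = Vec.count (Fin._≟ i) v

Ω : ∀ {n N} → Vec (Fin n) N → Fin n → List (Fin N)
Ω {N = N} v i = List.filter (λ j → lookup v j Fin.≟ i) (List.allFin N)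

-- An N-element subset 𝔷 of S × {0,…,d-1} is given by its increasing
-- enumeration, so that every subset is listed exactly once.
ℨ : ∀ {n N} d → (Fin n → ℕ) → List (Vec (Fin n × Fin d) N)
ℨ {n} {N} d c = List.filter
  (λ 𝔷 → linked? _<ₗₑₓ?_ 𝔷
     ×-dec Fin.all? (λ i → Vec.count (λ e → proj₁ e Fin.≟ i) 𝔷 ℕ.≟ c i))
  (vectors (List.cartesianProduct (List.allFin n) (List.allFin d)) N)

-- For k₁ > ⋯ > k_c, the partition (k₁ - (c-1), …, k_c - 0).
subtractStaircase : List ℕ → List ℕ
subtractStaircase []       = []
subtractStaircase (k ∷ ks) = (k ∸ length ks) ∷ subtractStaircase ks

Λ : ∀ {n N d} → Vec (Fin n × Fin d) N → Fin n → List ℕ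
Λ 𝔷 i = subtractStaircase (List.reverse
  (List.map (toℕ ∘ proj₂) (List.filter (λ e → proj₁ e Fin.≟ i) (toList 𝔷))))

-- Parts are indexed from 0; parts beyond the end are zero.
part : List ℕ → ℕ → ℕ
part []      _         = 0
part (k ∷ _) zero      = k
part (_ ∷ l) (ℕ.suc i) = part l i

module Parameters {a ℓ₁ ℓ₂} (ℝ : CompleteOrderedField a ℓ₁ ℓ₂) where
  open CompleteOrderedField ℝ
  open LinearAlgebra ℝ

  ParameterTensor : ℕ → ℕ → ℕ → Set a
  ParameterTensor N n d = Fin N → Fin n → Fin d → Carrier

  columns : ∀ {N n d} → ParameterTensor N n d → Vec (Fin n × Fin d) N → Matrix N N
  columns P 𝔷 i j = uncurry (P i) (lookup 𝔷 j)

  -- With rows numbered from 0, the part λ_{r-i+1} of row i is the one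
  -- with index opposite i.
  alternant : List ℕ → ∀ {r} → (Fin r → Carrier) → Carrier
  alternant l y = det λ i j → y j ^ (toℕ i ℕ.+ part l (toℕ (opposite i)))

  vandermonde : ∀ {r} → (Fin r → Carrier) → Carrier
  vandermonde y = det λ i j → y j ^ toℕ i

  -- The value of the Schur polynomial at a point with pairwise distinct
  -- coordinates, where the denominator does not vanish.
  schur : List ℕ → ∀ {r} → (Fin r → Carrier) → Carrier
  schur l y = alternant l y ÷ vandermonde y

  partialSchur : ∀ {n N} → (Fin n → List ℕ) → (Fin n → List (Fin N)) →
                 (Fin N → Carrier) → Carrier
  partialSchur l J y = product λ i → schur (l i) (y ∘ List.lookup (J i))

{-# OPTIONS --safe #-}
module Submission where

-- Let B be the Gale dual of A, and B_z its maximal minor at an occurrence z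
-- of v.  With x_j = j + 1, interpolation puts all columns of B on one
-- polynomial curve, B_j = Σ_k x_jᵏ P_k.  This factors the columns of z
-- through S × {0,…,d-1}; by the Cauchy–Binet formula, det B_z is the sum of
-- the det[P]_𝔷 times minors that split into one alternant per letter, at
-- the cost of the sign σ(v).  Dividing by positive Vandermonde determinants,
-- the sum in (ii) is a positive multiple of σ(v) det B_z.
--
-- It remains to see that det B_z has sign τ(v), up to a global sign that is
-- absorbed in the first row of B.  Any two occurrences are connected by
-- flips.  In a flip from R ∪ {a} to R ∪ {b} the interiors of the two cones
-- meet, so the columns a and b lie on the same side of the span of R, and
-- det B_z changes by (-1)ᵏ, k being the number of elements of R between a
-- and b.  The same holds for τ: the flip replaces a factor s y by y s′ with
-- |y| = k, and whenever s y = y s′ are reduced words they are related by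
-- braid moves of total sign (-1)^|y|, by induction on |y| from Matsumoto's
-- theorem.  The latter needs the exchange condition, proved by counting
-- reflections modulo 2, and that sᵢ sⱼ has order exactly mᵢⱼ, which is read
-- off the geometric representation.

open import Defs
open import Algebra.Bundles using (Group)
import Algebra.Properties.CommutativeMonoid.Sum as CommutativeMonoidSum
import Algebra.Properties.Group as GroupProperties
import Algebra.Properties.Ring as RingProperties
import Algebra.Properties.Semiring.Sum as SemiringSum
import Algebra.Solver.CommutativeMonoid as CommutativeMonoidSolver
import Algebra.Solver.Ring as RingSolver
open import Algebra.Solver.Ring.AlmostCommutativeRing using (_-Raw-AlmostCommutative⟶_; fromCommutativeRing)
open import Data.Bool.Base using (Bool; _xor_; false; true)
import Data.Bool.Properties as Bool
open import Data.Empty using (⊥-elim)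
open import Data.Fin.Base as Fin using (Fin; opposite; punchIn; toℕ)
import Data.Fin.Properties as Fin
open import Data.Fin.Subset as Subset using (Subset; _∩_; _∪_; ⁅_⁆; ∁; ∣_∣; ⋃)
import Data.Fin.Subset.Properties as Subset
open import Data.Integer.Base as ℤ using (+_; -[1+_]; 1ℤ; _◃_; ℤ)
import Data.Integer.Properties as ℤ
open import Data.List.Base as List using (List; []; _++_; _∷_; allFin; cartesianProduct; filter; length; map; reverse; tabulate)
open import Data.List.Membership.Propositional using (_∈_; _∉_)
open import Data.List.Membership.Propositional.Properties using (∈-++⁺ʳ; ∈-++⁺ˡ; ∈-++⁻; ∈-allFin; ∈-filter⁻; ∈-insert; ∈-∃++)
import Data.List.Properties as List
open import Data.List.Relation.Binary.Permutation.Propositional using (_↭_; ↭-refl; ↭-reflexive; ↭-sym; ↭-trans)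
import Data.List.Relation.Binary.Permutation.Propositional as ↭
import Data.List.Relation.Binary.Permutation.Propositional.Properties as ↭
open import Data.List.Relation.Binary.Sublist.Propositional as Sublist using ([]; _∷_; _∷ʳ_; _⊆_)
import Data.List.Relation.Binary.Sublist.Propositional.Properties as Sublist
open import Data.List.Relation.Unary.All using (All; []; _∷_)
import Data.List.Relation.Unary.All as All
import Data.List.Relation.Unary.All.Properties as All
open import Data.List.Relation.Unary.AllPairs using (AllPairs; []; _∷_)
import Data.List.Relation.Unary.AllPairs as AllPairs
import Data.List.Relation.Unary.AllPairs.Properties as AllPairs
open import Data.List.Relation.Unary.Any using (here; there)
open import Data.Maybe.Base using (Maybe; just; nothing)
open import Data.Nat.Base as ℕ using (_∸_; suc; zero; ℕ)
import Data.Nat.Properties as ℕ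
open import Data.Product.Base using (_,_; _×_; proj₁; proj₂; swap; uncurry; Σ-syntax; ∃; ∃-syntax)
open import Data.Sign.Base as Sign using (Sign)
import Data.Sign.Properties as Sign
open import Data.Sum.Base using (_⊎_; inj₁; inj₂)
open import Data.Unit.Base using (tt)
open import Data.Vec.Base as Vec using (Vec; []; _∷_; lookup; toList)
import Data.Vec.Properties as Vec
open import Data.Vec.Relation.Binary.Lex.Core using (base)
open import Data.Vec.Relation.Unary.Linked using (Linked; [-]; []; _∷_; linked?)
import Data.Vec.Relation.Unary.Linked as Linked
import Data.Vec.Relation.Unary.Linked.Properties as Linked
open import Function.Base using (_∘_; flip; id)
open import Function.Bundles using (Equivalence; Inverse)
open import Level as Level using (Level)
open import Relation.Binary.Construct.Closure.Equivalence using (EqClosure)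
import Relation.Binary.Construct.Closure.Equivalence as EqClosure
open import Relation.Binary.Core using (Rel)
open import Relation.Binary.Definitions using (Transitive; Tri; tri<; tri>; tri≈) renaming (Decidable to Decidable₂)
open import Relation.Binary.PropositionalEquality.Core as ≡ using (_≡_; _≢_)
import Relation.Binary.PropositionalEquality.Properties as ≡
open import Relation.Binary.Structures using (IsStrictTotalOrder)
open import Relation.Nullary.Decidable using (Dec; _×-dec_; does; map′; no; yes)
open import Relation.Nullary.Negation.Core using (contradiction; ¬_)
open import Relation.Unary using (Decidable)

-- The reals are given by axioms alone, so no cosine is at hand: the entry 2 cos (π/m) of the
-- geometric representation is built as a supremum, and every trigonometric fact about it becomes an
-- identity or inequality between Chebyshev values. The exact order of `sᵢ sⱼ` matters for
-- Matsumoto's theorem: when two reduced words with different first letters are brought to a common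
-- alternating prefix, the exchange condition might delete a letter of that prefix. This is excluded
-- because the two alternating words of each positive length below mᵢⱼ represent different elements.
-- Finiteness of the group makes its equality decidable, which is what allows reflections to be
-- counted modulo 2.
--
-- All m columns are interpolated at once, so the parameters do not depend on the occurrence, and
-- condition (i) holds because the nodes increase along the whole word.
--
-- Determinants are recursions over lists of rows and columns: removing, moving and splitting off
-- columns are then list operations, and the signs come from the recursion itself.

-- Ordered fields: integer coefficients, order and signs.

module OrderedField {a ℓ₁ ℓ₂} (ℝ : CompleteOrderedField a ℓ₁ ℓ₂) where
  open CompleteOrderedField ℝ hiding (zero)
  open import Relation.Binary.Reasoning.Setoid setoid
  open RingProperties ring using (-‿distribˡ-*; -‿distribʳ-*; -‿involutive; -‿+-comm; -0#≈0#)

  module IntegerCoefficients where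
    -- The separate clause for 1 makes the solver's constants unfold to `1#` and `1# + 1#`, without
    -- a trailing `0#`.
    nat : ℕ → Carrier
    nat 0             = 0#
    nat 1             = 1#
    nat (suc (suc k)) = 1# + nat (suc k)

    nat-suc : ∀ k → nat (suc k) ≈ 1# + nat k
    nat-suc zero    = sym (+-identityʳ 1#)
    nat-suc (suc k) = refl

    int : ℤ → Carrier
    int (+ k)    = nat k
    int -[1+ k ] = - nat (suc k)

    nat-+ : ∀ k l → nat (k ℕ.+ l) ≈ nat k + nat l
    nat-+ zero    l = sym (+-identityˡ _)
    nat-+ (suc k) l = begin
      nat (suc (k ℕ.+ l))   ≈⟨ nat-suc (k ℕ.+ l) ⟩
      1# + nat (k ℕ.+ l)    ≈⟨ +-congˡ (nat-+ k l) ⟩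
      1# + (nat k + nat l)  ≈⟨ +-assoc _ _ _ ⟨
      1# + nat k + nat l    ≈⟨ +-congʳ (nat-suc k) ⟨
      nat (suc k) + nat l   ∎

    nat-* : ∀ k l → nat (k ℕ.* l) ≈ nat k * nat l
    nat-* zero    l = sym (zeroˡ _)
    nat-* (suc k) l = begin
      nat (l ℕ.+ k ℕ.* l)       ≈⟨ nat-+ l (k ℕ.* l) ⟩
      nat l + nat (k ℕ.* l)     ≈⟨ +-cong (sym (*-identityˡ _)) (nat-* k l) ⟩
      1# * nat l + nat k * nat l ≈⟨ distribʳ _ _ _ ⟨
      (1# + nat k) * nat l      ≈⟨ *-congʳ (nat-suc k) ⟨
      nat (suc k) * nat l       ∎

    int-neg : ∀ i → int (ℤ.- i) ≈ - int i
    int-neg (+ zero)  = sym -0#≈0#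
    int-neg (+ suc k) = refl
    int-neg -[1+ k ]  = sym (-‿involutive _)

    cancel : ∀ x y → (1# + x) - (1# + y) ≈ x - y
    cancel x y = begin
      (1# + x) + - (1# + y)     ≈⟨ +-congˡ (-‿+-comm 1# y) ⟨
      (1# + x) + (- 1# + - y)   ≈⟨ +-congʳ (+-comm 1# x) ⟩
      (x + 1#) + (- 1# + - y)   ≈⟨ +-assoc _ _ _ ⟩
      x + (1# + (- 1# + - y))   ≈⟨ +-congˡ (+-assoc _ _ _) ⟨
      x + ((1# + - 1#) + - y)   ≈⟨ +-congˡ (+-congʳ (-‿inverseʳ 1#)) ⟩
      x + (0# + - y)            ≈⟨ +-congˡ (+-identityˡ _) ⟩
      x - y                     ∎

    int-⊖ : ∀ k l → int (k ℤ.⊖ l) ≈ nat k - nat l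
    int-⊖ k zero = sym (trans (+-congˡ -0#≈0#) (+-identityʳ _))
    int-⊖ zero (suc l) = sym (+-identityˡ _)
    int-⊖ (suc k) (suc l) = begin
      int (suc k ℤ.⊖ suc l)     ≡⟨ ≡.cong int (ℤ.[1+m]⊖[1+n]≡m⊖n k l) ⟩
      int (k ℤ.⊖ l)             ≈⟨ int-⊖ k l ⟩
      nat k - nat l             ≈⟨ cancel _ _ ⟨
      (1# + nat k) - (1# + nat l) ≈⟨ +-cong (nat-suc k) (-‿cong (nat-suc l)) ⟨
      nat (suc k) - nat (suc l) ∎

    int-+ : ∀ i j → int (i ℤ.+ j) ≈ int i + int j
    int-+ (+ k)    (+ l)    = nat-+ k l
    int-+ (+ k)    -[1+ l ] = int-⊖ k (suc l)
    int-+ -[1+ k ] (+ l)    = trans (int-⊖ l (suc k)) (+-comm _ _)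
    int-+ -[1+ k ] -[1+ l ] = begin
      - nat (suc (suc (k ℕ.+ l)))  ≈⟨ -‿cong (nat-suc (suc (k ℕ.+ l))) ⟩
      - (1# + nat (suc k ℕ.+ l))   ≈⟨ -‿cong (+-congˡ (nat-+ (suc k) l)) ⟩
      - (1# + (nat (suc k) + nat l)) ≈⟨ -‿cong (trans (+-comm _ _) (+-assoc _ _ _)) ⟩
      - (nat (suc k) + (nat l + 1#)) ≈⟨ -‿cong (+-congˡ (trans (+-comm _ _) (sym (nat-suc l)))) ⟩
      - (nat (suc k) + nat (suc l)) ≈⟨ -‿+-comm _ _ ⟨
      - nat (suc k) + - nat (suc l) ∎

    int-* : ∀ i j → int (i ℤ.* j) ≈ int i * int j
    int-* (+ k) (+ l) = trans (reflexive (≡.cong int (≡.sym (ℤ.pos-* k l)))) (nat-* k l)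
    int-* (+ zero) -[1+ l ] = sym (zeroˡ _)
    int-* (+ suc k) -[1+ l ] = trans (-‿cong (nat-* (suc k) (suc l))) (-‿distribʳ-* _ _)
    int-* -[1+ k ] (+ zero) = trans (reflexive (≡.cong int (ℤ.*-zeroʳ -[1+ k ]))) (sym (zeroʳ _))
    int-* -[1+ k ] (+ suc l) = trans (-‿cong (nat-* (suc k) (suc l))) (-‿distribˡ-* _ _)
    int-* -[1+ k ] -[1+ l ] = begin
      nat (suc k ℕ.* suc l)             ≈⟨ nat-* (suc k) (suc l) ⟩
      nat (suc k) * nat (suc l)         ≈⟨ -‿involutive _ ⟨
      - - (nat (suc k) * nat (suc l))   ≈⟨ -‿cong (-‿distribʳ-* _ _) ⟩
      - (nat (suc k) * - nat (suc l))   ≈⟨ -‿distribˡ-* _ _ ⟩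
      - nat (suc k) * - nat (suc l)     ∎

    morphism : ℤ.+-*-rawRing -Raw-AlmostCommutative⟶ fromCommutativeRing commutativeRing
    morphism = record
      { ⟦_⟧    = int
      ; +-homo = int-+
      ; *-homo = int-*
      ; -‿homo = int-neg
      ; 0-homo = refl
      ; 1-homo = refl
      }

    coefficient≟ : ∀ i j → Maybe (int i ≈ int j)
    coefficient≟ i j with i ℤ.≟ j
    ... | yes ≡.refl = just refl
    ... | no _       = nothing

  open IntegerCoefficients using (morphism; coefficient≟)
  open RingSolver ℤ.+-*-rawRing (fromCommutativeRing commutativeRing) morphism coefficient≟ public
    using (solve; _:=_; _:+_; _:*_; _:-_; :-_; con)

  open IsStrictTotalOrder isStrictTotalOrder public
    using () renaming (trans to <-trans; irrefl to <-irrefl; asym to <-asym; <-resp-≈ to <-resp-≈)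

  <-respˡ : ∀ {x y z} → x ≈ y → x < z → y < z
  <-respˡ = proj₂ <-resp-≈

  <-respʳ : ∀ {x y z} → y ≈ z → x < y → x < z
  <-respʳ = proj₁ <-resp-≈

  pos⇒≉0 : ∀ {x} → 0# < x → ¬ x ≈ 0#
  pos⇒≉0 0<x x≈0 = <-irrefl (sym x≈0) 0<x

  +-monoˡ-< : ∀ z {x y} → x < y → x + z < y + z
  +-monoˡ-< z x<y = <-respˡ (+-comm _ _) (<-respʳ (+-comm _ _) (+-monoʳ-< z x<y))

  x<y⇒0<y-x : ∀ {x y} → x < y → 0# < y - x
  x<y⇒0<y-x {x} {y} x<y = <-respˡ (-‿inverseʳ x) (+-monoˡ-< (- x) x<y)

  0<y-x⇒x<y : ∀ {x y} → 0# < y - x → x < y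
  0<y-x⇒x<y {x} {y} h = <-respˡ (+-identityʳ x)
    (<-respʳ (solve 2 (λ x y → x :+ (y :- x) := y) refl x y) (+-monoʳ-< x h))

  neg⇒0<- : ∀ {x} → x < 0# → 0# < - x
  neg⇒0<- {x} h = <-respʳ (+-identityˡ _) (x<y⇒0<y-x h)

  0<-⇒neg : ∀ {x} → 0# < - x → x < 0#
  0<-⇒neg h = 0<y-x⇒x<y (<-respʳ (sym (+-identityˡ _)) h)

  +-pos : ∀ {x y} → 0# < x → 0# < y → 0# < x + y
  +-pos {x} 0<x 0<y = <-trans 0<x (<-respˡ (+-identityʳ x) (+-monoʳ-< x 0<y))

  *-cancel-pos : ∀ {x y} → 0# < x → 0# < x * y → 0# < y
  *-cancel-pos {x} {y} 0<x 0<xy with compare 0# y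
  ... | tri< 0<y _ _ = 0<y
  ... | tri≈ _ 0≈y _ = contradiction (trans (*-congˡ (sym 0≈y)) (zeroʳ x)) (pos⇒≉0 0<xy)
  ... | tri> _ _ y<0 = ⊥-elim (<-asym 0<xy (0<-⇒neg
        (<-respʳ (sym (-‿distribʳ-* x y)) (*-pos 0<x (neg⇒0<- y<0)))))

  ⁻¹-inverseʳ : ∀ {x} → ¬ x ≈ 0# → x * x ⁻¹ ≈ 1#
  ⁻¹-inverseʳ {x} x≉0 with compare x 0#
  ... | tri< _ x≉0′ _ = proj₂ (inverse x≉0′)
  ... | tri≈ _ x≈0 _  = contradiction x≈0 x≉0
  ... | tri> _ x≉0′ _ = proj₂ (inverse x≉0′)

  ⁻¹-pos : ∀ {x} → 0# < x → 0# < x ⁻¹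
  ⁻¹-pos 0<x = *-cancel-pos 0<x (<-respʳ (sym (⁻¹-inverseʳ (pos⇒≉0 0<x))) 0<1)

  *-cancelˡ-0 : ∀ {x y} → ¬ x ≈ 0# → x * y ≈ 0# → y ≈ 0#
  *-cancelˡ-0 {x} {y} x≉0 xy≈0 = begin
    y                ≈⟨ *-identityˡ y ⟨
    1# * y           ≈⟨ *-congʳ (⁻¹-inverseʳ x≉0) ⟨
    x * x ⁻¹ * y     ≈⟨ solve 3 (λ x i y → x :* i :* y := i :* (x :* y)) refl x (x ⁻¹) y ⟩
    x ⁻¹ * (x * y)   ≈⟨ *-congˡ xy≈0 ⟩
    x ⁻¹ * 0#        ≈⟨ zeroʳ _ ⟩
    0#               ∎

  -- An ordered field does not have characteristic 2. This turns antisymmetry of a determinant into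
  -- its vanishing on a repeated column.
  x≈-x⇒x≈0 : ∀ {x} → x ≈ - x → x ≈ 0#
  x≈-x⇒x≈0 {x} h with compare 0# x
  ... | tri< 0<x _ _ = contradiction (<-respʳ h 0<x) (λ q → <-asym 0<x (0<-⇒neg q))
  ... | tri≈ _ 0≈x _ = sym 0≈x
  ... | tri> _ _ x<0 = contradiction x<0 (<-asym (<-respʳ (sym h) (neg⇒0<- x<0)))

  sgn : Sign → Carrier
  sgn Sign.+ = 1#
  sgn Sign.- = - 1#

  -- A strict sign as a single inequality, so that signs are multiplied and cancelled by ring
  -- calculations instead of case distinctions.
  HasSign : Sign → Carrier → Set ℓ₂
  HasSign s x = 0# < sgn s * x

  HasSign-resp : ∀ s {x y} → x ≈ y → HasSign s x → HasSign s y
  HasSign-resp s x≈y = <-respʳ (*-congˡ x≈y)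

  sgn-* : ∀ s t → sgn (s Sign.* t) ≈ sgn s * sgn t
  sgn-* Sign.+ t      = sym (*-identityˡ _)
  sgn-* Sign.- Sign.+ = sym (*-identityʳ _)
  sgn-* Sign.- Sign.- = solve 0 (con 1ℤ := (:- con 1ℤ) :* (:- con 1ℤ)) refl

  sgn-opposite : ∀ s → sgn (Sign.opposite s) ≈ - sgn s
  sgn-opposite Sign.+ = refl
  sgn-opposite Sign.- = sym (-‿involutive 1#)

  sgn-square : ∀ s → sgn s * sgn s ≈ 1#
  sgn-square Sign.+ = *-identityˡ _
  sgn-square Sign.- = solve 0 ((:- con 1ℤ) :* (:- con 1ℤ) := con 1ℤ) refl

  signOf : ∀ {x} → ¬ x ≈ 0# → Sign
  signOf {x} x≉0 with compare 0# x
  ... | tri< _ _ _   = Sign.+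
  ... | tri≈ _ 0≈x _ = contradiction (sym 0≈x) x≉0
  ... | tri> _ _ _   = Sign.-

  signOf-hasSign : ∀ {x} (x≉0 : ¬ x ≈ 0#) → HasSign (signOf x≉0) x
  signOf-hasSign {x} x≉0 with compare 0# x
  ... | tri< 0<x _ _ = <-respʳ (sym (*-identityˡ x)) 0<x
  ... | tri≈ _ 0≈x _ = contradiction (sym 0≈x) x≉0
  ... | tri> _ _ x<0 = <-respʳ (solve 1 (λ x → :- x := (:- con 1ℤ) :* x) refl x) (neg⇒0<- x<0)

  HasSign⇒sign : ∀ s {x} → HasSign s x → sign x ≡ s ◃ 1
  HasSign⇒sign Sign.+ {x} h with compare 0# x
  ... | tri< _ _ _    = ≡.refl
  ... | tri≈ ¬h _ _   = contradiction (<-respʳ (*-identityˡ x) h) ¬h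
  ... | tri> ¬h _ _   = contradiction (<-respʳ (*-identityˡ x) h) ¬h
  HasSign⇒sign Sign.- {x} h with compare 0# x
  ... | tri< _ _ ¬h   = contradiction (0<-⇒neg (<-respʳ (solve 1 (λ x → (:- con 1ℤ) :* x := :- x) refl x) h)) ¬h
  ... | tri≈ _ _ ¬h   = contradiction (0<-⇒neg (<-respʳ (solve 1 (λ x → (:- con 1ℤ) :* x := :- x) refl x) h)) ¬h
  ... | tri> _ _ _    = ≡.refl

-- Determinants over lists and the Cauchy-Binet formula.

module Determinants {a ℓ₁ ℓ₂} (ℝ : CompleteOrderedField a ℓ₁ ℓ₂) where
  open CompleteOrderedField ℝ hiding (zero)
  open OrderedField ℝ
  open import Relation.Binary.Reasoning.Setoid setoid
  open RingProperties ring using (-0#≈0#)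

  private variable
    x y r r′ c c′ j e : Level
    X : Set x
    Y : Set y
    R : Set r
    R′ : Set r′
    C : Set c
    C′ : Set c′
    J : Set j
    E : Set e

  ∑ : List X → (X → Carrier) → Carrier
  ∑ xs f = sumList (map f xs)

  ∑-cong : ∀ (xs : List X) {f g : X → Carrier} → (∀ x → f x ≈ g x) → ∑ xs f ≈ ∑ xs g
  ∑-cong []       h = refl
  ∑-cong (x ∷ xs) h = +-cong (h x) (∑-cong xs h)

  ∑-0 : ∀ (xs : List X) {f : X → Carrier} → (∀ x → f x ≈ 0#) → ∑ xs f ≈ 0#
  ∑-0 []       h = refl
  ∑-0 (x ∷ xs) h = trans (+-cong (h x) (∑-0 xs h)) (+-identityˡ 0#)

  ∑-+ : ∀ (xs : List X) (f g : X → Carrier) → ∑ xs (λ x → f x + g x) ≈ ∑ xs f + ∑ xs g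
  ∑-+ []       f g = sym (+-identityˡ 0#)
  ∑-+ (x ∷ xs) f g = trans (+-congˡ (∑-+ xs f g))
    (solve 4 (λ a b c d → a :+ b :+ (c :+ d) := a :+ c :+ (b :+ d)) refl _ _ _ _)

  ∑-distribˡ : ∀ (xs : List X) c (f : X → Carrier) → c * ∑ xs f ≈ ∑ xs (λ x → c * f x)
  ∑-distribˡ []       c f = zeroʳ c
  ∑-distribˡ (x ∷ xs) c f = trans (distribˡ c _ _) (+-congˡ (∑-distribˡ xs c f))

  ∑-++ : ∀ (xs ys : List X) (f : X → Carrier) → ∑ (xs ++ ys) f ≈ ∑ xs f + ∑ ys f
  ∑-++ []       ys f = sym (+-identityˡ _)
  ∑-++ (x ∷ xs) ys f = trans (+-congˡ (∑-++ xs ys f)) (sym (+-assoc _ _ _))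

  ∑-map : ∀ (g : X → Y) (xs : List X) (f : Y → Carrier) → ∑ (map g xs) f ≡ ∑ xs (f ∘ g)
  ∑-map g xs f = ≡.cong sumList (≡.sym (List.map-∘ xs))

  -- alt f [x₀, …, x_k] = Σᵢ (-1)ⁱ f xᵢ [x₀, …, x_k without xᵢ].
  alt : (X → List X → Carrier) → List X → Carrier
  alt f []       = 0#
  alt f (x ∷ xs) = f x xs - alt (λ y ys → f y (x ∷ ys)) xs

  alt-cong : ∀ {f g : X → List X → Carrier} xs → (∀ y ys → f y ys ≈ g y ys) → alt f xs ≈ alt g xs
  alt-cong []       h = refl
  alt-cong (x ∷ xs) h = +-cong (h x xs) (-‿cong (alt-cong xs (λ y ys → h y (x ∷ ys))))

  alt-0 : ∀ {f : X → List X → Carrier} xs → (∀ y ys → f y ys ≈ 0#) → alt f xs ≈ 0#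
  alt-0 []       h = refl
  alt-0 (x ∷ xs) h = trans (+-cong (h x xs) (-‿cong (alt-0 xs (λ y ys → h y (x ∷ ys)))))
    (-‿inverseʳ 0#)

  alt-- : ∀ (f g : X → List X → Carrier) xs →
          alt (λ y ys → f y ys - g y ys) xs ≈ alt f xs - alt g xs
  alt-- f g []       = sym (-‿inverseʳ 0#)
  alt-- f g (x ∷ xs) = trans (+-congˡ (-‿cong (alt-- _ _ xs)))
    (solve 4 (λ a b c d → a :- b :- (c :- d) := a :- c :- (b :- d)) refl _ _ _ _)

  alt-+ : ∀ (f g : X → List X → Carrier) xs →
          alt (λ y ys → f y ys + g y ys) xs ≈ alt f xs + alt g xs
  alt-+ f g []       = sym (+-identityʳ 0#)
  alt-+ f g (x ∷ xs) = trans (+-congˡ (-‿cong (alt-+ _ _ xs)))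
    (solve 4 (λ a b c d → a :+ b :- (c :+ d) := a :- c :+ (b :- d)) refl _ _ _ _)

  alt-* : ∀ c (f : X → List X → Carrier) xs → c * alt f xs ≈ alt (λ y ys → c * f y ys) xs
  alt-* c f []       = zeroʳ c
  alt-* c f (x ∷ xs) = trans
    (solve 3 (λ c a b → c :* (a :- b) := c :* a :- c :* b) refl c _ _)
    (+-congˡ (-‿cong (alt-* c _ xs)))

  alt-neg : ∀ (f : X → List X → Carrier) xs → alt (λ y ys → - f y ys) xs ≈ - alt f xs
  alt-neg f []       = sym -0#≈0#
  alt-neg f (x ∷ xs) = trans (+-congˡ (-‿cong (alt-neg _ xs)))
    (solve 2 (λ a b → :- a :- :- b := :- (a :- b)) refl _ _)

  alt-comm : ∀ (h : X → List X → Y → List Y → Carrier) xs ys →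
             alt (λ x xs′ → alt (h x xs′) ys) xs ≈
             alt (λ y ys′ → alt (λ x xs′ → h x xs′ y ys′) xs) ys
  alt-comm h []       ys = sym (alt-0 ys λ _ _ → refl)
  alt-comm h (x ∷ xs) ys = trans (+-congˡ (-‿cong (alt-comm _ xs ys))) (sym (alt-- _ _ ys))

  alt-∑ : ∀ (ks : List E) (f : E → X → List X → Carrier) xs →
          alt (λ y ys → ∑ ks (λ k → f k y ys)) xs ≈ ∑ ks (λ k → alt (f k) xs)
  alt-∑ []       f xs = alt-0 xs λ _ _ → refl
  alt-∑ (k ∷ ks) f xs = trans (alt-+ _ _ xs) (+-congˡ (alt-∑ ks f xs))

  alt-map : ∀ (g : X → Y) (f : Y → List Y → Carrier) xs →
            alt f (map g xs) ≈ alt (λ x xs′ → f (g x) (map g xs′)) xs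
  alt-map g f []       = refl
  alt-map g f (x ∷ xs) = +-congˡ (-‿cong (alt-map g _ xs))

  -- Non-square matrices get the value 0.
  D : (R → C → Carrier) → List R → List C → Carrier
  D e []       []      = 1#
  D e []       (_ ∷ _) = 0#
  D e (r ∷ rs) cs      = alt (λ c cs′ → e r c * D e rs cs′) cs

  D-cong : ∀ {e e′ : R → C → Carrier} rs cs → (∀ r c → e r c ≈ e′ r c) → D e rs cs ≈ D e′ rs cs
  D-cong []       []       h = refl
  D-cong []       (_ ∷ _)  h = refl
  D-cong (r ∷ rs) cs h = alt-cong cs λ c cs′ → *-cong (h r c) (D-cong rs cs′ h)

  D-map : ∀ (e : R → C → Carrier) (g : R′ → R) (h : C′ → C) rs cs →
          D e (map g rs) (map h cs) ≈ D (λ r c → e (g r) (h c)) rs cs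
  D-map e g h []       []       = refl
  D-map e g h []       (_ ∷ _)  = refl
  D-map e g h (r ∷ rs) cs       = trans (alt-map h _ cs)
    (alt-cong cs λ c cs′ → *-congˡ (D-map e g h rs cs′))

  -- The corner term is common to the row and the column expansion. In all other terms the remaining
  -- minor is expanded along the column by induction, and `alt-comm` interchanges the two
  -- alternating sums.
  D-expandColumn : ∀ (e : R → C → Carrier) rs c cs →
                   D e rs (c ∷ cs) ≈ alt (λ r rs′ → e r c * D e rs′ cs) rs
  D-expandColumn e []       c cs = refl
  D-expandColumn e (r ∷ rs) c cs = +-congˡ (-‿cong (begin
    alt (λ c′ cs′ → e r c′ * D e rs (c ∷ cs′)) cs
      ≈⟨ alt-cong cs (λ c′ cs′ → *-congˡ (D-expandColumn e rs c cs′)) ⟩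
    alt (λ c′ cs′ → e r c′ * alt (λ r′ rs′ → e r′ c * D e rs′ cs′) rs) cs
      ≈⟨ alt-cong cs (λ c′ cs′ → alt-* _ _ rs) ⟩
    alt (λ c′ cs′ → alt (λ r′ rs′ → e r c′ * (e r′ c * D e rs′ cs′)) rs) cs
      ≈⟨ alt-comm _ cs rs ⟩
    alt (λ r′ rs′ → alt (λ c′ cs′ → e r c′ * (e r′ c * D e rs′ cs′)) cs) rs
      ≈⟨ alt-cong rs (λ r′ rs′ → trans
           (alt-cong cs λ c′ cs′ → solve 3 (λ a b c → a :* (b :* c) := b :* (a :* c)) refl _ _ _)
           (sym (alt-* _ _ cs))) ⟩
    alt (λ r′ rs′ → e r′ c * alt (λ c′ cs′ → e r c′ * D e rs′ cs′) cs) rs ∎))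

  D-transpose : ∀ (e : R → C → Carrier) rs cs → D e rs cs ≈ D (flip e) cs rs
  D-transpose e []       []       = refl
  D-transpose e (r ∷ rs) []       = refl
  D-transpose e rs       (c ∷ cs) = trans (D-expandColumn e rs c cs)
    (alt-cong rs λ r rs′ → *-congˡ (D-transpose e rs′ cs))

  D-scaleRows : ∀ (s : R → Carrier) (e : R → C → Carrier) rs cs →
                D (λ r c → s r * e r c) rs cs ≈ List.foldr (λ r → s r *_) 1# rs * D e rs cs
  D-scaleRows s e []       []       = sym (*-identityˡ 1#)
  D-scaleRows s e []       (_ ∷ _)  = sym (zeroʳ 1#)
  D-scaleRows s e (r ∷ rs) cs = trans
    (alt-cong cs λ c cs′ → trans (*-congˡ (D-scaleRows s e rs cs′))
      (solve 4 (λ a b c d → a :* b :* (c :* d) := a :* c :* (b :* d)) refl _ _ _ _))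
    (sym (alt-* _ _ cs))

  -- Only neighbouring entries are exchanged, which is what an induction through `alt` can deliver;
  -- longer moves follow in `alternating-move`.
  record Alternating {C : Set c} (F : List C → Carrier) : Set (c Level.⊔ ℓ₁) where
    constructor alternates
    field
      negates : ∀ pre x y post → F (pre ++ x ∷ y ∷ post) ≈ - F (pre ++ y ∷ x ∷ post)

  open Alternating

  -- The terms that remove `x` and `y` themselves trade places, at neighbouring positions and hence
  -- with opposite signs; all other terms change sign by the hypothesis on `f`.
  alt-alternating : ∀ {x y : C} (f : C → List C → Carrier) →
    (∀ c pre post → f c (pre ++ x ∷ y ∷ post) ≈ - f c (pre ++ y ∷ x ∷ post)) →
    ∀ pre post → alt f (pre ++ x ∷ y ∷ post) ≈ - alt f (pre ++ y ∷ x ∷ post)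
  alt-alternating f h [] post = trans
    (+-congˡ (-‿cong (+-congˡ (-‿cong (trans (alt-cong post (λ c cs → h c [] cs)) (alt-neg _ post))))))
    (solve 3 (λ a b c → a :- (b :- :- c) := :- (b :- (a :- c))) refl _ _ _)
  alt-alternating f h (c ∷ pre) post = trans
    (+-cong (h c pre post) (-‿cong (alt-alternating _ (λ c′ pre′ → h c′ (c ∷ pre′)) pre post)))
    (solve 2 (λ a b → :- a :- :- b := :- (a :- b)) refl _ _)

  D-alternating : ∀ (e : R → C → Carrier) rs → Alternating (D e rs)
  D-alternating e []       .negates []      x y post = sym -0#≈0#
  D-alternating e []       .negates (_ ∷ _) x y post = sym -0#≈0#
  D-alternating e (r ∷ rs) .negates pre x y post = alt-alternating _
    (λ c pre′ post′ → trans (*-congˡ (D-alternating e rs .negates pre′ x y post′))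
      (solve 2 (λ a b → a :* :- b := :- (a :* b)) refl _ _)) pre post

  parity : ℕ → Carrier
  parity k = sgn (-1^ k)

  module _ {c} {C : Set c} {F : List C → Carrier} (alternating : Alternating F) where

    alternating-∷ : ∀ c → Alternating (F ∘ (c ∷_))
    alternating-∷ c .negates pre = alternating .negates (c ∷ pre)

    alternating-move : ∀ pre x mid post →
      F (pre ++ x ∷ mid ++ post) ≈ parity (length mid) * F (pre ++ mid ++ x ∷ post)
    alternating-move pre x []        post = sym (*-identityˡ _)
    alternating-move pre x (y ∷ mid) post = begin
      F (pre ++ x ∷ y ∷ mid ++ post)
        ≈⟨ alternating .negates pre x y (mid ++ post) ⟩
      - F (pre ++ y ∷ x ∷ mid ++ post)
        ≡⟨ ≡.cong (-_ ∘ F) (List.++-assoc pre (y ∷ []) _) ⟨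
      - F ((pre ++ y ∷ []) ++ x ∷ mid ++ post)
        ≈⟨ -‿cong (alternating-move (pre ++ y ∷ []) x mid post) ⟩
      - (parity (length mid) * F ((pre ++ y ∷ []) ++ mid ++ x ∷ post))
        ≡⟨ ≡.cong (λ zs → - (parity (length mid) * F zs)) (List.++-assoc pre (y ∷ []) _) ⟩
      - (parity (length mid) * F (pre ++ y ∷ mid ++ x ∷ post))
        ≈⟨ solve 2 (λ a b → :- (a :* b) := (:- a) :* b) refl _ _ ⟩
      (- parity (length mid)) * F (pre ++ y ∷ mid ++ x ∷ post)
        ≈⟨ *-congʳ (sgn-opposite (-1^ (length mid))) ⟨
      parity (suc (length mid)) * F (pre ++ y ∷ mid ++ x ∷ post) ∎

    alternating-repeat : ∀ pre x mid post → F (pre ++ x ∷ mid ++ x ∷ post) ≈ 0#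
    alternating-repeat pre x mid post = begin
      F (pre ++ x ∷ mid ++ x ∷ post)
        ≈⟨ alternating-move pre x mid (x ∷ post) ⟩
      parity (length mid) * F (pre ++ mid ++ x ∷ x ∷ post)
        ≡⟨ ≡.cong (λ zs → parity (length mid) * F zs) (List.++-assoc pre mid _) ⟨
      parity (length mid) * F ((pre ++ mid) ++ x ∷ x ∷ post)
        ≈⟨ *-congˡ (x≈-x⇒x≈0 (alternating .negates (pre ++ mid) x x post)) ⟩
      parity (length mid) * 0#
        ≈⟨ zeroʳ _ ⟩
      0# ∎

    alternating-∈ : ∀ {x xs} → x ∈ xs → F (x ∷ xs) ≈ 0#
    alternating-∈ {x} x∈xs with ∈-∃++ x∈xs
    ... | mid , post , ≡.refl = alternating-repeat [] x mid post

  D-linear-head : ∀ (e : R → C → Carrier) (ks : List E) (q : E → Carrier) (g : E → C) c →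
    (∀ r → e r c ≈ ∑ ks (λ k → q k * e r (g k))) →
    ∀ rs cs → D e rs (c ∷ cs) ≈ ∑ ks (λ k → q k * D e rs (g k ∷ cs))
  D-linear-head e ks q g c h []       cs = sym (∑-0 ks λ k → zeroʳ (q k))
  D-linear-head e ks q g c h (r ∷ rs) cs = begin
    e r c * D e rs cs - alt (λ c′ cs′ → e r c′ * D e rs (c ∷ cs′)) cs
      ≈⟨ +-cong (trans (*-congʳ (h r)) (trans (*-comm _ _) (∑-distribˡ ks _ _)))
                (trans (-‿cong (trans (alt-cong cs λ c′ cs′ → trans (*-congˡ (D-linear-head e ks q g c h rs cs′))
                                        (∑-distribˡ ks _ _))
                               (alt-∑ ks _ cs)))
                       (trans (solve 1 (λ x → :- x := (:- con 1ℤ) :* x) refl _) (∑-distribˡ ks _ _))) ⟩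
    ∑ ks (λ k → D e rs cs * (q k * e r (g k))) +
    ∑ ks (λ k → - 1# * alt (λ c′ cs′ → e r c′ * (q k * D e rs (g k ∷ cs′))) cs)
      ≈⟨ ∑-+ ks _ _ ⟨
    ∑ ks (λ k → D e rs cs * (q k * e r (g k)) + - 1# * alt (λ c′ cs′ → e r c′ * (q k * D e rs (g k ∷ cs′))) cs)
      ≈⟨ ∑-cong ks (λ k → trans
          (+-congˡ (*-congˡ (trans
            (alt-cong cs λ c′ cs′ → solve 3 (λ a b c → a :* (b :* c) := b :* (a :* c)) refl _ _ _)
            (sym (alt-* (q k) _ cs)))))
          (solve 4 (λ d q e x → d :* (q :* e) :+ (:- con 1ℤ) :* (q :* x) := q :* (e :* d :- x)) refl _ _ _ _)) ⟩
    ∑ ks (λ k → q k * (e r (g k) * D e rs cs - alt (λ c′ cs′ → e r c′ * D e rs (g k ∷ cs′)) cs)) ∎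

  -- The column is moved to the front, where the row expansion isolates it, and back again; both
  -- moves cost the same sign.
  D-linear : ∀ (e : R → C → Carrier) (ks : List E) (q : E → Carrier) (g : E → C) c →
    (∀ r → e r c ≈ ∑ ks (λ k → q k * e r (g k))) →
    ∀ rs pre post → D e rs (pre ++ c ∷ post) ≈ ∑ ks (λ k → q k * D e rs (pre ++ g k ∷ post))
  D-linear e ks q g c h rs pre post = begin
    D e rs (pre ++ c ∷ post)
      ≈⟨ toHead c ⟩
    s * D e rs (c ∷ pre ++ post)
      ≈⟨ *-congˡ (D-linear-head e ks q g c h rs (pre ++ post)) ⟩
    s * ∑ ks (λ k → q k * D e rs (g k ∷ pre ++ post))
      ≈⟨ ∑-distribˡ ks s _ ⟩
    ∑ ks (λ k → s * (q k * D e rs (g k ∷ pre ++ post)))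
      ≈⟨ ∑-cong ks (λ k → trans (solve 3 (λ a b c → a :* (b :* c) := b :* (a :* c)) refl _ _ _)
                                (*-congˡ (sym (toHead (g k))))) ⟩
    ∑ ks (λ k → q k * D e rs (pre ++ g k ∷ post)) ∎
    where
    s = parity (length pre)
    toHead : ∀ c → D e rs (pre ++ c ∷ post) ≈ s * D e rs (c ∷ pre ++ post)
    toHead c = begin
      D e rs (pre ++ c ∷ post)             ≈⟨ *-identityˡ _ ⟨
      1# * D e rs (pre ++ c ∷ post)        ≈⟨ *-congʳ (sgn-square (-1^ (length pre))) ⟨
      s * s * D e rs (pre ++ c ∷ post)     ≈⟨ *-assoc _ _ _ ⟩
      s * (s * D e rs (pre ++ c ∷ post))
        ≈⟨ *-congˡ (alternating-move (D-alternating e rs) [] c pre post) ⟨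
      s * D e rs (c ∷ pre ++ post)         ∎

  choose : List E → ℕ → List (List E)
  choose xs       zero    = [] ∷ []
  choose []       (suc k) = []
  choose (x ∷ xs) (suc k) = map (x ∷_) (choose xs k) ++ choose xs (suc k)

  sel : (X → List X → Carrier) → List X → Carrier
  sel f []       = 0#
  sel f (x ∷ xs) = f x xs + sel (λ y ys → f y (x ∷ ys)) xs

  -- A pair of an element and a k-set contributes nothing if the element lies in the set. The other
  -- pairs are the (k+1)-sets with one element singled out, which is what `sel` sums over.
  ∑-choose-suc : ∀ (xs : List E) k (H : E → List E → Carrier) → (∀ {e 𝔷} → e ∈ 𝔷 → H e 𝔷 ≈ 0#) →
    ∑ xs (λ e → ∑ (choose xs k) (H e)) ≈ ∑ (choose xs (suc k)) (sel H)
  ∑-choose-suc [] k H h = refl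
  ∑-choose-suc (x ∷ xs) zero H h = +-congˡ (∑-choose-suc xs zero H h)
  ∑-choose-suc (x ∷ xs) (suc k) H h = begin
    ∑ (choose (x ∷ xs) (suc k)) (H x) + ∑ xs (λ e → ∑ (choose (x ∷ xs) (suc k)) (H e))
      ≈⟨ +-cong (split x) (trans (∑-cong xs split) (∑-+ xs _ _)) ⟩
    ∑ (choose xs k) (H x ∘ (x ∷_)) + ∑ (choose xs (suc k)) (H x) +
    (∑ xs (λ e → ∑ (choose xs k) (H e ∘ (x ∷_))) + ∑ xs (λ e → ∑ (choose xs (suc k)) (H e)))
      ≈⟨ +-cong (trans (+-congʳ (∑-0 (choose xs k) (λ _ → h (here ≡.refl)))) (+-identityˡ _))
                (+-cong (∑-choose-suc xs k (λ e → H e ∘ (x ∷_)) (λ e∈𝔷 → h (there e∈𝔷)))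
                        (∑-choose-suc xs (suc k) H h)) ⟩
    ∑ (choose xs (suc k)) (H x) +
    (∑ (choose xs (suc k)) (sel (λ e → H e ∘ (x ∷_))) + ∑ (choose xs (suc (suc k))) (sel H))
      ≈⟨ +-assoc _ _ _ ⟨
    ∑ (choose xs (suc k)) (H x) +
    ∑ (choose xs (suc k)) (sel (λ e → H e ∘ (x ∷_))) + ∑ (choose xs (suc (suc k))) (sel H)
      ≈⟨ +-congʳ (∑-+ (choose xs (suc k)) _ _) ⟨
    ∑ (choose xs (suc k)) (λ 𝔷 → sel H (x ∷ 𝔷)) + ∑ (choose xs (suc (suc k))) (sel H)
      ≡⟨ ≡.cong (_+ ∑ (choose xs (suc (suc k))) (sel H)) (∑-map (x ∷_) (choose xs (suc k)) (sel H)) ⟨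
    ∑ (map (x ∷_) (choose xs (suc k))) (sel H) + ∑ (choose xs (suc (suc k))) (sel H)
      ≈⟨ ∑-++ (map (x ∷_) (choose xs (suc k))) _ _ ⟨
    ∑ (choose (x ∷ xs) (suc (suc k))) (sel H) ∎
    where
    split : ∀ e → ∑ (choose (x ∷ xs) (suc k)) (H e) ≈
                  ∑ (choose xs k) (H e ∘ (x ∷_)) + ∑ (choose xs (suc k)) (H e)
    split e = trans (∑-++ (map (x ∷_) (choose xs k)) _ (H e))
      (+-congʳ (reflexive (∑-map (x ∷_) (choose xs k) (H e))))

  -- Returning the singled-out element from the front of `F` to its own place costs (-1) to its
  -- index, exactly the sign that turns the unsigned `sel` into `alt`.
  sel-alternating : ∀ {F : List C → Carrier} → Alternating F → ∀ (f : C → List C → Carrier) 𝔷 →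
    sel (λ e 𝔷′ → f e 𝔷′ * F (e ∷ 𝔷′)) 𝔷 ≈ F 𝔷 * alt f 𝔷
  sel-alternating {F = F} alternating f [] = sym (zeroʳ _)
  sel-alternating {F = F} alternating f (x ∷ xs) = begin
    f x xs * F (x ∷ xs) + sel (λ e 𝔷′ → f e (x ∷ 𝔷′) * F (e ∷ x ∷ 𝔷′)) xs
      ≈⟨ +-congˡ (sel-cong xs) ⟩
    f x xs * F (x ∷ xs) + sel (λ e 𝔷′ → (- f e (x ∷ 𝔷′)) * F (x ∷ e ∷ 𝔷′)) xs
      ≈⟨ +-congˡ (sel-alternating (alternating-∷ alternating x) (λ e 𝔷′ → - f e (x ∷ 𝔷′)) xs) ⟩
    f x xs * F (x ∷ xs) + F (x ∷ xs) * alt (λ e 𝔷′ → - f e (x ∷ 𝔷′)) xs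
      ≈⟨ +-congˡ (*-congˡ (alt-neg _ xs)) ⟩
    f x xs * F (x ∷ xs) + F (x ∷ xs) * (- alt (λ e 𝔷′ → f e (x ∷ 𝔷′)) xs)
      ≈⟨ +-congʳ (*-comm _ _) ⟩
    F (x ∷ xs) * f x xs + F (x ∷ xs) * (- alt (λ e 𝔷′ → f e (x ∷ 𝔷′)) xs)
      ≈⟨ distribˡ _ _ _ ⟨
    F (x ∷ xs) * alt f (x ∷ xs) ∎
    where
    sel-cong′ : ∀ {g h : C → List C → Carrier} ys → (∀ y zs → g y zs ≈ h y zs) → sel g ys ≈ sel h ys
    sel-cong′ []       eq = refl
    sel-cong′ (y ∷ ys) eq = +-cong (eq y ys) (sel-cong′ ys λ z zs → eq z (y ∷ zs))
    sel-cong : ∀ ys → sel (λ e 𝔷′ → f e (x ∷ 𝔷′) * F (e ∷ x ∷ 𝔷′)) ys ≈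
                      sel (λ e 𝔷′ → (- f e (x ∷ 𝔷′)) * F (x ∷ e ∷ 𝔷′)) ys
    sel-cong ys = sel-cong′ ys λ e zs → trans (*-congˡ (alternating .negates [] e x zs))
      (solve 2 (λ a b → a :* :- b := (:- a) :* b) refl _ _)

  -- The full expansion of a multilinear expression: one summand for every word in `xs` of the
  -- length of the index list, repetitions included.
  multiSum : List E → (J → E → Carrier) → List J → (List E → Carrier) → Carrier
  multiSum xs Q []       F = F []
  multiSum xs Q (j ∷ js) F = ∑ xs (λ e → Q j e * multiSum xs Q js (F ∘ (e ∷_)))

  -- Words with a repeated entry drop out, and the orderings of one and the same set combine, with
  -- their signs, to a determinant of `Q`.
  multiSum-alternating : ∀ (xs : List E) (Q : J → E → Carrier) js {F : List E → Carrier} → Alternating F →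
    multiSum xs Q js F ≈ ∑ (choose xs (length js)) (λ 𝔷 → F 𝔷 * D Q js 𝔷)
  multiSum-alternating xs Q []       {F} alternating = sym (trans (+-identityʳ _) (*-identityʳ _))
  multiSum-alternating xs Q (j ∷ js) {F} alternating = begin
    ∑ xs (λ e → Q j e * multiSum xs Q js (F ∘ (e ∷_)))
      ≈⟨ ∑-cong xs (λ e → trans (*-congˡ (multiSum-alternating xs Q js (alternating-∷ alternating e)))
                                (trans (∑-distribˡ (choose xs (length js)) _ _)
                                       (∑-cong (choose xs (length js)) λ 𝔷 →
                                         solve 3 (λ a b c → a :* (b :* c) := a :* c :* b) refl _ _ _))) ⟩
    ∑ xs (λ e → ∑ (choose xs (length js)) (λ 𝔷 → Q j e * D Q js 𝔷 * F (e ∷ 𝔷)))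
      ≈⟨ ∑-choose-suc xs (length js) _ (λ e∈𝔷 → trans (*-congˡ (alternating-∈ alternating e∈𝔷)) (zeroʳ _)) ⟩
    ∑ (choose xs (suc (length js))) (sel (λ e 𝔷 → Q j e * D Q js 𝔷 * F (e ∷ 𝔷)))
      ≈⟨ ∑-cong (choose xs (suc (length js))) (λ 𝔷 → sel-alternating alternating _ 𝔷) ⟩
    ∑ (choose xs (suc (length js))) (λ 𝔷 → F 𝔷 * D Q (j ∷ js) 𝔷) ∎

  -- Columns are vectors rather than indices here, so that a linear combination of columns is again
  -- a column.
  columnD : List R → List (R → Carrier) → Carrier
  columnD = D (λ r c → c r)

  columnD-multiSum : ∀ (xs : List E) (Q : J → E → Carrier) (P : E → R → Carrier) (B : J → R → Carrier) →
    (∀ j r → B j r ≈ ∑ xs (λ e → Q j e * P e r)) → ∀ rs js pre →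
    columnD rs (pre ++ map B js) ≈ multiSum xs Q js (λ 𝔷 → columnD rs (pre ++ map P 𝔷))
  columnD-multiSum xs Q P B h rs []       pre = refl
  columnD-multiSum xs Q P B h rs (j ∷ js) pre = begin
    columnD rs (pre ++ B j ∷ map B js)
      ≈⟨ D-linear (λ r c → c r) xs (Q j) P (B j) (h j) rs pre (map B js) ⟩
    ∑ xs (λ e → Q j e * columnD rs (pre ++ P e ∷ map B js))
      ≈⟨ ∑-cong xs (λ e → *-congˡ (begin
          columnD rs (pre ++ P e ∷ map B js)
            ≡⟨ ≡.cong (columnD rs) (List.++-assoc pre (P e ∷ []) _) ⟨
          columnD rs ((pre ++ P e ∷ []) ++ map B js)
            ≈⟨ columnD-multiSum xs Q P B h rs js (pre ++ P e ∷ []) ⟩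
          multiSum xs Q js (λ 𝔷 → columnD rs ((pre ++ P e ∷ []) ++ map P 𝔷))
            ≈⟨ multiSum-cong js (λ 𝔷 → reflexive (≡.cong (columnD rs) (List.++-assoc pre (P e ∷ []) _))) ⟩
          multiSum xs Q js (λ 𝔷 → columnD rs (pre ++ P e ∷ map P 𝔷)) ∎)) ⟩
    multiSum xs Q (j ∷ js) (λ 𝔷 → columnD rs (pre ++ map P 𝔷)) ∎
    where
    multiSum-cong : ∀ js {F G : List _ → Carrier} → (∀ 𝔷 → F 𝔷 ≈ G 𝔷) → multiSum xs Q js F ≈ multiSum xs Q js G
    multiSum-cong []       eq = eq []
    multiSum-cong (j ∷ js) eq = ∑-cong xs λ e → *-congˡ (multiSum-cong js λ 𝔷 → eq (e ∷ 𝔷))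

  -- The columns of `B` are expanded multilinearly in those of `P`; the result is alternating in the
  -- chosen columns, so the expansion collapses to a sum over sets.
  cauchyBinet : ∀ (xs : List E) (Q : J → E → Carrier) (P : E → R → Carrier) (B : J → R → Carrier) →
    (∀ j r → B j r ≈ ∑ xs (λ e → Q j e * P e r)) → ∀ rs js →
    D (λ r j → B j r) rs js ≈ ∑ (choose xs (length js)) (λ 𝔷 → D (λ r e → P e r) rs 𝔷 * D Q js 𝔷)
  cauchyBinet xs Q P B h rs js = begin
    D (λ r j → B j r) rs js
      ≈⟨ toColumns B js ⟨
    columnD rs (map B js)
      ≈⟨ columnD-multiSum xs Q P B h rs js [] ⟩
    multiSum xs Q js (λ 𝔷 → columnD rs (map P 𝔷))
      ≈⟨ multiSum-alternating xs Q js (alternates λ pre x y post → trans (toColumns P (pre ++ x ∷ y ∷ post))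
           (trans (D-alternating (λ r e → P e r) rs .negates pre x y post)
                  (-‿cong (sym (toColumns P (pre ++ y ∷ x ∷ post)))))) ⟩
    ∑ (choose xs (length js)) (λ 𝔷 → columnD rs (map P 𝔷) * D Q js 𝔷)
      ≈⟨ ∑-cong (choose xs (length js)) (λ 𝔷 → *-congʳ (toColumns P 𝔷)) ⟩
    ∑ (choose xs (length js)) (λ 𝔷 → D (λ r e → P e r) rs 𝔷 * D Q js 𝔷) ∎
    where
    toColumns : ∀ {k} {K : Set k} (G : K → _ → Carrier) ks → columnD rs (map G ks) ≈ D (λ r k → G k r) rs ks
    toColumns G ks = trans (reflexive (≡.cong (λ rs′ → columnD rs′ (map G ks)) (≡.sym (List.map-id rs))))
      (D-map (λ r c → c r) (λ r → r) G rs ks)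

-- Letter counts and block determinants.

module Filters where
  private variable
    x y p : Level
    X : Set x
    Y : Set y

  filter-map-length : ∀ {P : Y → Set p} (P? : Decidable P) (f : X → Y) xs →
                      length (filter P? (map f xs)) ≡ length (filter (λ x → P? (f x)) xs)
  filter-map-length P? f [] = ≡.refl
  filter-map-length P? f (x ∷ xs) with P? (f x)
  ... | yes _ = ≡.cong suc (filter-map-length P? f xs)
  ... | no _  = filter-map-length P? f xs

  filter-length-↭ : ∀ {P : X → Set p} (P? : Decidable P) {xs ys} → xs ↭ ys →
                    length (filter P? xs) ≡ length (filter P? ys)
  filter-length-↭ P? ↭.refl = ≡.refl
  filter-length-↭ P? (↭.prep x h) with P? x
  ... | yes _ = ≡.cong suc (filter-length-↭ P? h)
  ... | no _  = filter-length-↭ P? h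
  filter-length-↭ P? {xs = _ ∷ _ ∷ xs} {ys = _ ∷ _ ∷ ys} (↭.swap x y h) with does (P? x) in ex | does (P? y) in ey
  ... | true  | true  rewrite ex | ey = ≡.cong (suc ∘ suc) (filter-length-↭ P? h)
  ... | true  | false rewrite ex | ey = ≡.cong suc (filter-length-↭ P? h)
  ... | false | true  rewrite ex | ey = ≡.cong suc (filter-length-↭ P? h)
  ... | false | false rewrite ex | ey = filter-length-↭ P? h
  filter-length-↭ P? (↭.trans h k) = ≡.trans (filter-length-↭ P? h) (filter-length-↭ P? k)

  AllPairs-remove : ∀ {R : X → X → Set p} xs {y ys} → AllPairs R (xs ++ y ∷ ys) → AllPairs R (xs ++ ys)
  AllPairs-remove []       (_ ∷ ps) = ps
  AllPairs-remove (x ∷ xs) (h ∷ ps) =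
    All.++⁺ (All.++⁻ˡ xs h) (All.tail (All.++⁻ʳ xs h)) ∷ AllPairs-remove xs ps

  module _ {n} {X : Set x} (f : X → Fin n) where

    at : Fin n → List X → List X
    at i = filter (λ x → f x Fin.≟ i)

    below : Fin n → List X → List X
    below s = filter (λ x → f x Fin.<? s)

    inv : List X → ℕ
    inv []       = 0
    inv (x ∷ xs) = length (below (f x) xs) ℕ.+ inv xs

    Sorted : List X → Set x
    Sorted = AllPairs (λ x y → f x Fin.≤ f y)

    record Split (s : Fin n) (xs : List X) : Set x where
      constructor split
      field
        {lower block upper} : List X
        lower< : All (λ x → f x Fin.< s) lower
        block≡ : All (λ x → f x ≡ s) block
        upper> : All (λ x → s Fin.< f x) upper
        whole  : xs ≡ lower ++ block ++ upper

    sorted-split : ∀ s {xs} → Sorted xs → Split s xs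
    sorted-split s [] = split [] [] [] ≡.refl
    sorted-split s {x ∷ xs} (h ∷ hs) with Fin.<-cmp (f x) s | sorted-split s hs
    ... | tri< x<s _ _ | split l b u ≡.refl = split (x<s ∷ l) b u ≡.refl
    ... | tri≈ _ ≡.refl _ | split [] b u ≡.refl = split [] (≡.refl ∷ b) u ≡.refl
    ... | tri≈ _ ≡.refl _ | split (l<s ∷ _) b u ≡.refl = ⊥-elim (ℕ.<⇒≱ l<s (All.head h))
    ... | tri> _ _ s<x | _ = split [] [] (s<x ∷ All.map (ℕ.<-≤-trans s<x) h) ≡.refl

    module _ {s : Fin n} {lower upper : List X} (l : All (λ x → f x Fin.< s) lower)
             (u : All (λ x → s Fin.< f x) upper) where

      below-split : ∀ {block} → All (λ x → f x ≡ s) block → below s (lower ++ block ++ upper) ≡ lower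
      below-split {block} b = begin
        below s (lower ++ block ++ upper)
          ≡⟨ List.filter-++ _ lower _ ⟩
        below s lower ++ below s (block ++ upper)
          ≡⟨ ≡.cong₂ _++_ (List.filter-all _ l)
              (List.filter-none _ (All.++⁺ (All.map (λ { ≡.refl → ℕ.<-irrefl ≡.refl }) b)
                                           (All.map (λ s<x x<s → ℕ.<-asym s<x x<s) u))) ⟩
        lower ++ []
          ≡⟨ List.++-identityʳ lower ⟩
        lower ∎
        where open import Relation.Binary.PropositionalEquality.Properties using (module ≡-Reasoning)
              open ≡-Reasoning

      at-split : ∀ {block} → All (λ x → f x ≡ s) block → at s (lower ++ block ++ upper) ≡ block
      at-split {block} b = begin
        at s (lower ++ block ++ upper)
          ≡⟨ List.filter-++ _ lower _ ⟩
        at s lower ++ at s (block ++ upper)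
          ≡⟨ ≡.cong₂ _++_ (List.filter-none _ (All.map (λ x<s eq → ℕ.<-irrefl (≡.cong Fin.toℕ eq) x<s) l))
                          (List.filter-++ _ block upper) ⟩
        at s block ++ at s upper
          ≡⟨ ≡.cong₂ _++_ (List.filter-all _ b)
               (List.filter-none _ (All.map (λ s<x eq → ℕ.<-irrefl (≡.cong Fin.toℕ (≡.sym eq)) s<x) u)) ⟩
        block ++ []
          ≡⟨ List.++-identityʳ block ⟩
        block ∎
        where open import Relation.Binary.PropositionalEquality.Properties using (module ≡-Reasoning)
              open ≡-Reasoning

    at-≢ : ∀ {s i} → i ≢ s → ∀ lower {block} upper → All (λ x → f x ≡ s) block →
           at i (lower ++ block ++ upper) ≡ at i (lower ++ upper)
    at-≢ {s} {i} i≢s lower {block} upper b = begin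
      at i (lower ++ block ++ upper)
        ≡⟨ List.filter-++ _ lower _ ⟩
      at i lower ++ at i (block ++ upper)
        ≡⟨ ≡.cong (at i lower ++_) (List.filter-++ _ block upper) ⟩
      at i lower ++ at i block ++ at i upper
        ≡⟨ ≡.cong (λ z → at i lower ++ z ++ at i upper)
             (List.filter-none _ (All.map (λ { ≡.refl eq → i≢s (≡.sym eq) }) b)) ⟩
      at i lower ++ at i upper
        ≡⟨ List.filter-++ _ lower upper ⟨
      at i (lower ++ upper) ∎
      where open import Relation.Binary.PropositionalEquality.Properties using (module ≡-Reasoning)
            open ≡-Reasoning

  counts⇒↭ : ∀ {n} {X : Set x} {Y : Set y} (f : X → Fin n) (g : Y → Fin n) xs ys →
    (∀ i → length (at f i xs) ≡ length (at g i ys)) → map f xs ↭ map g ys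
  counts⇒↭ f g [] [] h = ↭-refl
  counts⇒↭ f g [] (y ∷ ys) h =
    contradiction (≡.trans (h (g y)) (≡.cong length (List.filter-accept (λ z → g z Fin.≟ g y) {xs = ys} ≡.refl))) (λ ())
  counts⇒↭ {X = X} {Y} f g (x ∷ xs) ys h with at g (f x) ys in eq
  ... | [] = contradiction (≡.trans (≡.sym (≡.cong length (List.filter-accept (λ z → f z Fin.≟ f x) {xs = xs} ≡.refl)))
                                    (≡.trans (h (f x)) (≡.cong length eq))) (λ ())
  ... | z ∷ zs with ∈-filter⁻ (λ z → g z Fin.≟ f x) {xs = ys} (≡.subst (z ∈_) (≡.sym eq) (here ≡.refl))
  ...   | z∈ys , gz≡fx with ∈-∃++ z∈ys
  ...     | as , bs , ≡.refl = ↭-trans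
    (↭.prep (f x) (counts⇒↭ f g xs (as ++ bs) λ i →
      counts i (≡.trans (h i) (filter-length-↭ (λ w → g w Fin.≟ i) (↭.shift z as bs)))))
    (≡.subst (λ w → w ∷ map g (as ++ bs) ↭ map g (as ++ z ∷ bs)) gz≡fx
      (↭.map⁺ g (↭-sym (↭.shift z as bs))))
    where
    counts : ∀ i → length (at f i (x ∷ xs)) ≡ length (at g i (z ∷ as ++ bs)) →
             length (at f i xs) ≡ length (at g i (as ++ bs))
    counts i e with f x Fin.≟ i | g z Fin.≟ i
    ... | yes _ | yes _ = ℕ.suc-injective e
    ... | yes p | no q  = contradiction (≡.trans gz≡fx p) q
    ... | no p  | yes q = contradiction (≡.trans (≡.sym gz≡fx) q) p
    ... | no _  | no _  = e

open Filters

module BlockDeterminants {a ℓ₁ ℓ₂} (ℝ : CompleteOrderedField a ℓ₁ ℓ₂) where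
  open CompleteOrderedField ℝ hiding (zero)
  open OrderedField ℝ
  open Determinants ℝ
  open import Relation.Binary.Reasoning.Setoid setoid
  module ∏ = CommutativeMonoidSum *-commutativeMonoid

  private variable
    x : Level
    X : Set x

  parity-+ : ∀ k l → parity (k ℕ.+ l) ≈ parity k * parity l
  parity-+ zero    l = sym (*-identityˡ _)
  parity-+ (suc k) l = begin
    parity (suc (k ℕ.+ l))     ≈⟨ sgn-opposite (-1^ (k ℕ.+ l)) ⟩
    - parity (k ℕ.+ l)         ≈⟨ -‿cong (parity-+ k l) ⟩
    - (parity k * parity l)    ≈⟨ solve 2 (λ a b → :- (a :* b) := (:- a) :* b) refl _ _ ⟩
    (- parity k) * parity l    ≈⟨ *-congʳ (sgn-opposite (-1^ k)) ⟨
    parity (suc k) * parity l  ∎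

  -- Unlike `alt-cong` it remembers where the removed entry was, so that properties of the whole
  -- list can be restricted to what remains.
  alt-cong-∈ : ∀ {f g : X → List X → Carrier} xs →
    (∀ as y bs → xs ≡ as ++ y ∷ bs → f y (as ++ bs) ≈ g y (as ++ bs)) → alt f xs ≈ alt g xs
  alt-cong-∈ []       h = refl
  alt-cong-∈ (x ∷ xs) h = +-cong (h [] x xs ≡.refl)
    (-‿cong (alt-cong-∈ xs λ { as y bs ≡.refl → h (x ∷ as) y bs ≡.refl }))

  alt-++ : ∀ (f : X → List X → Carrier) xs ys → alt f (xs ++ ys) ≈
    alt (λ x xs′ → f x (xs′ ++ ys)) xs + parity (length xs) * alt (λ y ys′ → f y (xs ++ ys′)) ys
  alt-++ f []       ys = sym (trans (+-identityˡ _) (*-identityˡ _))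
  alt-++ f (x ∷ xs) ys = begin
    f x (xs ++ ys) - alt (λ y zs → f y (x ∷ zs)) (xs ++ ys)
      ≈⟨ +-congˡ (-‿cong (alt-++ _ xs ys)) ⟩
    f x (xs ++ ys) - (_ + parity (length xs) * _)
      ≈⟨ solve 4 (λ a b c d → a :- (b :+ c :* d) := a :- b :+ (:- c) :* d) refl _ _ _ _ ⟩
    f x (xs ++ ys) - _ + (- parity (length xs)) * _
      ≈⟨ +-congˡ (*-congʳ (sgn-opposite (-1^ (length xs)))) ⟨
    f x (xs ++ ys) - _ + parity (suc (length xs)) * _ ∎

  -- The constant is fixed before `g` is chosen: one and the same factor, made of the blocks other
  -- than `s`, serves every term of an expansion and its total.
  ∏-separate : ∀ {n} s (f : Fin n → Carrier) →
    ∃[ c ] ∀ g → (∀ i → i ≢ s → g i ≈ f i) → product g ≈ c * g s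
  ∏-separate {suc n} s f = product (f ∘ Fin.punchIn s) , λ g h →
    trans (∏.sum-remove {i = s} g) (trans (*-comm _ _)
      (*-congʳ (∏.sum-cong-≋ λ i → h (Fin.punchIn s i) (Fin.punchInᵢ≢i s i))))

  module _ {j e} {J : Set j} {E : Set e} {n} (v : J → Fin n) (ℓ : E → Fin n)
           (Q : J → E → Carrier) (Q-off : ∀ {j e} → v j ≢ ℓ e → Q j e ≈ 0#) where

    -- A nonzero term of the expansion would match rows with columns of the same letter, and so
    -- would exhibit the excluded permutation.
    D-mismatch : ∀ js 𝔷 → ¬ (map v js ↭ map ℓ 𝔷) → D Q js 𝔷 ≈ 0#
    D-mismatch []       []      h = contradiction ↭-refl h
    D-mismatch []       (_ ∷ _) h = refl
    D-mismatch (j ∷ js) 𝔷       h = trans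
      (alt-cong-∈ {g = λ _ _ → 0#} 𝔷 λ { as e bs ≡.refl → zero-term as e bs h })
      (alt-0 𝔷 λ _ _ → refl)
      where
      zero-term : ∀ as e bs → ¬ (map v (j ∷ js) ↭ map ℓ (as ++ e ∷ bs)) → Q j e * D Q js (as ++ bs) ≈ 0#
      zero-term as e bs h with v j Fin.≟ ℓ e
      ... | no v≢ℓ  = trans (*-congʳ (Q-off v≢ℓ)) (zeroˡ _)
      ... | yes v≡ℓ = trans (*-congˡ (D-mismatch js (as ++ bs) λ p → h
        (↭-trans (↭-trans (↭.prep (v j) p) (↭-reflexive (≡.cong (_∷ map ℓ (as ++ bs)) v≡ℓ)))
                 (↭.map⁺ ℓ (↭-sym (↭.shift e as bs)))))) (zeroʳ _)

    alt-block : ∀ {s j} (f : List E → Carrier) → v j ≡ s → (w : List E) (sp : Split ℓ s w) → let open Split sp in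
      alt (λ e w′ → Q j e * f w′) w ≈
      parity (length lower) * alt (λ e b → Q j e * f (lower ++ b ++ upper)) block
    alt-block {s} {j} f ≡.refl w (split {lower} {block} {upper} l b u ≡.refl) = begin
      alt F (lower ++ block ++ upper)
        ≈⟨ alt-++ F lower _ ⟩
      alt _ lower + parity (length lower) * alt (λ e w′ → F e (lower ++ w′)) (block ++ upper)
        ≈⟨ +-cong (vanish lower _ (All.map (λ x<s eq → ℕ.<-irrefl (≡.cong Fin.toℕ (≡.sym eq)) x<s) l))
                  (*-congˡ (trans (alt-++ _ block upper)
                    (trans (+-congˡ (trans (*-congˡ (vanish upper _
                              (All.map (λ s<x eq → ℕ.<-irrefl (≡.cong Fin.toℕ eq) s<x) u))) (zeroʳ _)))
                           (+-identityʳ _)))) ⟩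
      0# + parity (length lower) * alt (λ e b → Q j e * f (lower ++ b ++ upper)) block
        ≈⟨ +-identityˡ _ ⟩
      parity (length lower) * alt (λ e b → Q j e * f (lower ++ b ++ upper)) block ∎
      where
      F = λ e w′ → Q j e * f w′
      vanish : ∀ zs (k : List E → List E) → All (λ e → v j ≢ ℓ e) zs →
               alt (λ e zs′ → Q j e * f (k zs′)) zs ≈ 0#
      vanish []       k []      = refl
      vanish (z ∷ zs) k (h ∷ hs) = trans
        (+-cong (trans (*-congʳ (Q-off h)) (zeroˡ _)) (-‿cong (vanish zs (k ∘ (z ∷_)) hs)))
        (-‿inverseʳ 0#)

    -- The row of `j` meets only the columns of its own letter. Reaching them means passing all
    -- columns of smaller letters, one sign each; these are as many as the later rows with a smaller
    -- letter, which is the contribution of `j` to `inv`.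
    D-blocks : ∀ js 𝔷 → Sorted ℓ 𝔷 → map v js ↭ map ℓ 𝔷 →
      D Q js 𝔷 ≈ parity (inv v js) * product (λ i → D Q (at v i js) (at ℓ i 𝔷))
    D-blocks [] []      _ _ = sym (trans (*-identityˡ _) (∏1≈1 n))
      where
      ∏1≈1 : ∀ n → product {n} (λ _ → 1#) ≈ 1#
      ∏1≈1 zero    = refl
      ∏1≈1 (suc n) = trans (*-identityˡ _) (∏1≈1 n)
    D-blocks [] (_ ∷ _) _ p = contradiction (↭-sym p) ↭.¬x∷xs↭[]
    D-blocks (j ∷ js) 𝔷 sorted p with sorted-split ℓ (v j) sorted
    ... | sp@(split {lower} {block} {upper} l b u ≡.refl) = begin
      alt (λ e 𝔷′ → Q j e * D Q js 𝔷′) 𝔷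
        ≈⟨ alt-block (D Q js) ≡.refl 𝔷 sp ⟩
      parity (length lower) * alt (λ e b′ → Q j e * D Q js (lower ++ b′ ++ upper)) block
        ≈⟨ *-congˡ (alt-cong-∈ block λ { as e bs ≡.refl → term as e bs b p sorted }) ⟩
      parity (length lower) * alt (λ e b′ → (parity (inv v js) * c) * (Q j e * D Q (at v s js) b′)) block
        ≈⟨ *-congˡ (alt-* _ _ block) ⟨
      parity (length lower) * ((parity (inv v js) * c) * D Q (j ∷ at v s js) block)
        ≈⟨ solve 4 (λ x y z w → x :* (y :* z :* w) := x :* y :* (z :* w)) refl _ _ _ _ ⟩
      parity (length lower) * parity (inv v js) * (c * D Q (j ∷ at v s js) block)
        ≈⟨ *-cong (sym (trans (reflexive (≡.cong (λ k → parity (k ℕ.+ inv v js)) lower-length)) (parity-+ (length lower) (inv v js))))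
                  (*-congˡ (reflexive (≡.cong₂ (D Q) (≡.sym (List.filter-accept (λ i → v i Fin.≟ s) ≡.refl))
                                                    (≡.sym (at-split ℓ l u b))))) ⟩
      parity (inv v (j ∷ js)) * (c * D Q (at v s (j ∷ js)) (at ℓ s 𝔷))
        ≈⟨ *-congˡ (separate (λ i → D Q (at v i (j ∷ js)) (at ℓ i 𝔷)) λ i i≢s → reflexive
             (≡.cong₂ (D Q) (List.filter-reject (λ k → v k Fin.≟ i) (i≢s ∘ ≡.sym)) (at-≢ ℓ i≢s lower upper b))) ⟨
      parity (inv v (j ∷ js)) * product (λ i → D Q (at v i (j ∷ js)) (at ℓ i 𝔷)) ∎
      where
      s = v j
      rest = λ i → D Q (at v i js) (at ℓ i (lower ++ upper))
      c = proj₁ (∏-separate s rest)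
      separate = proj₂ (∏-separate s rest)
      lower-length : length (below v s js) ≡ length lower
      lower-length = ≡.trans (≡.sym (filter-map-length (Fin._<? s) v js))
        (≡.trans (≡.trans (≡.cong length (≡.sym (List.filter-reject (Fin._<? s) {xs = map v js} (ℕ.<-irrefl ≡.refl))))
                   (filter-length-↭ (Fin._<? s) p))
        (≡.trans (filter-map-length (Fin._<? s) ℓ 𝔷) (≡.cong length (below-split ℓ l u b))))
      term : ∀ as e bs → All (λ e → ℓ e ≡ s) (as ++ e ∷ bs) →
        map v (j ∷ js) ↭ map ℓ (lower ++ (as ++ e ∷ bs) ++ upper) → Sorted ℓ (lower ++ (as ++ e ∷ bs) ++ upper) →
        Q j e * D Q js (lower ++ (as ++ bs) ++ upper) ≈ (parity (inv v js) * c) * (Q j e * D Q (at v s js) (as ++ bs))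
      term as e bs b p sorted = begin
        Q j e * D Q js (lower ++ (as ++ bs) ++ upper)
          ≈⟨ *-congˡ (D-blocks js _ sorted′ p′) ⟩
        Q j e * (parity (inv v js) * product (λ i → D Q (at v i js) (at ℓ i (lower ++ (as ++ bs) ++ upper))))
          ≈⟨ *-congˡ (*-congˡ (separate (λ i → D Q (at v i js) (at ℓ i (lower ++ (as ++ bs) ++ upper)))
               λ i i≢s → reflexive (≡.cong (D Q (at v i js)) (at-≢ ℓ i≢s lower upper b′)))) ⟩
        Q j e * (parity (inv v js) * (c * D Q (at v s js) (at ℓ s (lower ++ (as ++ bs) ++ upper))))
          ≈⟨ *-congˡ (*-congˡ (*-congˡ (reflexive (≡.cong (D Q (at v s js)) (at-split ℓ l u b′))))) ⟩
        Q j e * (parity (inv v js) * (c * D Q (at v s js) (as ++ bs)))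
          ≈⟨ solve 4 (λ x y z w → x :* (y :* (z :* w)) := y :* z :* (x :* w)) refl _ _ _ _ ⟩
        (parity (inv v js) * c) * (Q j e * D Q (at v s js) (as ++ bs)) ∎
        where
        b′ : All (λ e → ℓ e ≡ s) (as ++ bs)
        b′ = All.++⁺ (All.++⁻ˡ as b) (All.tail (All.++⁻ʳ as b))
        reassociate : ∀ (zs : List E) → lower ++ (as ++ zs) ++ upper ≡ (lower ++ as) ++ zs ++ upper
        reassociate zs = ≡.trans (≡.cong (lower ++_) (List.++-assoc as zs upper)) (≡.sym (List.++-assoc lower as _))
        sorted′ : Sorted ℓ (lower ++ (as ++ bs) ++ upper)
        sorted′ = ≡.subst (Sorted ℓ) (≡.sym (reassociate bs))
          (AllPairs-remove (lower ++ as) (≡.subst (Sorted ℓ) (reassociate (e ∷ bs)) sorted))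
        p′ : map v js ↭ map ℓ (lower ++ (as ++ bs) ++ upper)
        p′ = ↭.drop-∷ (↭-trans p (↭-trans (↭-reflexive (≡.cong (map ℓ) (reassociate (e ∷ bs))))
          (↭-trans (↭.map⁺ ℓ (↭.shift e (lower ++ as) (bs ++ upper)))
            (↭-reflexive (≡.cong₂ _∷_ (All.head (All.++⁻ʳ as b)) (≡.cong (map ℓ) (≡.sym (reassociate bs))))))))

open Filters

-- Staircases, inversions and the enumeration of column sets.

module Lists where
  private variable
    x y p q : Level
    X : Set x
    Y : Set y

  toList-tabulate : ∀ {N} (v : Vec X N) → tabulate (lookup v) ≡ toList v
  toList-tabulate []      = ≡.refl
  toList-tabulate (x ∷ v) = ≡.cong (x ∷_) (toList-tabulate v)

  map-lookup-allFin : ∀ {N} (v : Vec X N) → map (lookup v) (allFin N) ≡ toList v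
  map-lookup-allFin v = ≡.trans (List.map-tabulate id (lookup v)) (toList-tabulate v)

  filter-length-toList : ∀ {P : X → Set p} (P? : Decidable P) {N} (v : Vec X N) →
                         length (filter P? (toList v)) ≡ Vec.count P? v
  filter-length-toList P? []      = ≡.refl
  filter-length-toList P? (x ∷ v) with does (P? x)
  ... | true  = ≡.cong suc (filter-length-toList P? v)
  ... | false = filter-length-toList P? v

  filter-length-cong : ∀ {P : X → Set p} {Q : X → Set q} (P? : Decidable P) (Q? : Decidable Q) {xs} →
    All (λ x → (P x → Q x) × (Q x → P x)) xs → length (filter P? xs) ≡ length (filter Q? xs)
  filter-length-cong P? Q? [] = ≡.refl
  filter-length-cong P? Q? {x ∷ _} (h ∷ hs) with P? x | Q? x
  ... | yes _ | yes _ = ≡.cong suc (filter-length-cong P? Q? hs)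
  ... | no _  | no _  = filter-length-cong P? Q? hs
  ... | yes p | no q  = contradiction (proj₁ h p) q
  ... | no p  | yes q = contradiction (proj₂ h q) p

  module _ {R : Rel X p} (R-trans : Transitive R) where

    Linked⇒All : ∀ {x N} {w : Vec X N} → Linked R (x ∷ w) → All (R x) (toList w)
    Linked⇒All {w = []}    _       = []
    Linked⇒All {w = _ ∷ _} (r ∷ l) = r ∷ All.map (R-trans r) (Linked⇒All l)

    Linked⇒AllPairs : ∀ {N} {w : Vec X N} → Linked R w → AllPairs R (toList w)
    Linked⇒AllPairs {w = []}    _ = []
    Linked⇒AllPairs {w = _ ∷ _} l = Linked⇒All l ∷ Linked⇒AllPairs (Linked.tail l)

    All⇒Linked : ∀ {x N} {w : Vec X N} → All (R x) (toList w) → Linked R w → Linked R (x ∷ w)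
    All⇒Linked {w = []}    _       _ = [-]
    All⇒Linked {w = _ ∷ _} (r ∷ _) l = r ∷ l

  range : ℕ → ℕ → List ℕ
  range k zero    = []
  range k (suc r) = k ∷ range (suc k) r

  tabulate-range : ∀ k r → tabulate {n = r} (λ i → k ℕ.+ toℕ i) ≡ range k r
  tabulate-range k zero    = ≡.refl
  tabulate-range k (suc r) = ≡.cong₂ _∷_ (ℕ.+-identityʳ k)
    (≡.trans (List.tabulate-cong (λ i → ℕ.+-suc k (toℕ i))) (tabulate-range (suc k) r))

  part-lookup : ∀ ks i → part ks (toℕ i) ≡ List.lookup ks i
  part-lookup (k ∷ ks) Fin.zero    = ≡.refl
  part-lookup (k ∷ ks) (Fin.suc i) = part-lookup ks i

  part-subtractStaircase : ∀ l q → part (subtractStaircase l) q ≡ part l q ∸ (length l ∸ suc q)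
  part-subtractStaircase []      q       = ≡.refl
  part-subtractStaircase (k ∷ l) zero    = ≡.refl
  part-subtractStaircase (k ∷ l) (suc q) = part-subtractStaircase l q

  part-++ˡ : ∀ xs ys q → q ℕ.< length xs → part (xs ++ ys) q ≡ part xs q
  part-++ˡ (x ∷ xs) ys zero    _ = ≡.refl
  part-++ˡ (x ∷ xs) ys (suc q) (ℕ.s≤s h) = part-++ˡ xs ys q h

  part-last : ∀ xs k → part (xs ++ k ∷ []) (length xs) ≡ k
  part-last []       k = ≡.refl
  part-last (x ∷ xs) k = part-last xs k

  part-reverse : ∀ ks q → q ℕ.< length ks → part (reverse ks) q ≡ part ks (length ks ∸ suc q)
  part-reverse (k ∷ ks) q (ℕ.s≤s q≤) rewrite List.unfold-reverse k ks with ℕ.m≤n⇒m<n∨m≡n q≤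
  ... | inj₁ q< = ≡.trans (part-++ˡ (reverse ks) _ q (≡.subst (q ℕ.<_) (≡.sym (List.length-reverse ks)) q<))
    (≡.trans (part-reverse ks q q<) (≡.cong (part (k ∷ ks)) (≡.sym (ℕ.+-∸-assoc 1 q<))))
  ... | inj₂ ≡.refl = ≡.trans (≡.cong (part (reverse ks ++ k ∷ [])) (≡.sym (List.length-reverse ks)))
    (≡.trans (part-last (reverse ks) k) (≡.cong (part (k ∷ ks)) (≡.sym (ℕ.n∸n≡0 (length ks)))))

  ascending-≥ : ∀ {b ks} → All (b ℕ.≤_) ks → AllPairs ℕ._<_ ks → ∀ q → q ℕ.< length ks → b ℕ.+ q ℕ.≤ part ks q
  ascending-≥ {b} {k ∷ ks} (b≤k ∷ _) _        zero    _         = ≡.subst (ℕ._≤ k) (≡.sym (ℕ.+-identityʳ b)) b≤k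
  ascending-≥ {b} {k ∷ ks} (b≤k ∷ _) (h ∷ hs) (suc q) (ℕ.s≤s q<) =
    ≡.subst (ℕ._≤ part ks q) (≡.sym (ℕ.+-suc b q))
      (ascending-≥ (All.map (ℕ.≤-<-trans b≤k) h) hs q q<)

  -- The alternant adds back the staircase that was subtracted. The truncated subtraction loses
  -- nothing, because in an ascending list the entry at index q, counted from 0, is at least q.
  staircase-exponents : ∀ {r} ks → AllPairs ℕ._<_ ks → length ks ≡ r →
    tabulate {n = r} (λ i → toℕ i ℕ.+ part (subtractStaircase (reverse ks)) (toℕ (opposite i))) ≡ ks
  staircase-exponents ks ascending ≡.refl = ≡.trans (List.tabulate-cong λ i → begin
    toℕ i ℕ.+ part (subtractStaircase (reverse ks)) (toℕ (opposite i))
      ≡⟨ ≡.cong (toℕ i ℕ.+_) (part-subtractStaircase (reverse ks) _) ⟩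
    toℕ i ℕ.+ (part (reverse ks) (toℕ (opposite i)) ∸ (length (reverse ks) ∸ suc (toℕ (opposite i))))
      ≡⟨ ≡.cong₂ (λ a b → toℕ i ℕ.+ (a ∸ (b ∸ suc (toℕ (opposite i)))))
           (part-reverse ks _ (Fin.toℕ<n (opposite i))) (List.length-reverse ks) ⟩
    toℕ i ℕ.+ (part ks (length ks ∸ suc (toℕ (opposite i))) ∸ (length ks ∸ suc (toℕ (opposite i))))
      ≡⟨ ≡.cong (λ q → toℕ i ℕ.+ (part ks q ∸ q)) (mirror i) ⟩
    toℕ i ℕ.+ (part ks (toℕ i) ∸ toℕ i)
      ≡⟨ ℕ.m+[n∸m]≡n (ascending-≥ (All.universal (λ _ → ℕ.z≤n) ks) ascending (toℕ i) (Fin.toℕ<n i)) ⟩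
    part ks (toℕ i)
      ≡⟨ part-lookup ks i ⟩
    List.lookup ks i ∎) (List.tabulate-lookup ks)
    where
    open ≡.≡-Reasoning
    mirror : ∀ {r} (i : Fin r) → r ∸ suc (toℕ (opposite i)) ≡ toℕ i
    mirror i = ≡.trans (≡.sym (Fin.opposite-prop (opposite i))) (≡.cong toℕ (Fin.opposite-involutive i))

open Lists

module Inversions {n N} (v : Vec (Fin n) N) where

  private
    Inverted : Fin N × Fin N → Set
    Inverted (a , b) = a Fin.< b × lookup v b Fin.< lookup v a

    inverted? : Decidable Inverted
    inverted? = λ (a , b) → (a Fin.<? b) ×-dec (lookup v b Fin.<? lookup v a)

    count : List (Fin N) → List (Fin N) → ℕ
    count xs ys = length (filter inverted? (cartesianProduct xs ys))

    count-∷ : ∀ x xs ys → count (x ∷ xs) ys ≡ length (filter (λ y → inverted? (x , y)) ys) ℕ.+ count xs ys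
    count-∷ x xs ys = ≡.trans (≡.cong length (List.filter-++ inverted? (map (x ,_) ys) _))
      (≡.trans (List.length-++ (filter inverted? (map (x ,_) ys)))
               (≡.cong (ℕ._+ count xs ys) (filter-map-length inverted? (x ,_) ys)))

    count-drop : ∀ {j} xs ys → All (λ x → ¬ Inverted (x , j)) xs → count xs (j ∷ ys) ≡ count xs ys
    count-drop     []       ys []       = ≡.refl
    count-drop {j} (x ∷ xs) ys (h ∷ hs) = ≡.trans (count-∷ x xs (j ∷ ys)) (≡.trans
      (≡.cong₂ ℕ._+_ (≡.cong length (List.filter-reject (λ y → inverted? (x , y)) h)) (count-drop xs ys hs))
      (≡.sym (count-∷ x xs ys)))

    -- No entry precedes the head of an ascending list, so pairs with the head in second place are
    -- never inverted and the product of positions shrinks to the tail in both factors.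
    count-inv : ∀ js → AllPairs Fin._<_ js → count js js ≡ inv (lookup v) js
    count-inv []       _        = ≡.refl
    count-inv (j ∷ js) (h ∷ hs) = ≡.trans (count-∷ j js (j ∷ js)) (≡.cong₂ ℕ._+_
      (≡.trans (≡.cong length (List.filter-reject (λ y → inverted? (j , y)) (λ p → ℕ.<-irrefl ≡.refl (proj₁ p))))
               (filter-length-cong _ _ (All.map (λ j<b → proj₂ , (j<b ,_)) h)))
      (≡.trans (count-drop js js (All.map (λ j<x p → ℕ.<-asym j<x (proj₁ p)) h)) (count-inv js hs)))

  inversions≡inv : inversions v ≡ inv (lookup v) (allFin N)
  inversions≡inv = count-inv (allFin N) (AllPairs.tabulate⁺-< id)

module Enumeration {a ℓ₁ ℓ₂} (ℝ : CompleteOrderedField a ℓ₁ ℓ₂) where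
  open CompleteOrderedField ℝ hiding (zero)
  open Determinants ℝ

  private variable
    x p : Level
    X : Set x

  filter-all-choose : ∀ {P : X → Set p} (P? : Decidable P) xs k →
    filter (All.all? P?) (choose xs k) ≡ choose (filter P? xs) k
  filter-all-choose P? xs       zero    = ≡.refl
  filter-all-choose P? []       (suc k) = ≡.refl
  filter-all-choose P? (x ∷ xs) (suc k) = ≡.trans (List.filter-++ (All.all? P?) (map (x ∷_) (choose xs k)) _) (join (P? x))
    where
    reject : ¬ _ → ∀ zs → filter (All.all? P?) (map (x ∷_) zs) ≡ []
    reject ¬p []       = ≡.refl
    reject ¬p (z ∷ zs) = ≡.trans (List.filter-reject (All.all? P?) (¬p ∘ All.head)) (reject ¬p zs)
    accept : _ → ∀ zs → filter (All.all? P?) (map (x ∷_) zs) ≡ map (x ∷_) (filter (All.all? P?) zs)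
    accept p []       = ≡.refl
    accept p (z ∷ zs) = by-cases (All.all? P? z)
      where
      by-cases : Dec (All _ z) → filter (All.all? P?) ((x ∷ z) ∷ map (x ∷_) zs) ≡ map (x ∷_) (filter (All.all? P?) (z ∷ zs))
      by-cases (yes h) = ≡.trans (List.filter-accept (All.all? P?) (p ∷ h))
        (≡.trans (≡.cong ((x ∷ z) ∷_) (accept p zs)) (≡.cong (map (x ∷_)) (≡.sym (List.filter-accept (All.all? P?) h))))
      by-cases (no ¬h) = ≡.trans (List.filter-reject (All.all? P?) (¬h ∘ All.tail))
        (≡.trans (accept p zs) (≡.cong (map (x ∷_)) (≡.sym (List.filter-reject (All.all? P?) ¬h))))
    join : Dec _ → filter (All.all? P?) (map (x ∷_) (choose xs k)) ++ filter (All.all? P?) (choose xs (suc k)) ≡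
           choose (filter P? (x ∷ xs)) (suc k)
    join (yes p) = ≡.trans
      (≡.cong₂ _++_ (≡.trans (accept p (choose xs k)) (≡.cong (map (x ∷_)) (filter-all-choose P? xs k)))
                    (filter-all-choose P? xs (suc k)))
      (≡.cong (λ zs → choose zs (suc k)) (≡.sym (List.filter-accept P? p)))
    join (no ¬p) = ≡.trans
      (≡.cong₂ _++_ (reject ¬p (choose xs k)) (filter-all-choose P? xs (suc k)))
      (≡.cong (λ zs → choose zs (suc k)) (≡.sym (List.filter-reject P? ¬p)))

  module _ {X : Set} {R : Rel X p} (R? : Decidable₂ R) (R-trans : Transitive R) (R-asym : ∀ {x y} → R x y → ¬ R y x) where

    filter-linked-∷ : ∀ x {k} (ws : List (Vec X k)) →
      map toList (filter (linked? R?) (map (x Vec.∷_) ws)) ≡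
      map (x ∷_) (filter (All.all? (R? x)) (map toList (filter (linked? R?) ws)))
    filter-linked-∷ x [] = ≡.refl
    filter-linked-∷ x (w ∷ ws) with linked? R? w
    ... | no ¬l = ≡.trans (≡.cong (map toList) (List.filter-reject (linked? R?) {x = x Vec.∷ w} (¬l ∘ Linked.tail))) (filter-linked-∷ x ws)
    ... | yes l with All.all? (R? x) (toList w)
    ...   | no ¬h = ≡.trans (≡.cong (map toList) (List.filter-reject (linked? R?) {x = x Vec.∷ w} (¬h ∘ Linked⇒All R-trans)))
                      (filter-linked-∷ x ws)
    ...   | yes h = ≡.trans (≡.cong (map toList) (List.filter-accept (linked? R?) {x = x Vec.∷ w} (All⇒Linked R-trans h l)))
                      (≡.cong ((x ∷ toList w) ∷_) (filter-linked-∷ x ws))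

    -- The heads run through a suffix of `xs` while the tails range over all of `xs`. The passed
    -- part `pre` is carried along to show that exactly the entries after the head `y` lie above it,
    -- so that both sides recurse on the same list and even the order of the sets agrees.
    filter-linked-vectors : ∀ {xs} → AllPairs R xs → ∀ k →
      map toList (filter (linked? R?) (vectors xs k)) ≡ choose xs k
    filter-linked-vectors         sorted zero    = ≡.refl
    filter-linked-vectors {xs} sorted (suc k) = suffix [] xs [] sorted ≡.refl
      where
      open ≡.≡-Reasoning
      suffix : ∀ pre ys → All (λ x → All (R x) ys) pre → AllPairs R ys → xs ≡ pre ++ ys →
        map toList (filter (linked? R?) (List.cartesianProductWith Vec._∷_ ys (vectors xs k))) ≡ choose ys (suc k)
      suffix pre []       _ _        _  = ≡.refl
      suffix pre (y ∷ ys) h (y< ∷ s) eq = begin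
        map toList (filter (linked? R?) (map (y Vec.∷_) (vectors xs k) ++ rest))
          ≡⟨ ≡.cong (map toList) (List.filter-++ (linked? R?) (map (y Vec.∷_) (vectors xs k)) rest) ⟩
        map toList (filter (linked? R?) (map (y Vec.∷_) (vectors xs k)) ++ filter (linked? R?) rest)
          ≡⟨ List.map-++ toList (filter (linked? R?) (map (y Vec.∷_) (vectors xs k))) _ ⟩
        map toList (filter (linked? R?) (map (y Vec.∷_) (vectors xs k))) ++ map toList (filter (linked? R?) rest)
          ≡⟨ ≡.cong₂ _++_ (filter-linked-∷ y (vectors xs k))
               (suffix (pre ++ y ∷ []) ys (All.++⁺ (All.map All.tail h) (y< ∷ [])) s
                 (≡.trans eq (≡.sym (List.++-assoc pre (y ∷ []) ys)))) ⟩
        map (y ∷_) (filter (All.all? (R? y)) (map toList (filter (linked? R?) (vectors xs k)))) ++ choose ys (suc k)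
          ≡⟨ ≡.cong (λ zs → map (y ∷_) (filter (All.all? (R? y)) zs) ++ choose ys (suc k)) (filter-linked-vectors sorted k) ⟩
        map (y ∷_) (filter (All.all? (R? y)) (choose xs k)) ++ choose ys (suc k)
          ≡⟨ ≡.cong (λ zs → map (y ∷_) zs ++ choose ys (suc k)) (filter-all-choose (R? y) xs k) ⟩
        map (y ∷_) (choose (filter (R? y) xs) k) ++ choose ys (suc k)
          ≡⟨ ≡.cong (λ zs → map (y ∷_) (choose zs k) ++ choose ys (suc k)) above ⟩
        choose (y ∷ ys) (suc k) ∎
        where
        rest = List.cartesianProductWith Vec._∷_ ys (vectors xs k)
        above : filter (R? y) xs ≡ ys
        above = begin
          filter (R? y) xs                          ≡⟨ ≡.cong (filter (R? y)) eq ⟩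
          filter (R? y) (pre ++ y ∷ ys)             ≡⟨ List.filter-++ (R? y) pre (y ∷ ys) ⟩
          filter (R? y) pre ++ filter (R? y) (y ∷ ys)
            ≡⟨ ≡.cong₂ _++_ (List.filter-none (R? y) (All.map (λ h yx → R-asym yx (All.head h)) h))
                 (≡.trans (List.filter-reject (R? y) (λ yy → R-asym yy yy)) (List.filter-all (R? y) y<)) ⟩
          ys ∎

open Filters
open Lists
open Inversions

-- Vandermonde determinants and the expansion into partial Schur functions.

module SchurExpansion {a ℓ₁ ℓ₂} (ℝ : CompleteOrderedField a ℓ₁ ℓ₂) where
  open CompleteOrderedField ℝ hiding (zero)
  open OrderedField ℝ
  open LinearAlgebra ℝ
  open Parameters ℝ
  open Determinants ℝ
  open BlockDeterminants ℝ
  open Enumeration ℝ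
  open import Relation.Binary.Reasoning.Setoid setoid
  module Sum = CommutativeMonoidSum +-commutativeMonoid

  private variable
    x p q : Level
    X R C : Set x

  alt-tabulate : ∀ {k} (f : X → List X → Carrier) (h : Fin (suc k) → X) →
    alt f (tabulate h) ≈ sum λ j → (- 1#) ^ toℕ j * f (h j) (tabulate (h ∘ punchIn j))
  alt-tabulate {k = zero}  f h = solve 1 (λ x → x :- con (ℤ.+ 0) := con 1ℤ :* x :+ con (ℤ.+ 0)) refl _
  alt-tabulate {k = suc k} f h = +-cong (sym (*-identityˡ _)) (begin
    - alt (λ y ys → f y (h Fin.zero ∷ ys)) (tabulate (h ∘ Fin.suc))
      ≈⟨ -‿cong (alt-tabulate (λ y ys → f y (h Fin.zero ∷ ys)) (h ∘ Fin.suc)) ⟩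
    - sum t
      ≈⟨ solve 1 (λ x → :- x := (:- con 1ℤ) :* x) refl _ ⟩
    - 1# * sum t
      ≈⟨ SemiringSum.*-distribˡ-sum semiring (- 1#) t ⟩
    sum (λ j → - 1# * t j)
      ≈⟨ Sum.sum-cong-≋ {x = λ j → - 1# * t j} {y = t′} (λ j → sym (*-assoc (- 1#) _ _)) ⟩
    sum t′ ∎)
    where
    t t′ : Fin (suc k) → Carrier
    t j = (- 1#) ^ toℕ j * f (h (Fin.suc j)) (h Fin.zero ∷ tabulate (h ∘ Fin.suc ∘ punchIn j))
    t′ j = (- 1#) ^ suc (toℕ j) * f (h (Fin.suc j)) (h Fin.zero ∷ tabulate (h ∘ Fin.suc ∘ punchIn j))

  det-tabulate : ∀ {k} (e : R → C → Carrier) (g : Fin k → R) (h : Fin k → C) →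
    det (λ i j → e (g i) (h j)) ≈ D e (tabulate g) (tabulate h)
  det-tabulate {k = zero}  e g h = refl
  det-tabulate {k = suc k} e g h = begin
    sum t
      ≈⟨ Sum.sum-cong-≋ {x = t} {y = t′} (λ j → trans
           (*-congˡ (det-tabulate e (g ∘ Fin.suc) (h ∘ punchIn j))) (*-assoc _ _ _)) ⟩
    sum t′
      ≈⟨ alt-tabulate (λ c cs → e (g Fin.zero) c * D e (tabulate (g ∘ Fin.suc)) cs) h ⟨
    D e (tabulate g) (tabulate h) ∎
    where
    t t′ : Fin (suc k) → Carrier
    t j = (- 1#) ^ toℕ j * e (g Fin.zero) (h j) * det (λ i l → e (g (Fin.suc i)) (h (punchIn j l)))
    t′ j = (- 1#) ^ toℕ j * (e (g Fin.zero) (h j) * D e (tabulate (g ∘ Fin.suc)) (tabulate (h ∘ punchIn j)))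

  D-cong-All : ∀ {P : R → Set p} {P′ : C → Set q} {e e′ : R → C → Carrier} →
    (∀ {r c} → P r → P′ c → e r c ≈ e′ r c) → ∀ {rs cs} → All P rs → All P′ cs → D e rs cs ≈ D e′ rs cs
  D-cong-All h {cs = []}    []       _ = refl
  D-cong-All h {cs = _ ∷ _} []       _ = refl
  D-cong-All {P′ = P′} {e} {e′} h {r ∷ rs} {cs} (pr ∷ prs) pcs =
    alt-cong-∈ cs λ { as c bs ≡.refl → step as c bs pcs }
    where
    step : ∀ as c bs → All P′ (as ++ c ∷ bs) → e r c * D e rs (as ++ bs) ≈ e′ r c * D e′ rs (as ++ bs)
    step as c bs pcs = *-cong (h pr (All.head (All.++⁻ʳ as pcs)))
      (D-cong-All h prs (All.++⁺ (All.++⁻ˡ as pcs) (All.tail (All.++⁻ʳ as pcs))))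

  -- The column operations that evaluate a Vandermonde determinant. Each column loses `t` times its
  -- original predecessor, not the already reduced one.
  reduce : Carrier → (X → Carrier) → List (X → Carrier) → List (X → Carrier)
  reduce t p []       = []
  reduce t p (q ∷ qs) = (λ x → q x - t * p x) ∷ reduce t q qs

  columnD-reduce : ∀ t (rs : List X) pre p qs →
    columnD rs (pre ++ p ∷ reduce t p qs) ≈ columnD rs (pre ++ p ∷ qs)
  columnD-reduce t rs pre p []       = refl
  columnD-reduce t rs pre p (q ∷ qs) = begin
    columnD rs (pre ++ p ∷ q′ ∷ reduce t q qs)
      ≡⟨ ≡.cong (columnD rs) (List.++-assoc pre (p ∷ []) _) ⟨
    columnD rs ((pre ++ p ∷ []) ++ q′ ∷ reduce t q qs)
      ≈⟨ D-linear (λ r c → c r) ((1# , q) ∷ (- t , p) ∷ []) proj₁ proj₂ q′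
           (λ r → solve 3 (λ q t p → q :- t :* p := con 1ℤ :* q :+ ((:- t) :* p :+ con (ℤ.+ 0))) refl (q r) t (p r))
           rs (pre ++ p ∷ []) (reduce t q qs) ⟩
    1# * columnD rs ((pre ++ p ∷ []) ++ q ∷ reduce t q qs) +
    ((- t) * columnD rs ((pre ++ p ∷ []) ++ p ∷ reduce t q qs) + 0#)
      ≈⟨ +-cong (*-congˡ (columnD-reduce t rs (pre ++ p ∷ []) q qs))
                (+-congʳ (*-congˡ (trans (reflexive (≡.cong (columnD rs) (List.++-assoc pre (p ∷ []) _)))
                  (alternating-repeat (D-alternating (λ r c → c r) rs) pre p [] _)))) ⟩
    1# * columnD rs ((pre ++ p ∷ []) ++ q ∷ qs) + ((- t) * 0# + 0#)
      ≈⟨ solve 2 (λ x t → con 1ℤ :* x :+ ((:- t) :* con (ℤ.+ 0) :+ con (ℤ.+ 0)) := x) refl _ t ⟩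
    columnD rs ((pre ++ p ∷ []) ++ q ∷ qs)
      ≡⟨ ≡.cong (columnD rs) (List.++-assoc pre (p ∷ []) _) ⟩
    columnD rs (pre ++ p ∷ q ∷ qs) ∎
    where
    q′ = λ x → q x - t * p x

  power : ℕ → Carrier → Carrier
  power k y = y ^ k

  reduce-powers : ∀ t k r → reduce t (power k) (map power (range (suc k) r)) ≡
                  map (λ i y → y ^ suc i - t * y ^ i) (range k r)
  reduce-powers t k zero    = ≡.refl
  reduce-powers t k (suc r) = ≡.cong (_ ∷_) (reduce-powers t (suc k) r)

  -- Reducing with `t = y` turns the row of `y` into 1, 0, ..., 0 and leaves a factor `z - y` in the
  -- row of each other node `z`.
  vandermonde-∷ : ∀ y ys r → D (flip power) (y ∷ ys) (range 0 (suc r)) ≈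
    List.foldr (λ z → (z - y) *_) 1# ys * D (flip power) ys (range 0 r)
  vandermonde-∷ y ys r = begin
    D (flip power) (y ∷ ys) (range 0 (suc r))
      ≈⟨ toColumns power (y ∷ ys) (range 0 (suc r)) ⟨
    columnD (y ∷ ys) (power 0 ∷ map power (range 1 r))
      ≈⟨ columnD-reduce y (y ∷ ys) [] (power 0) _ ⟨
    columnD (y ∷ ys) (power 0 ∷ reduce y (power 0) (map power (range 1 r)))
      ≡⟨ ≡.cong (λ ps → columnD (y ∷ ys) (power 0 ∷ ps)) (reduce-powers y 0 r) ⟩
    1# * columnD ys (map g (range 0 r)) - alt _ (map g (range 0 r))
      ≈⟨ +-cong (*-identityˡ _) (-‿cong (trans (alt-map g _ (range 0 r)) (alt-0 (range 0 r) λ i is →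
           trans (*-congʳ (-‿inverseʳ _)) (zeroˡ _)))) ⟩
    columnD ys (map g (range 0 r)) - 0#
      ≈⟨ solve 1 (λ x → x :- con (ℤ.+ 0) := x) refl _ ⟩
    columnD ys (map g (range 0 r))
      ≈⟨ toColumns g ys (range 0 r) ⟩
    D (flip g) ys (range 0 r)
      ≈⟨ D-cong ys (range 0 r) (λ z i → solve 3 (λ z y p → z :* p :- y :* p := (z :- y) :* p) refl z y (z ^ i)) ⟩
    D (λ z i → (z - y) * z ^ i) ys (range 0 r)
      ≈⟨ D-scaleRows (_- y) (flip power) ys (range 0 r) ⟩
    List.foldr (λ z → (z - y) *_) 1# ys * D (flip power) ys (range 0 r) ∎
    where
    g : ℕ → Carrier → Carrier
    g i z = z ^ suc i - y * z ^ i
    toColumns : ∀ (g : ℕ → Carrier → Carrier) ys is → columnD ys (map g is) ≈ D (flip g) ys is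
    toColumns g ys is = trans (reflexive (≡.cong (λ ys → columnD ys (map g is)) (≡.sym (List.map-id ys))))
      (D-map (λ r c → c r) id g ys is)

  vandermonde-pos : ∀ {ys} → AllPairs _<_ ys → 0# < D (flip power) ys (range 0 (length ys))
  vandermonde-pos {[]}     []       = 0<1
  vandermonde-pos {y ∷ ys} (h ∷ hs) = <-respʳ (sym (vandermonde-∷ y ys (length ys)))
    (*-pos (differences h) (vandermonde-pos hs))
    where
    differences : ∀ {ys} → All (y <_) ys → 0# < List.foldr (λ z → (z - y) *_) 1# ys
    differences []      = 0<1
    differences (h ∷ hs) = *-pos (x<y⇒0<y-x h) (differences hs)

  det-powers : ∀ {k} (y : Fin k → Carrier) (exponent : Fin k → ℕ) →
    det (λ i j → y j ^ exponent i) ≈ D (flip power) (tabulate y) (tabulate exponent)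
  det-powers y exponent = trans (det-tabulate power exponent y) (D-transpose power (tabulate exponent) (tabulate y))

  ∑-allFin : ∀ {k} (f : Fin k → Carrier) → ∑ (allFin k) f ≈ sum f
  ∑-allFin f = ∑-tabulate id
    where
    ∑-tabulate : ∀ {k} (g : Fin k → _) → ∑ (tabulate g) f ≈ sum (f ∘ g)
    ∑-tabulate {zero}  g = refl
    ∑-tabulate {suc k} g = +-congˡ (∑-tabulate (g ∘ Fin.suc))

  sum-0 : ∀ {k} {f : Fin k → Carrier} → (∀ i → f i ≈ 0#) → sum f ≈ 0#
  sum-0 {k} h = trans (Sum.sum-cong-≋ h) (Sum.sum-replicate-zero k)

  sum-single : ∀ {k} s (f : Fin k → Carrier) → (∀ i → i ≢ s → f i ≈ 0#) → sum f ≈ f s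
  sum-single {suc k} s f h = trans (Sum.sum-remove {i = s} f) (trans (+-congˡ (sum-0 λ i →
    h (punchIn s i) (Fin.punchInᵢ≢i s i))) (+-identityʳ _))

  ∑-cartesianProduct : ∀ {X Y : Set} (xs : List X) (ys : List Y) (f : X × Y → Carrier) →
    ∑ (cartesianProduct xs ys) f ≈ ∑ xs (λ x → ∑ ys (λ y → f (x , y)))
  ∑-cartesianProduct []       ys f = refl
  ∑-cartesianProduct (x ∷ xs) ys f = trans (∑-++ (map (x ,_) ys) _ f)
    (+-cong (reflexive (∑-map (x ,_) ys f)) (∑-cartesianProduct xs ys f))

  -- Allows the condition on letter counts to be dropped from `ℨ`: the sets added in this way
  -- contribute zero.
  ∑-filter-× : ∀ {X : Set x} {P : X → Set p} {Q : X → Set q} (P? : Decidable P) (Q? : Decidable Q)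
    {f g : X → Carrier} xs → (∀ x → P x → Q x → f x ≈ g x) → (∀ x → P x → ¬ Q x → g x ≈ 0#) →
    ∑ (filter (λ x → P? x ×-dec Q? x) xs) f ≈ ∑ (filter P? xs) g
  ∑-filter-× P? Q? []       on off = refl
  ∑-filter-× P? Q? (x ∷ xs) on off with P? x | Q? x
  ... | yes p | yes q = +-cong (on x p q) (∑-filter-× P? Q? xs on off)
  ... | yes p | no ¬q = trans (∑-filter-× P? Q? xs on off) (sym (trans (+-congʳ (off x p ¬q)) (+-identityˡ _)))
  ... | no _  | yes _ = ∑-filter-× P? Q? xs on off
  ... | no _  | no _  = ∑-filter-× P? Q? xs on off

  product-pos : ∀ {k} (f : Fin k → Carrier) → (∀ i → 0# < f i) → 0# < product f
  product-pos {zero}  f h = 0<1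
  product-pos {suc k} f h = *-pos (h Fin.zero) (product-pos (f ∘ Fin.suc) (h ∘ Fin.suc))

  lex-trans : ∀ {n d} → Transitive (_<ₗₑₓ_ {n} {d})
  lex-trans (inj₁ a<b)          (inj₁ b<c)          = inj₁ (ℕ.<-trans a<b b<c)
  lex-trans (inj₁ a<b)          (inj₂ (≡.refl , _)) = inj₁ a<b
  lex-trans (inj₂ (≡.refl , _)) (inj₁ b<c)          = inj₁ b<c
  lex-trans (inj₂ (≡.refl , k)) (inj₂ (≡.refl , l)) = inj₂ (≡.refl , ℕ.<-trans k l)

  lex-asym : ∀ {n d} {e e′ : Fin n × Fin d} → e <ₗₑₓ e′ → ¬ e′ <ₗₑₓ e
  lex-asym (inj₁ a<b)            (inj₁ b<a)            = ℕ.<-asym a<b b<a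
  lex-asym (inj₁ a<b)            (inj₂ (≡.refl , _))   = ℕ.<-irrefl ≡.refl a<b
  lex-asym (inj₂ (≡.refl , _))   (inj₁ b<a)            = ℕ.<-irrefl ≡.refl b<a
  lex-asym (inj₂ (_ , c<d))      (inj₂ (_ , d<c))      = ℕ.<-asym c<d d<c

  lex-enumeration : ∀ n d → AllPairs _<ₗₑₓ_ (cartesianProduct (allFin n) (allFin d))
  lex-enumeration n d = build (allFin n) (AllPairs.tabulate⁺-< id)
    where
    build : ∀ (xs : List (Fin n)) → AllPairs Fin._<_ xs → AllPairs _<ₗₑₓ_ (cartesianProduct xs (allFin d))
    build []       _        = []
    build (x ∷ xs) (h ∷ hs) = AllPairs.++⁺
      (AllPairs.map⁺ (AllPairs.map (λ k<l → inj₂ (≡.refl , k<l)) (AllPairs.tabulate⁺-< id)))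
      (build xs hs)
      (All.map⁺ (All.universal (λ k → cross k xs h) (allFin d)))
      where
      cross : ∀ k xs → All (x Fin.<_) xs → All ((x , k) <ₗₑₓ_) (cartesianProduct xs (allFin d))
      cross k []        []       = []
      cross k (x′ ∷ xs) (h ∷ hs) = All.++⁺ (All.map⁺ (All.universal (λ _ → inj₁ h) (allFin d))) (cross k xs hs)

  module _ {n N d : ℕ} (v : Vec (Fin n) N) (y : Fin N → Carrier)
           (ascending : ∀ {i j} → i Fin.< j → lookup v i ≡ lookup v j → y i < y j)
           (P : ParameterTensor N n d) (B : Fin N → Fin N → Carrier)
           (interpolates : ∀ j r → B j r ≈ sum (λ k → y j ^ toℕ k * P r (lookup v j) k)) where

    private
      E = Fin n × Fin d

      es : List E
      es = cartesianProduct (allFin n) (allFin d)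

      js : List (Fin N)
      js = allFin N

      -- The right factor of the factorisation of `B` through `S × {0,…,d-1}`: powers of the node,
      -- placed in the columns of its own letter.
      Q : Fin N → E → Carrier
      Q j (s , k) with lookup v j Fin.≟ s
      ... | yes _ = y j ^ toℕ k
      ... | no _  = 0#

      Q-on : ∀ {j e} → lookup v j ≡ proj₁ e → Q j e ≈ y j ^ toℕ (proj₂ e)
      Q-on {j} {s , k} eq with lookup v j Fin.≟ s
      ... | yes _ = refl
      ... | no ¬eq = contradiction eq ¬eq

      Q-off : ∀ {j e} → lookup v j ≢ proj₁ e → Q j e ≈ 0#
      Q-off {j} {s , k} ¬eq with lookup v j Fin.≟ s
      ... | yes eq = contradiction eq ¬eq
      ... | no _   = refl

      B-factors : ∀ j r → B j r ≈ ∑ es (λ e → Q j e * uncurry (P r) e)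
      B-factors j r = sym (begin
        ∑ es (λ e → Q j e * uncurry (P r) e)
          ≈⟨ ∑-cartesianProduct (allFin n) (allFin d) _ ⟩
        ∑ (allFin n) (λ s → ∑ (allFin d) (λ k → Q j (s , k) * P r s k))
          ≈⟨ ∑-allFin (λ s → ∑ (allFin d) (λ k → Q j (s , k) * P r s k)) ⟩
        sum (λ s → ∑ (allFin d) (λ k → Q j (s , k) * P r s k))
          ≈⟨ sum-single (lookup v j) _ (λ s s≢ → ∑-0 (allFin d) λ k →
               trans (*-congʳ (Q-off (s≢ ∘ ≡.sym))) (zeroˡ _)) ⟩
        ∑ (allFin d) (λ k → Q j (lookup v j , k) * P r (lookup v j) k)
          ≈⟨ ∑-allFin (λ k → Q j (lookup v j , k) * P r (lookup v j) k) ⟩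
        sum (λ k → Q j (lookup v j , k) * P r (lookup v j) k)
          ≈⟨ Sum.sum-cong-≋ {n = d} (λ k → *-congʳ (Q-on {j} {lookup v j , k} ≡.refl)) ⟩
        sum (λ k → y j ^ toℕ k * P r (lookup v j) k)
          ≈⟨ interpolates j r ⟨
        B j r ∎)

      V : Fin n → Carrier
      V i = vandermonde (y ∘ List.lookup (Ω v i))

      V-pos : ∀ i → 0# < V i
      V-pos i = <-respʳ (sym (trans (det-powers (y ∘ List.lookup (Ω v i)) toℕ) (reflexive (≡.cong₂ (D (flip power))
          tabulated (≡.trans (tabulate-range 0 (length (Ω v i))) (≡.cong (range 0) (≡.sym (List.length-map y (Ω v i)))))))))
        (vandermonde-pos (AllPairs.map⁺ {f = y} (same-letter (Ω v i) (All.all-filter letter? js)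
          (AllPairs.filter⁺ letter? (AllPairs.tabulate⁺-< id)))))
        where
        letter? = λ j → lookup v j Fin.≟ i
        tabulated : tabulate (y ∘ List.lookup (Ω v i)) ≡ map y (Ω v i)
        tabulated = ≡.trans (≡.sym (List.map-tabulate (List.lookup (Ω v i)) y)) (≡.cong (map y) (List.tabulate-lookup (Ω v i)))
        same-letter : ∀ js → All (λ j → lookup v j ≡ i) js → AllPairs Fin._<_ js → AllPairs (λ a b → y a < y b) js
        same-letter []       _        _        = []
        same-letter (j ∷ js) (eq ∷ eqs) (h ∷ hs) =
          All.zipWith (λ (eq′ , j<b) → ascending j<b (≡.trans eq (≡.sym eq′))) (eqs , h) ∷ same-letter js eqs hs

      κ : Carrier
      κ = product (λ i → V i ⁻¹)

      Counts : Vec E N → Set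
      Counts 𝔷 = ∀ i → Vec.count (λ e → proj₁ e Fin.≟ i) 𝔷 ≡ α v i

      letters : ∀ i → length (at (lookup v) i js) ≡ α v i
      letters i = ≡.trans (≡.sym (filter-map-length (Fin._≟ i) (lookup v) js))
        (≡.trans (≡.cong (λ zs → length (filter (Fin._≟ i) zs)) (map-lookup-allFin v)) (filter-length-toList (Fin._≟ i) v))

      parity-σ : sgn (σ v) ≡ parity (inv (lookup v) js)
      parity-σ = ≡.cong parity (inversions≡inv v)

      module _ (𝔷 : Vec E N) (linked : Linked _<ₗₑₓ_ 𝔷) where

        private
          zs = toList 𝔷

        lex-sorted : AllPairs _<ₗₑₓ_ zs
        lex-sorted = Linked⇒AllPairs lex-trans linked

        sorted : Sorted proj₁ zs
        sorted = AllPairs.map lex⇒≤ lex-sorted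
          where
          lex⇒≤ : ∀ {e e′ : E} → e <ₗₑₓ e′ → proj₁ e Fin.≤ proj₁ e′
          lex⇒≤ (inj₁ a<b)          = ℕ.<⇒≤ a<b
          lex⇒≤ (inj₂ (≡.refl , _)) = ℕ.≤-refl

        exponents : Fin n → List ℕ
        exponents i = map (toℕ ∘ proj₂) (at proj₁ i zs)

        exponents-ascending : ∀ i → AllPairs ℕ._<_ (exponents i)
        exponents-ascending i = AllPairs.map⁺ (same-letter _ (All.all-filter (λ e → proj₁ e Fin.≟ i) zs)
          (AllPairs.filter⁺ (λ e → proj₁ e Fin.≟ i) lex-sorted))
          where
          second : ∀ {e e′ : E} → proj₁ e ≡ proj₁ e′ → e <ₗₑₓ e′ → proj₂ e Fin.< proj₂ e′
          second ≡.refl (inj₁ a<a)     = contradiction a<a (ℕ.<-irrefl ≡.refl)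
          second _      (inj₂ (_ , h)) = h
          same-letter : ∀ zs → All (λ e → proj₁ e ≡ i) zs → AllPairs _<ₗₑₓ_ zs →
                        AllPairs (λ e e′ → toℕ (proj₂ e) ℕ.< toℕ (proj₂ e′)) zs
          same-letter []       _          _        = []
          same-letter (z ∷ zs) (eq ∷ eqs) (h ∷ hs) =
            All.zipWith (λ (eq′ , lex) → second (≡.trans eq (≡.sym eq′)) lex) (eqs , h) ∷ same-letter zs eqs hs

        -- By `staircase-exponents` the alternant of `Λ 𝔷 i` has the exponents that `𝔷` lists for
        -- the letter `i`; rows and columns sharing this letter meet in pure powers of `Q`.
        alternant-block : Counts 𝔷 → ∀ i →
          alternant (Λ 𝔷 i) (y ∘ List.lookup (Ω v i)) ≈ D Q (at (lookup v) i js) (at proj₁ i zs)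
        alternant-block counts i = begin
          alternant (Λ 𝔷 i) (y ∘ List.lookup J)
            ≈⟨ det-powers (y ∘ List.lookup J) (λ j → toℕ j ℕ.+ part (Λ 𝔷 i) (toℕ (opposite j))) ⟩
          D (flip power) (tabulate (y ∘ List.lookup J))
            (tabulate (λ j → toℕ j ℕ.+ part (Λ 𝔷 i) (toℕ (opposite j))))
            ≡⟨ ≡.cong₂ (D (flip power))
                 (≡.trans (≡.sym (List.map-tabulate (List.lookup J) y)) (≡.cong (map y) (List.tabulate-lookup J)))
                 (staircase-exponents (exponents i) (exponents-ascending i) same-length) ⟩
          D (flip power) (map y J) (exponents i)
            ≈⟨ D-map (flip power) y (toℕ ∘ proj₂) J (at proj₁ i zs) ⟩
          D (λ j e → y j ^ toℕ (proj₂ e)) J (at proj₁ i zs)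
            ≈⟨ D-cong-All (λ vj≡i e≡i → sym (Q-on (≡.trans vj≡i (≡.sym e≡i))))
                 (All.all-filter (λ j → lookup v j Fin.≟ i) js) (All.all-filter (λ e → proj₁ e Fin.≟ i) zs) ⟩
          D Q J (at proj₁ i zs) ∎
          where
          J = Ω v i
          same-length : length (exponents i) ≡ length J
          same-length = ≡.trans (List.length-map _ (at proj₁ i zs))
            (≡.trans (filter-length-toList (λ e → proj₁ e Fin.≟ i) 𝔷) (≡.trans (counts i) (≡.sym (letters i))))

        partialSchur-D : Counts 𝔷 → partialSchur (Λ 𝔷) (Ω v) y ≈ κ * (sgn (σ v) * D Q js zs)
        partialSchur-D counts = begin
          product (λ i → alternant (Λ 𝔷 i) (y ∘ List.lookup (Ω v i)) * V i ⁻¹)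
            ≈⟨ ∏.∑-distrib-+ {n = n} (λ i → alternant (Λ 𝔷 i) (y ∘ List.lookup (Ω v i))) (λ i → V i ⁻¹) ⟩
          product (λ i → alternant (Λ 𝔷 i) (y ∘ List.lookup (Ω v i))) * κ
            ≈⟨ trans (*-comm _ _) (*-congˡ (∏.sum-cong-≋ {n = n} (alternant-block counts))) ⟩
          κ * Π
            -- The block formula reads `D Q js zs = parity i * Π`; solving it for `Π` uses that the
            -- sign squares to 1.
            ≈⟨ *-congˡ (sym (trans (sym (*-assoc _ _ _)) (trans (*-congʳ (sgn-square (-1^ i))) (*-identityˡ _)))) ⟩
          κ * (parity i * (parity i * Π))
            ≈⟨ *-congˡ (*-cong (reflexive (≡.sym parity-σ)) (sym (D-blocks (lookup v) proj₁ Q Q-off js zs sorted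
                 (counts⇒↭ (lookup v) proj₁ js zs λ k → ≡.trans (letters k)
                   (≡.sym (≡.trans (filter-length-toList (λ e → proj₁ e Fin.≟ k) 𝔷) (counts k))))))) ⟩
          κ * (sgn (σ v) * D Q js zs) ∎
          where
          i = inv (lookup v) js
          Π = product (λ k → D Q (at (lookup v) k js) (at proj₁ k zs))

        D-vanishes : ¬ Counts 𝔷 → D Q js zs ≈ 0#
        D-vanishes ¬counts = D-mismatch (lookup v) proj₁ Q Q-off js zs λ p → ¬counts λ i →
          ≡.trans (≡.sym (filter-length-toList (λ e → proj₁ e Fin.≟ i) 𝔷))
          (≡.trans (≡.sym (filter-map-length (Fin._≟ i) proj₁ zs))
          (≡.trans (≡.sym (filter-length-↭ (Fin._≟ i) p))
          (≡.trans (filter-map-length (Fin._≟ i) (lookup v) js) (letters i))))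

    -- Once the sets with wrong letter counts are added, for which the minor of `Q` vanishes, the
    -- sum ranges over all N-element sets of columns and is the Cauchy-Binet expansion of `B`. The
    -- constant collects the inverse Vandermonde determinants, positive because nodes of equal
    -- letter ascend.
    schurExpansion : ∃[ κ ] 0# < κ ×
      sumList (map (λ 𝔷 → det (columns P 𝔷) * partialSchur (Λ 𝔷) (Ω v) y) (ℨ d (α v))) ≈
      κ * (sgn (σ v) * D (λ r j → B j r) (allFin N) (allFin N))
    schurExpansion = κ , product-pos _ (λ i → ⁻¹-pos (V-pos i)) , (begin
      ∑ (ℨ d (α v)) (λ 𝔷 → det (columns P 𝔷) * partialSchur (Λ 𝔷) (Ω v) y)
        ≈⟨ ∑-filter-× (linked? _<ₗₑₓ?_) (λ 𝔷 → Fin.all? (λ i → Vec.count (λ e → proj₁ e Fin.≟ i) 𝔷 ℕ.≟ α v i))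
             {g = h ∘ toList} (vectors es N)
             (λ 𝔷 linked counts → trans (*-cong (columns-D 𝔷) (partialSchur-D 𝔷 linked counts))
               (solve 4 (λ a b c d → a :* (b :* (c :* d)) := (b :* c) :* (a :* d)) refl _ _ _ _))
             (λ 𝔷 linked ¬counts → trans (*-congˡ (trans (*-congˡ (D-vanishes 𝔷 linked ¬counts)) (zeroʳ _))) (zeroʳ _)) ⟩
      ∑ (filter (linked? _<ₗₑₓ?_) (vectors es N)) (h ∘ toList)
        ≡⟨ ∑-map toList (filter (linked? _<ₗₑₓ?_) (vectors es N)) h ⟨
      ∑ (map toList (filter (linked? _<ₗₑₓ?_) (vectors es N))) h
        ≡⟨ ≡.cong (λ zss → ∑ zss h) (filter-linked-vectors _<ₗₑₓ?_ lex-trans lex-asym (lex-enumeration n d) N) ⟩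
      ∑ (choose es N) h
        ≈⟨ ∑-distribˡ (choose es N) _ _ ⟨
      (κ * sgn (σ v)) * ∑ (choose es N) (λ zs → D (λ r e → uncurry (P r) e) js zs * D Q js zs)
        ≡⟨ ≡.cong (λ k → (κ * sgn (σ v)) * ∑ (choose es k) (λ zs → D (λ r e → uncurry (P r) e) js zs * D Q js zs))
             (List.length-tabulate {n = N} id) ⟨
      (κ * sgn (σ v)) * ∑ (choose es (length js)) (λ zs → D (λ r e → uncurry (P r) e) js zs * D Q js zs)
        ≈⟨ *-congˡ (cauchyBinet es Q (λ e r → uncurry (P r) e) B B-factors js js) ⟨
      (κ * sgn (σ v)) * D (λ r j → B j r) js js
        ≈⟨ *-assoc _ _ _ ⟩
      κ * (sgn (σ v) * D (λ r j → B j r) js js) ∎)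
      where
      h : List E → Carrier
      h zs = (κ * sgn (σ v)) * (D (λ r e → uncurry (P r) e) js zs * D Q js zs)
      columns-D : ∀ 𝔷 → det (columns P 𝔷) ≈ D (λ r e → uncurry (P r) e) js (toList 𝔷)
      columns-D 𝔷 = trans (det-tabulate (λ r e → uncurry (P r) e) id (lookup 𝔷))
        (reflexive (≡.cong (D (λ r e → uncurry (P r) e) js) (toList-tabulate 𝔷)))

-- Chebyshev values and the number 2 cos (π/m).

module Chebyshev {a ℓ₁ ℓ₂} (ℝ : CompleteOrderedField a ℓ₁ ℓ₂) where
  open CompleteOrderedField ℝ hiding (zero)
  open OrderedField ℝ
  open import Relation.Binary.Reasoning.Setoid setoid

  -- U k (2 cos θ) = sin (k θ) / sin θ.
  U : ℕ → Carrier → Carrier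
  U 0             x = 0#
  U 1             x = 1#
  U (suc (suc k)) x = x * U (suc k) x - U k x

  2# : Carrier
  2# = 1# + 1#

  0<2 : 0# < 2#
  0<2 = +-pos 0<1 0<1

  U-cong : ∀ k {x y} → x ≈ y → U k x ≈ U k y
  U-cong 0             eq = refl
  U-cong 1             eq = refl
  U-cong (suc (suc k)) eq = +-cong (*-cong eq (U-cong (suc k) eq)) (-‿cong (U-cong k eq))

  -- The differences satisfy `U (k+2) - U (k+1) = (x - 2) U (k+1) + (U (k+1) - U k)`, so they stay
  -- positive along with the values.
  U-increasing : ∀ {x} → 2# ≤ x → ∀ k → 0# < U (suc k) x × 0# < U (suc k) x - U k x
  U-increasing {x} 2≤x zero    = 0<1 , <-respʳ (solve 0 (con 1ℤ := con 1ℤ :- con (ℤ.+ 0)) refl) 0<1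
  U-increasing {x} 2≤x (suc k) with U-increasing 2≤x k
  ... | 0<u , 0<d = <-respʳ (solve 3 (λ x u w → (x :* u :- w :- u) :+ u := x :* u :- w) refl x (U (suc k) x) (U k x))
                      (+-pos 0<d′ 0<u) , 0<d′
    where
    0<d′ : 0# < U (suc (suc k)) x - U (suc k) x
    0<d′ = <-respʳ (solve 3 (λ x u w → (x :- con (ℤ.+ 2)) :* u :+ (u :- w) := x :* u :- w :- u) refl x (U (suc k) x) (U k x)) step
      where
      step : 0# < (x - 2#) * U (suc k) x + (U (suc k) x - U k x)
      step with compare 2# x
      ... | tri< 2<x _ _ = +-pos (*-pos (x<y⇒0<y-x 2<x) 0<u) 0<d
      ... | tri≈ _ 2≈x _ = <-respʳ (sym (trans (+-congʳ (trans (*-congʳ (trans (+-congʳ (sym 2≈x)) (-‿inverseʳ 2#))) (zeroˡ _)))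
                              (+-identityˡ _))) 0<d
      ... | tri> _ _ x<2 = contradiction x<2 2≤x

  -- |x| < b
  _<∣_∣ : Carrier → Carrier → Set ℓ₂
  x <∣ b ∣ = 0# < b - x × 0# < b + x

  bounded-+ : ∀ {x y b d} → x <∣ b ∣ → y <∣ d ∣ → (x + y) <∣ b + d ∣
  bounded-+ (p , q) (r , s) =
    <-respʳ (solve 4 (λ x y b d → (b :- x) :+ (d :- y) := (b :+ d) :- (x :+ y)) refl _ _ _ _) (+-pos p r) ,
    <-respʳ (solve 4 (λ x y b d → (b :+ x) :+ (d :+ y) := (b :+ d) :+ (x :+ y)) refl _ _ _ _) (+-pos q s)

  bounded-neg : ∀ {x b} → x <∣ b ∣ → (- x) <∣ b ∣
  bounded-neg (p , q) = <-respʳ (solve 2 (λ x b → b :+ x := b :- (:- x)) refl _ _) q , p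

  bounded-* : ∀ {x y b d} → x <∣ b ∣ → y <∣ d ∣ → (x * y) <∣ b * d ∣
  bounded-* (p , q) (r , s) =
    *-cancel-pos 0<2 (<-respʳ (solve 4 (λ x y b d → (b :- x) :* (d :+ y) :+ (b :+ x) :* (d :- y) :=
      con (ℤ.+ 2) :* (b :* d :- x :* y)) refl _ _ _ _) (+-pos (*-pos p s) (*-pos q r))) ,
    *-cancel-pos 0<2 (<-respʳ (solve 4 (λ x y b d → (b :- x) :* (d :- y) :+ (b :+ x) :* (d :+ y) :=
      con (ℤ.+ 2) :* (b :* d :+ x :* y)) refl _ _ _ _) (+-pos (*-pos p r) (*-pos q s)))

  bounded-pos : ∀ {x b} → x <∣ b ∣ → 0# < b
  bounded-pos (p , q) = *-cancel-pos 0<2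
    (<-respʳ (solve 2 (λ x b → (b :- x) :+ (b :+ x) := con (ℤ.+ 2) :* b) refl _ _) (+-pos p q))

  bounded-resp : ∀ {x y b} → x ≈ y → x <∣ b ∣ → y <∣ b ∣
  bounded-resp eq (p , q) = <-respʳ (+-congˡ (-‿cong eq)) p , <-respʳ (+-congˡ eq) q

  bound : ∀ x → ∃[ b ] x <∣ b ∣
  bound x with compare 0# x
  ... | tri< 0<x _ _ = x + 1# , <-respʳ (solve 1 (λ x → con 1ℤ := x :+ con 1ℤ :- x) refl x) 0<1 , +-pos (+-pos 0<x 0<1) 0<x
  ... | tri≈ _ 0≈x _ = 1# , bounded-resp 0≈x
        (<-respʳ (solve 0 (con 1ℤ := con 1ℤ :- con (ℤ.+ 0)) refl) 0<1 , <-respʳ (sym (+-identityʳ 1#)) 0<1)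
  ... | tri> _ _ x<0 = 1# - x , +-pos (+-pos 0<1 (neg⇒0<- x<0)) (neg⇒0<- x<0) ,
        <-respʳ (solve 1 (λ x → con 1ℤ := con 1ℤ :- x :+ x) refl x) 0<1

  -- The difference quotient (U k y - U k x) / (y - x).
  quotient : ℕ → Carrier → Carrier → Carrier
  quotient 0             x y = 0#
  quotient 1             x y = 0#
  quotient (suc (suc k)) x y = y * quotient (suc k) x y + U (suc k) x - quotient k x y

  U-difference : ∀ k x y → (y - x) * quotient k x y ≈ U k y - U k x
  U-difference 0             x y = solve 2 (λ x y → (y :- x) :* con (ℤ.+ 0) := con (ℤ.+ 0) :- con (ℤ.+ 0)) refl x y
  U-difference 1             x y = solve 2 (λ x y → (y :- x) :* con (ℤ.+ 0) := con 1ℤ :- con 1ℤ) refl x y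
  U-difference (suc (suc k)) x y = begin
    (y - x) * (y * q₁ + u₁ - q₀)
      ≈⟨ solve 5 (λ x y q₁ u₁ q₀ → (y :- x) :* (y :* q₁ :+ u₁ :- q₀) :=
           y :* ((y :- x) :* q₁) :+ (y :- x) :* u₁ :- (y :- x) :* q₀) refl x y q₁ u₁ q₀ ⟩
    y * ((y - x) * q₁) + (y - x) * u₁ - (y - x) * q₀
      ≈⟨ +-cong (+-congʳ (*-congˡ (U-difference (suc k) x y))) (-‿cong (U-difference k x y)) ⟩
    y * (U (suc k) y - u₁) + (y - x) * u₁ - (U k y - U k x)
      ≈⟨ solve 6 (λ x y a b c d → y :* (a :- b) :+ (y :- x) :* b :- (c :- d) := (y :* a :- c) :- (x :* b :- d))
           refl x y (U (suc k) y) u₁ (U k y) (U k x) ⟩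
    U (suc (suc k)) y - U (suc (suc k)) x ∎
    where
    q₁ = quotient (suc k) x y
    q₀ = quotient k x y
    u₁ = U (suc k) x

  -- With `U-difference` this is a Lipschitz bound for `U k` on the interval of radius 1 around `x`,
  -- the only continuity that is used.
  quotient-bounded : ∀ k x → ∃[ b ] ∀ y → (y - x) <∣ 1# ∣ → quotient k x y <∣ b ∣
  quotient-bounded 0 x = proj₁ (bound 0#) , λ _ _ → proj₂ (bound 0#)
  quotient-bounded 1 x = proj₁ (bound 0#) , λ _ _ → proj₂ (bound 0#)
  quotient-bounded (suc (suc k)) x
    with quotient-bounded (suc k) x | quotient-bounded k x | bound x | bound (U (suc k) x)
  ... | b₁ , h₁ | b₀ , h₀ | d , x<d | u , h = (1# + d) * b₁ + u + b₀ , λ y near → bounded-+ (bounded-+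
    (bounded-* (bounded-resp (solve 2 (λ x y → (y :- x) :+ x := y) refl x y) (bounded-+ near x<d)) (h₁ y near)) h)
    (bounded-neg (h₀ y near))

  bounded-widen : ∀ {z β γ} → β < γ → z <∣ β ∣ → z <∣ γ ∣
  bounded-widen β<γ (p , q) =
    <-respʳ (solve 3 (λ z b g → (g :- b) :+ (b :- z) := g :- z) refl _ _ _) (+-pos (x<y⇒0<y-x β<γ) p) ,
    <-respʳ (solve 3 (λ z b g → (g :- b) :+ (b :+ z) := g :+ z) refl _ _ _) (+-pos (x<y⇒0<y-x β<γ) q)

  Near : Carrier → (Carrier → Set ℓ₂) → Set _
  Near x P = ∃[ δ ] 0# < δ × (∀ y → (y - x) <∣ δ ∣ → P y)

  Near-× : ∀ {x P Q R} → (∀ y → P y → Q y → R y) → Near x P → Near x Q → Near x R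
  Near-× {x} {P} {Q} {R} f (δ , 0<δ , p) (ε , 0<ε , q) = smaller (compare δ ε)
    where
    smaller : Tri (δ < ε) (δ ≈ ε) (ε < δ) → Near x R
    smaller (tri< δ<ε _ _) = δ , 0<δ , λ y d → f y (p y d) (q y (bounded-widen δ<ε d))
    smaller (tri≈ _ δ≈ε _) = δ , 0<δ , λ y d → f y (p y d) (q y (<-respʳ (+-congʳ δ≈ε) (proj₁ d) , <-respʳ (+-congʳ δ≈ε) (proj₂ d)))
    smaller (tri> _ _ ε<δ) = ε , 0<ε , λ y e → f y (p y (bounded-widen ε<δ e)) (q y e)

  near-sign : ∀ s {u v e} → (v - u) <∣ e ∣ → 0# < sgn s * u - e → HasSign s v
  near-sign Sign.+ (p , q) h = <-respʳ
    (solve 3 (λ e u v → (con 1ℤ :* u :- e) :+ (e :+ (v :- u)) := con 1ℤ :* v) refl _ _ _) (+-pos h q)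
  near-sign Sign.- (p , q) h = <-respʳ
    (solve 3 (λ e u v → ((:- con 1ℤ) :* u :- e) :+ (e :- (v :- u)) := (:- con 1ℤ) :* v) refl _ _ _) (+-pos h p)

  U-continuous : ∀ s k x → HasSign s (U k x) →
    Near x (λ y → HasSign s (U k y))
  U-continuous s k x 0<su with quotient-bounded k x
  ... | b , h = δ , 0<δ , close
    where
    u = sgn s * U k x
    0<b : 0# < b
    0<b = bounded-pos (h x (<-respʳ (solve 1 (λ x → con 1ℤ := con 1ℤ :- (x :- x)) refl x) 0<1 ,
                            <-respʳ (solve 1 (λ x → con 1ℤ := con 1ℤ :+ (x :- x)) refl x) 0<1))
    0<b+u = +-pos 0<b 0<su
    i = (b + u) ⁻¹
    0<i = ⁻¹-pos 0<b+u
    unit : (b + u) * i ≈ 1#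
    unit = ⁻¹-inverseʳ (pos⇒≉0 0<b+u)
    -- The radius `u / (b + u)` is below 1, so that the bound `b` applies, and `δ b < u`, so that
    -- the value moves by less than its distance `u` from 0.
    δ = u * i
    0<δ = *-pos 0<su 0<i
    δ<1 : 0# < 1# - δ
    δ<1 = <-respʳ (trans (solve 3 (λ b u i → b :* i := (b :+ u) :* i :- u :* i) refl b u i) (+-congʳ unit)) (*-pos 0<b 0<i)
    δb<u : 0# < u - δ * b
    δb<u = <-respʳ (trans (solve 3 (λ b u i → u :* (u :* i) := u :* ((b :+ u) :* i) :- u :* i :* b) refl b u i)
      (+-congʳ (trans (*-congˡ unit) (*-identityʳ u)))) (*-pos 0<su 0<δ)
    widen : ∀ {z} → z <∣ δ ∣ → z <∣ 1# ∣
    widen (p , q) = <-respʳ (solve 2 (λ δ z → (con 1ℤ :- δ) :+ (δ :- z) := con 1ℤ :- z) refl δ _) (+-pos δ<1 p) ,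
                    <-respʳ (solve 2 (λ δ z → (con 1ℤ :- δ) :+ (δ :+ z) := con 1ℤ :+ z) refl δ _) (+-pos δ<1 q)
    close : ∀ y → (y - x) <∣ δ ∣ → HasSign s (U k y)
    close y near = near-sign s (bounded-resp (U-difference k x y) (bounded-* near (h y (widen near)))) δb<u

  PositiveUpTo : ℕ → Carrier → Set ℓ₂
  PositiveUpTo m x = ∀ k → k ℕ.< m → 0# < U (suc k) x

  PositiveUpTo-open : ∀ m x → PositiveUpTo m x → Near x (PositiveUpTo m)
  PositiveUpTo-open zero    x h = 1# , 0<1 , λ _ _ _ ()
  PositiveUpTo-open (suc m) x h = Near-× join
    (PositiveUpTo-open m x (λ k k<m → h k (ℕ.m<n⇒m<1+n k<m)))
    (U-continuous Sign.+ (suc m) x (<-respʳ (sym (*-identityˡ _)) (h m ℕ.≤-refl)))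
    where
    join : ∀ y → PositiveUpTo m y → HasSign Sign.+ (U (suc m) y) → PositiveUpTo (suc m) y
    join y p q k k<1+m with ℕ.m≤n⇒m<n∨m≡n (ℕ.s≤s⁻¹ k<1+m)
    ... | inj₁ k<m    = p k k<m
    ... | inj₂ ≡.refl = <-respʳ (*-identityˡ _) q

  -- Here `c` stands for 2 cos (π/m), and for 2 if `m = 0` encodes ∞. The fields say that sin (kπ/m)
  -- is positive for 0 < k < m, that sin π = 0, and that the 2 × 2 system met in `act-relator` is
  -- nonsingular.
  record Angle (m : ℕ) : Set (a Level.⊔ ℓ₁ Level.⊔ ℓ₂) where
    field
      c        : Carrier
      positive : ∀ k → m ≡ 0 ⊎ suc k ℕ.< m → 0# < U (suc k) c
      closing  : m ≢ 0 → U m c ≈ 0#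
      c²<4     : m ≢ 0 → 0# < (2# - c) * (2# + c)

  Bad : ℕ → Carrier → Set (a Level.⊔ ℓ₁ Level.⊔ ℓ₂)
  Bad M x = Level.Lift (a Level.⊔ ℓ₁) (∃[ k ] k ℕ.< M × U (suc k) x ≤ 0#)

  bad-2 : ∀ M → UpperBound (Bad M) 2#
  bad-2 M x (Level.lift (k , _ , u≤0)) 2<x = u≤0 (proj₁ (U-increasing (<-asym 2<x) k))

  -- A zero of `U 2`. It makes the set inhabited and its supremum nonnegative, which later gives
  -- `2 + s > 0`.
  bad-0 : ∀ m → Bad (suc (suc m)) 0#
  bad-0 m = Level.lift (1 , ℕ.s≤s (ℕ.s≤s ℕ.z≤n) ,
    λ h → <-irrefl refl (<-respʳ (solve 0 (con (ℤ.+ 0) :* con 1ℤ :- con (ℤ.+ 0) := con (ℤ.+ 0)) refl) h))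

  -- 2 cos (π/M) is the supremum of the x with U k x ≤ 0 for some
  -- 0 < k ≤ M.
  module LeastUpperBound (M : ℕ) (s : Carrier) (upper : UpperBound (Bad M) s)
                         (least : ∀ u → UpperBound (Bad M) u → s ≤ u) where

    -- Positivity is an open condition: holding at `s`, it would hold just below `s` too, and
    -- `s - δ` would be a smaller upper bound.
    not-all-positive : ¬ PositiveUpTo M s
    not-all-positive pos = contradiction-near (PositiveUpTo-open M s pos)
      where
      contradiction-near : ¬ Near s (PositiveUpTo M)
      contradiction-near (δ , 0<δ , near) =
        least (s - δ) lowered (0<y-x⇒x<y (<-respʳ (solve 2 (λ s δ → δ := s :- (s :- δ)) refl s δ) 0<δ))
        where
        lowered : UpperBound (Bad M) (s - δ)
        lowered x bad@(Level.lift (k , k<M , u≤0)) s-δ<x = u≤0 (near x (left (compare s x) , right) k k<M)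
          where
          right : 0# < δ + (x - s)
          right = <-respʳ (solve 3 (λ x s δ → x :- (s :- δ) := δ :+ (x :- s)) refl x s δ) (x<y⇒0<y-x s-δ<x)
          left : Tri (s < x) (s ≈ x) (x < s) → 0# < δ - (x - s)
          left (tri< s<x _ _) = contradiction s<x (upper x bad)
          left (tri≈ _ s≈x _) = <-respʳ (trans (solve 2 (λ s δ → δ := δ :- (s :- s)) refl s δ) (+-congˡ (-‿cong (+-congʳ s≈x)))) 0<δ
          left (tri> _ _ x<s) = <-respʳ (solve 3 (λ x s δ → δ :+ (s :- x) := δ :- (x :- s)) refl x s δ) (+-pos 0<δ (x<y⇒0<y-x x<s))

    -- A negative value would persist slightly to the right of `s`, producing a bad point beyond the
    -- upper bound. Half the radius `δ` keeps that point strictly inside the neighbourhood.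
    not-negative : ∀ k → k ℕ.< M → ¬ U (suc k) s < 0#
    not-negative k k<M u<0 = contradiction-near
      (U-continuous Sign.- (suc k) s (<-respʳ (solve 1 (λ x → :- x := (:- con 1ℤ) :* x) refl _) (neg⇒0<- u<0)))
      where
      contradiction-near : ¬ Near s (λ y → HasSign Sign.- (U (suc k) y))
      contradiction-near (δ , 0<δ , near) = upper (s + ε) bad
        (0<y-x⇒x<y (<-respʳ (solve 2 (λ s e → e := s :+ e :- s) refl s ε) 0<ε))
        where
        ε = δ * 2# ⁻¹
        0<ε = *-pos 0<δ (⁻¹-pos 0<2)
        2ε≈δ : ε + ε ≈ δ
        2ε≈δ = trans (solve 2 (λ δ h → δ :* h :+ δ :* h := δ :* (con (ℤ.+ 2) :* h)) refl δ (2# ⁻¹))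
          (trans (*-congˡ (⁻¹-inverseʳ (pos⇒≉0 0<2))) (*-identityʳ δ))
        inside : (s + ε - s) <∣ δ ∣
        inside = <-respʳ (trans (solve 2 (λ s e → e := (e :+ e) :- (s :+ e :- s)) refl s ε) (+-congʳ 2ε≈δ)) 0<ε ,
                 <-respʳ (solve 3 (λ s e d → d :+ e := d :+ (s :+ e :- s)) refl s ε δ) (+-pos 0<δ 0<ε)
        bad : Bad M (s + ε)
        bad = Level.lift (k , k<M , λ 0<u → <-asym 0<u
          (0<-⇒neg (<-respʳ (solve 1 (λ x → (:- con 1ℤ) :* x := :- x) refl _) (near (s + ε) inside))))

    FirstZero : Set (ℓ₁ Level.⊔ ℓ₂)
    FirstZero = (∀ k → suc k ℕ.< M → 0# < U (suc k) s) × U M s ≈ 0#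

    next-negative : ∀ k → 0# < U (suc k) s → U (suc (suc k)) s ≈ 0# → U (suc (suc (suc k))) s < 0#
    next-negative k 0<v u≈0 = 0<-⇒neg (<-respʳ (sym (trans
      (-‿cong (trans (+-congʳ (trans (*-congˡ u≈0) (zeroʳ s))) (+-identityˡ _)))
      (solve 1 (λ x → :- (:- x) := x) refl _))) 0<v)

    -- Walking up from `U 1 = 1`, the values at `s` are never negative and not all positive, so
    -- there is a first zero. Before index `M` it would be followed by the negative of the value
    -- preceding it, which is excluded; so it sits at `M`.
    first-zero : ∀ fuel j → fuel ℕ.+ suc j ≡ M → PositiveUpTo (suc j) s → FirstZero
    first-zero zero       j ≡.refl pos = contradiction pos not-all-positive
    first-zero (suc fuel) j eq     pos = continue (compare 0# (U (suc (suc j)) s))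
      where
      j<M : suc j ℕ.< M
      j<M = ≡.subst (suc (suc j) ℕ.≤_) eq (ℕ.s≤s (ℕ.m≤n+m (suc j) fuel))
      finish : ∀ fuel → suc fuel ℕ.+ suc j ≡ M → U (suc (suc j)) s ≈ 0# → FirstZero
      finish zero       ≡.refl u≈0 = (λ { k (ℕ.s≤s k<) → pos k k< }) , u≈0
      finish (suc fuel) eq     u≈0 = contradiction (next-negative j (pos j ℕ.≤-refl) u≈0)
        (not-negative (suc (suc j)) (≡.subst (suc (suc (suc j)) ℕ.≤_) eq (ℕ.s≤s (ℕ.s≤s (ℕ.m≤n+m (suc j) fuel)))))
      continue : Tri (0# < U (suc (suc j)) s) (0# ≈ U (suc (suc j)) s) (U (suc (suc j)) s < 0#) → FirstZero
      continue (tri< 0<u _ _) = first-zero fuel (suc j) (≡.trans (ℕ.+-suc fuel (suc j)) eq) extend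
        where
        extend : PositiveUpTo (suc (suc j)) s
        extend k k<2+j with ℕ.m≤n⇒m<n∨m≡n (ℕ.s≤s⁻¹ k<2+j)
        ... | inj₁ k<1+j  = pos k k<1+j
        ... | inj₂ ≡.refl = 0<u
      continue (tri≈ _ 0≈u _) = finish fuel eq (sym 0≈u)
      continue (tri> _ _ u<0) = contradiction u<0 (not-negative (suc j) j<M)

    toAngle : ∀ m → M ≡ suc (suc m) → 0# ≤ s → Angle M
    toAngle m ≡.refl 0≤s = record
      { c        = s
      ; positive = λ { k (inj₂ k<M) → proj₁ result k k<M }
      ; closing  = λ _ → proj₂ result
      ; c²<4     = λ _ → *-pos (0<2-s (compare 2# s)) (0<2+s (compare 0# s))
      }
      where
      result = first-zero (suc m) 0 (ℕ.+-comm (suc m) 1) λ { zero _ → 0<1 ; (suc k) (ℕ.s≤s ()) }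
      0<2-s : Tri (2# < s) (2# ≈ s) (s < 2#) → 0# < 2# - s
      0<2-s (tri< 2<s _ _) = contradiction (proj₂ result) (pos⇒≉0 (proj₁ (U-increasing (<-asym 2<s) (suc m))))
      0<2-s (tri≈ _ 2≈s _) = contradiction (proj₂ result) (pos⇒≉0 (proj₁ (U-increasing (<-irrefl (sym 2≈s)) (suc m))))
      0<2-s (tri> _ _ s<2) = x<y⇒0<y-x s<2
      0<2+s : Tri (0# < s) (0# ≈ s) (s < 0#) → 0# < 2# + s
      0<2+s (tri< 0<s _ _) = +-pos 0<2 0<s
      0<2+s (tri≈ _ 0≈s _) = <-respʳ (trans (sym (+-identityʳ 2#)) (+-congˡ 0≈s)) 0<2
      0<2+s (tri> _ _ s<0) = contradiction s<0 0≤s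

  properAngle : ∀ m → Angle (suc (suc m))
  properAngle m = fromSupremum (supremum (Bad M) (0# , bad-0 m) (2# , bad-2 M))
    where
    M = suc (suc m)
    fromSupremum : (∃[ s ] UpperBound (Bad M) s × (∀ u → UpperBound (Bad M) u → s ≤ u)) → Angle M
    fromSupremum (s , upper , least) = LeastUpperBound.toAngle M s upper least m ≡.refl (upper 0# (bad-0 m))

  angle : ∀ m → m ≢ 1 → Angle m
  angle 0             _   = record
    { c        = 2#
    ; positive = λ k _ → proj₁ (U-increasing (<-irrefl refl) k)
    ; closing  = contradiction ≡.refl
    ; c²<4     = contradiction ≡.refl
    }
  angle 1             1≢1 = contradiction ≡.refl 1≢1
  angle (suc (suc m)) _   = properAngle m

  -- The Casoratian of the recursion, hence constant. Where `U (k+2)` vanishes it gives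
  -- `U (k+1)² = 1`.
  U-determinant : ∀ k x → U (suc k) x * U (suc k) x - U (suc (suc k)) x * U k x ≈ 1#
  U-determinant zero    x = solve 1 (λ x → con 1ℤ :* con 1ℤ :- (x :* con 1ℤ :- con (ℤ.+ 0)) :* con (ℤ.+ 0) := con 1ℤ) refl x
  U-determinant (suc k) x = trans
    (solve 3 (λ x u v → (x :* u :- v) :* (x :* u :- v) :- (x :* (x :* u :- v) :- u) :* u :=
      u :* u :- (x :* u :- v) :* v) refl x (U (suc k) x) (U k x))
    (U-determinant k x)

-- The order of sᵢ sⱼ, by the numbers game.

-- The contragredient of the geometric representation, in the coordinates
-- of the numbers game of Mozes.
module NumbersGame {a ℓ₁ ℓ₂} (ℝ : CompleteOrderedField a ℓ₁ ℓ₂)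
                   {n} {mat : Fin n → Fin n → ℕ} (isCoxeterMatrix : IsCoxeterMatrix mat) where
  open CompleteOrderedField ℝ hiding (zero)
  open OrderedField ℝ
  open Chebyshev ℝ
  open IsCoxeterMatrix isCoxeterMatrix
  open import Relation.Binary.Reasoning.Setoid setoid

  Position : Set a
  Position = Fin n → Carrier

  -- The matrix -2B of the geometric representation, whose bilinear form has B(αᵢ, αⱼ) = -cos
  -- (π/mᵢⱼ).
  coupling : Fin n → Fin n → Carrier
  coupling i j with i Fin.≟ j
  ... | yes _  = - 2#
  ... | no i≢j = Angle.c (angle (mat i j) (offDiagonal i≢j))

  coupling-diagonal : ∀ i → coupling i i ≈ - 2#
  coupling-diagonal i with i Fin.≟ i
  ... | yes _  = refl
  ... | no i≢i = contradiction ≡.refl i≢i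

  angle-irrelevant : ∀ {m m′} p q → m ≡ m′ → Angle.c (angle m p) ≡ Angle.c (angle m′ q)
  angle-irrelevant {0}           p q ≡.refl = ≡.refl
  angle-irrelevant {1}           p q ≡.refl = contradiction ≡.refl p
  angle-irrelevant {suc (suc m)} p q ≡.refl = ≡.refl

  coupling-angle : ∀ {i j} (i≢j : i ≢ j) → coupling i j ≈ Angle.c (angle (mat i j) (offDiagonal i≢j))
  coupling-angle {i} {j} i≢j with i Fin.≟ j
  ... | yes i≡j = contradiction i≡j i≢j
  ... | no p    = reflexive (angle-irrelevant (offDiagonal p) (offDiagonal i≢j) ≡.refl)

  coupling-symmetric : ∀ {i j} → i ≢ j → coupling j i ≈ coupling i j
  coupling-symmetric {i} {j} i≢j = trans (coupling-angle (i≢j ∘ ≡.sym))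
    (trans (reflexive (angle-irrelevant _ _ (symmetric j i))) (sym (coupling-angle i≢j)))

  fire : Fin n → Position → Position
  fire i x j = x j + coupling i j * x i

  act : List (Fin n) → Position → Position
  act []      x = x
  act (i ∷ u) x = act u (fire i x)

  infix 4 _≈̇_
  _≈̇_ : Position → Position → Set ℓ₁
  x ≈̇ y = ∀ i → x i ≈ y i

  fire-cong : ∀ i {x y} → x ≈̇ y → fire i x ≈̇ fire i y
  fire-cong i h j = +-cong (h j) (*-congˡ (h i))

  act-cong : ∀ u {x y} → x ≈̇ y → act u x ≈̇ act u y
  act-cong []      h = h
  act-cong (i ∷ u) h = act-cong u (fire-cong i h)

  act-++ : ∀ u v x → act (u ++ v) x ≡ act v (act u x)
  act-++ []      v x = ≡.refl
  act-++ (i ∷ u) v x = act-++ u v (fire i x)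

  fire-self : ∀ i x → fire i x i ≈ - x i
  fire-self i x = trans (+-congˡ (*-congʳ (coupling-diagonal i)))
    (solve 1 (λ x → x :+ (:- con (ℤ.+ 2)) :* x := :- x) refl (x i))

  fire-involutive : ∀ i x → fire i (fire i x) ≈̇ x
  fire-involutive i x j = trans (+-congˡ (*-congˡ (fire-self i x)))
    (solve 3 (λ x c y → x :+ c :* y :+ c :* (:- y) := x) refl (x j) (coupling i j) (x i))

  double : ℕ → ℕ
  double zero    = zero
  double (suc k) = suc (suc (double k))

  double-+ : ∀ k → double k ≡ k ℕ.+ k
  double-+ zero    = ≡.refl
  double-+ (suc k) = ≡.cong suc (≡.trans (≡.cong suc (double-+ k)) (≡.sym (ℕ.+-suc k k)))

  -- The values fired when i and j are fired alternately from a position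
  -- with values p and q at i and j.
  fired : (c p q : Carrier) → ℕ → Carrier
  fired c p q 0             = p
  fired c p q 1             = q + c * p
  fired c p q (suc (suc k)) = c * fired c p q (suc k) - fired c p q k

  fired-cong : ∀ {c p q p′ q′} → p ≈ p′ → q ≈ q′ → ∀ k → fired c p q k ≈ fired c p′ q′ k
  fired-cong p≈ q≈ 0             = p≈
  fired-cong p≈ q≈ 1             = +-cong q≈ (*-congˡ p≈)
  fired-cong p≈ q≈ (suc (suc k)) = +-cong (*-congˡ (fired-cong p≈ q≈ (suc k))) (-‿cong (fired-cong p≈ q≈ k))

  -- Firing once turns the values `p`, `q` into `- p`, `q + c p`; read with the two nodes exchanged,
  -- they continue the same sequence.
  fired-suc : ∀ c p q k → fired c (q + c * p) (- p) k ≈ fired c p q (suc k)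
  fired-suc c p q 0             = refl
  fired-suc c p q 1             = +-comm _ _
  fired-suc c p q (suc (suc k)) = +-cong (*-congˡ (fired-suc c p q (suc k))) (-‿cong (fired-suc c p q k))

  fired-U : ∀ c p q k → fired c p q k ≈ U (suc k) c * p + U k c * q
  fired-U c p q 0 = solve 2 (λ p q → p := con 1ℤ :* p :+ con (ℤ.+ 0) :* q) refl p q
  fired-U c p q 1 = solve 3 (λ c p q → q :+ c :* p := (c :* con 1ℤ :- con (ℤ.+ 0)) :* p :+ con 1ℤ :* q) refl c p q
  fired-U c p q (suc (suc k)) = trans (+-cong (*-congˡ (fired-U c p q (suc k))) (-‿cong (fired-U c p q k)))
    (solve 6 (λ c p q u v w → c :* (w :* p :+ u :* q) :- (u :* p :+ v :* q) := (c :* w :- u) :* p :+ (c :* u :- v) :* q)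
      refl c p q (U (suc k) c) (U k c) (U (suc (suc k)) c))

  -- A recursion of order two is determined by two consecutive values, so negating two of them
  -- negates everything after them.
  fired-antiperiodic : ∀ c p q m → fired c p q m ≈ - p → fired c p q (suc m) ≈ - (q + c * p) →
                       ∀ k → fired c p q (k ℕ.+ m) ≈ - fired c p q k
  fired-antiperiodic c p q m h₀ h₁ 0 = h₀
  fired-antiperiodic c p q m h₀ h₁ 1 = h₁
  fired-antiperiodic c p q m h₀ h₁ (suc (suc k)) = trans
    (+-cong (*-congˡ (fired-antiperiodic c p q m h₀ h₁ (suc k))) (-‿cong (fired-antiperiodic c p q m h₀ h₁ k)))
    (solve 3 (λ c x y → c :* (:- x) :- :- y := :- (c :* x :- y)) refl c _ _)

  module _ {i j : Fin n} (i≢j : i ≢ j) where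
    private
      c = coupling i j
      m = mat i j
      A = angle m (offDiagonal i≢j)
      c≈ : c ≈ Angle.c A
      c≈ = coupling-angle i≢j

    -- After `m` steps the angle has advanced by π: `U m = 0` and `U (m+1) = -1` negate two
    -- consecutive values. A second half turn restores them.
    fired-period : m ≢ 0 → ∀ p q →
      fired c p q (double m) ≈ p × fired c p q (suc (double m)) ≈ q + c * p
    fired-period m≢0 p q rewrite double-+ m =
      trans (antiperiodic m) (trans (-‿cong h₀) (solve 1 (λ x → :- (:- x) := x) refl p)) ,
      trans (antiperiodic (suc m)) (trans (-‿cong h₁) (solve 1 (λ x → :- (:- x) := x) refl _))
      where
      U-m : U m c ≈ 0#
      U-m = trans (U-cong m c≈) (Angle.closing A m≢0)
      predecessor : ∀ m → m ≢ 1 → m ≢ 0 → U m c ≈ 0# → (∀ k → suc k ℕ.< m → 0# < U (suc k) c) → U (suc m) c ≈ - 1#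
      predecessor 0 _ m≢0 _ _ = contradiction ≡.refl m≢0
      predecessor 1 m≢1 _ _ _ = contradiction ≡.refl m≢1
      predecessor (suc (suc k)) _ _ U≈0 pos = begin
        c * U (suc (suc k)) c - u
          ≈⟨ +-congʳ (trans (*-congˡ U≈0) (zeroʳ c)) ⟩
        0# - u
          ≈⟨ trans (+-identityˡ _) (-‿cong u≈1) ⟩
        - 1# ∎
        where
        u = U (suc k) c
        0<u = pos k ℕ.≤-refl
        u²≈1 : u * u ≈ 1#
        u²≈1 = trans (solve 2 (λ u v → u :* u := u :* u :- con (ℤ.+ 0) :* v) refl u (U k c))
          (trans (+-congˡ (-‿cong (*-congʳ (sym U≈0)))) (U-determinant k c))
        -- Positivity before the first zero selects the root: `u + 1` is nonzero and can be
        -- cancelled from `u² - 1 = 0`.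
        u≈1 : u ≈ 1#
        u≈1 = trans (solve 1 (λ u → u := u :- con 1ℤ :+ con 1ℤ) refl u)
          (trans (+-congʳ (*-cancelˡ-0 (pos⇒≉0 (+-pos 0<u 0<1))
            (trans (solve 1 (λ u → (u :+ con 1ℤ) :* (u :- con 1ℤ) := u :* u :- con 1ℤ) refl u)
              (trans (+-congʳ u²≈1) (-‿inverseʳ 1#))))) (+-identityˡ 1#))
      U-suc-m : U (suc m) c ≈ - 1#
      U-suc-m = predecessor m (offDiagonal i≢j) m≢0 U-m
        (λ k k<m → <-respʳ (sym (U-cong (suc k) c≈)) (Angle.positive A k (inj₂ k<m)))
      h₀ : fired c p q m ≈ - p
      h₀ = trans (fired-U c p q m) (trans (+-cong (*-congʳ U-suc-m) (*-congʳ U-m))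
        (solve 2 (λ p q → (:- con 1ℤ) :* p :+ con (ℤ.+ 0) :* q := :- p) refl p q))
      h₁ : fired c p q (suc m) ≈ - (q + c * p)
      h₁ = trans (fired-U c p q (suc m))
        (trans (+-cong (*-congʳ (+-cong (*-congˡ U-suc-m) (-‿cong U-m))) (*-congʳ U-suc-m))
          (solve 3 (λ c p q → (c :* (:- con 1ℤ) :- con (ℤ.+ 0)) :* p :+ (:- con 1ℤ) :* q := :- (q :+ c :* p)) refl c p q))
      antiperiodic = fired-antiperiodic c p q m h₀ h₁

    powers : ℕ → List (Fin n)
    powers k = List.concat (List.replicate k (i ∷ j ∷ []))

    -- Every value changes only by multiples of two rows of `coupling`, with `s` and `t` the total
    -- amounts fired at `i` and at `j`. The value at `j` is recorded together with `c` times that at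
    -- `i`, since this is what `j` fires once `i` has been fired.
    act-powers : ∀ k x → ∃[ s ] ∃[ t ]
      (∀ l → act (powers k) x l ≈ x l + coupling i l * s + coupling j l * t)
      × act (powers k) x i ≈ fired c (x i) (x j) (double k)
      × act (powers k) x j + c * act (powers k) x i ≈ fired c (x i) (x j) (suc (double k))
    act-powers zero x = 0# , 0# ,
      (λ l → solve 3 (λ x a b → x := x :+ a :* con (ℤ.+ 0) :+ b :* con (ℤ.+ 0)) refl (x l) _ _) , refl , refl
    act-powers (suc k) x with act-powers k (fire j (fire i x))
    ... | s , t , h , hᵢ , hⱼ = x i + s , q + t , sums ,
          trans hᵢ (shift (double k)) , trans hⱼ (shift (suc (double k)))
      where
      q = x j + c * x i
      y = fire j (fire i x)
      sums : ∀ l → act (powers k) y l ≈ x l + coupling i l * (x i + s) + coupling j l * (q + t)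
      sums l = trans (h l) (solve 7 (λ x a p b q s t →
        x :+ a :* p :+ b :* q :+ a :* s :+ b :* t := x :+ a :* (p :+ s) :+ b :* (q :+ t)) refl
        (x l) (coupling i l) (x i) (coupling j l) q s t)
      y-i : y i ≈ q * c + - x i
      y-i = trans (+-cong (fire-self i x) (*-congʳ (coupling-symmetric i≢j)))
        (solve 3 (λ x c q → :- x :+ c :* q := q :* c :+ :- x) refl (x i) c q)
      y-j : y j ≈ - q
      y-j = fire-self j (fire i x)
      shift : ∀ l → fired c (y i) (y j) l ≈ fired c (x i) (x j) (suc (suc l))
      shift l = trans (fired-cong (trans y-i (solve 3 (λ x c q → q :* c :+ :- x := (:- x) :+ c :* q) refl (x i) c q)) y-j l)
        (trans (fired-suc c q (- x i) l) (fired-suc c (x i) (x j) (suc l)))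

    -- After `m` rounds the values at `i` and `j` have returned, so the totals `s` and `t` solve a
    -- homogeneous 2 × 2 system of determinant `4 - c²`. Both vanish, and with them the change at
    -- every other node.
    act-relator : ∀ x → act (powers m) x ≈̇ x
    act-relator x with m ℕ.≟ 0
    ... | yes m≡0 = λ l → reflexive (≡.cong (λ k → act (powers k) x l) m≡0)
    ... | no m≢0 with act-powers m x
    ...   | s , t , h , hᵢ , hⱼ = λ l → trans (h l) (trans
            (+-cong (+-congˡ (trans (*-congˡ s≈0) (zeroʳ _))) (trans (*-congˡ t≈0) (zeroʳ _)))
            (trans (+-identityʳ _) (+-identityʳ _)))
      where
      return-i : act (powers m) x i ≈ x i
      return-i = trans hᵢ (proj₁ (fired-period m≢0 (x i) (x j)))
      return-j : act (powers m) x j ≈ x j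
      return-j = trans (solve 2 (λ y z → y := y :+ z :- z) refl _ (c * x i))
        (trans (+-congʳ (trans (+-congˡ (*-congˡ (sym return-i))) (trans hⱼ (proj₂ (fired-period m≢0 (x i) (x j))))))
          (solve 2 (λ y z → y :+ z :- z := y) refl _ _))
      eqᵢ : - 2# * s + c * t ≈ 0#
      eqᵢ = trans (+-cong (*-congʳ (sym (coupling-diagonal i))) (*-congʳ (sym (coupling-symmetric i≢j))))
        (trans (solve 3 (λ x a b → a :+ b := x :+ a :+ b :- x) refl (x i) _ _)
          (trans (+-congʳ (trans (sym (h i)) return-i)) (-‿inverseʳ _)))
      eqⱼ : c * s + - 2# * t ≈ 0#
      eqⱼ = trans (+-congˡ (*-congʳ (sym (coupling-diagonal j))))
        (trans (solve 3 (λ x a b → a :+ b := x :+ a :+ b :- x) refl (x j) _ _)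
          (trans (+-congʳ (trans (sym (h j)) return-j)) (-‿inverseʳ _)))
      discriminant : ¬ (2# - c) * (2# + c) ≈ 0#
      discriminant = pos⇒≉0 (<-respʳ (*-cong (+-congˡ (-‿cong (sym c≈))) (+-congˡ (sym c≈))) (Angle.c²<4 A m≢0))
      s≈0 : s ≈ 0#
      s≈0 = *-cancelˡ-0 discriminant (trans
        (solve 3 (λ c s t → (con (ℤ.+ 2) :- c) :* (con (ℤ.+ 2) :+ c) :* s :=
          (:- con (ℤ.+ 2)) :* ((:- con (ℤ.+ 2)) :* s :+ c :* t) :+ (:- c) :* (c :* s :+ (:- con (ℤ.+ 2)) :* t)) refl c s t)
        (trans (+-cong (trans (*-congˡ eqᵢ) (zeroʳ _)) (trans (*-congˡ eqⱼ) (zeroʳ _))) (+-identityʳ _)))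
      t≈0 : t ≈ 0#
      t≈0 = *-cancelˡ-0 discriminant (trans
        (solve 3 (λ c s t → (con (ℤ.+ 2) :- c) :* (con (ℤ.+ 2) :+ c) :* t :=
          (:- c) :* ((:- con (ℤ.+ 2)) :* s :+ c :* t) :+ (:- con (ℤ.+ 2)) :* (c :* s :+ (:- con (ℤ.+ 2)) :* t)) refl c s t)
        (trans (+-cong (trans (*-congˡ eqᵢ) (zeroʳ _)) (trans (*-congˡ eqⱼ) (zeroʳ _))) (+-identityʳ _)))

  act-deletion : ∀ {u v} → RelatorDeletion mat u v → ∀ x → act u x ≈̇ act v x
  act-deletion (delete u i j v) x rewrite act-++ u (List.concat (List.replicate (mat i j) (i ∷ j ∷ [])) ++ v) x
    | act-++ (List.concat (List.replicate (mat i j) (i ∷ j ∷ []))) v (act u x) | act-++ u v x =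
    act-cong v (relator (i Fin.≟ j) (act u x))
    where
    relator : Dec (i ≡ j) → ∀ y → act (List.concat (List.replicate (mat i j) (i ∷ j ∷ []))) y ≈̇ y
    relator (no i≢j)     y = act-relator i≢j y
    relator (yes ≡.refl) y rewrite diagonal i = fire-involutive i y

  act-≈ : ∀ {u v} → EqClosure (RelatorDeletion mat) u v → ∀ x → act u x ≈̇ act v x
  act-≈ = EqClosure.fold (record
    { refl  = λ x i → refl
    ; sym   = λ h x i → sym (h x i)
    ; trans = λ h k x i → trans (h x i) (k x i)
    }) act-deletion

  -- After `k` alternating firings that start with `i`, the first component is the node due next;
  -- for positive `k` the second is the one just fired.
  ends : ℕ → Fin n → Fin n → Fin n × Fin n
  ends zero    i j = i , j
  ends (suc k) i j = ends k j i

  ends-swap : ∀ k i j → ends k j i ≡ swap (ends k i j)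
  ends-swap zero    i j = ≡.refl
  ends-swap (suc k) i j = ends-swap k j i

  act-alternating : ∀ {i j} → i ≢ j → ∀ {c} → coupling i j ≈ c → ∀ k x →
    act (alternating k i j) x (proj₁ (ends k i j)) ≈ fired c (x i) (x j) k
    × act (alternating k i j) x (proj₂ (ends k i j)) ≈ fired c (x i) (x j) (suc k) - c * fired c (x i) (x j) k
  act-alternating i≢j c≈ zero    x = refl , solve 2 (λ a b → a := a :+ b :- b) refl _ _
  act-alternating {i} {j} i≢j {c} c≈ (suc k) x with act-alternating (i≢j ∘ ≡.sym) (trans (coupling-symmetric i≢j) c≈) k (fire i x)
  ... | h , h′ = trans h (shift k) , trans h′ (+-cong (shift (suc k)) (-‿cong (*-congˡ (shift k))))
    where
    shift : ∀ l → fired c (fire i x j) (fire i x i) l ≈ fired c (x i) (x j) (suc l)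
    shift l = trans (fired-cong (+-congˡ (*-congʳ c≈)) (fire-self i x) l) (fired-suc c (x i) (x j) l)

  -- Both words are played from the position with all values 1 and compared at the node `y` that the
  -- first word would fire next. There the first word leaves a positive value, whereas the second
  -- has just fired `y` and leaves a negative one.
  alternating-distinct : ∀ {i j} → i ≢ j → ∀ k → mat i j ≡ 0 ⊎ suc k ℕ.< mat i j →
    ¬ EqClosure (RelatorDeletion mat) (alternating (suc k) i j) (alternating (suc k) j i)
  alternating-distinct {i} {j} i≢j k k<m eq = <-asym (positive-fired k (weaken k<m)) (0<-⇒neg
    (<-respʳ (trans (sym last-j) (trans (act-≈ eq one y) (trans (reflexive (≡.cong (act (alternating (suc k) j i) one) (≡.sym first-y)))
       (trans (proj₂ from-j) (lower-term (suc k)))))) (positive-fired (suc k) k<m)))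
    where
    c = Angle.c (angle (mat i j) (offDiagonal i≢j))
    one : Position
    one _ = 1#
    y = proj₁ (ends (suc k) i j)
    first-y : proj₂ (ends (suc k) j i) ≡ y
    first-y = ≡.cong proj₂ (ends-swap (suc k) i j)
    last-j = proj₁ (act-alternating i≢j (coupling-angle i≢j) (suc k) one)
    from-j = act-alternating (i≢j ∘ ≡.sym) (trans (coupling-symmetric i≢j) (coupling-angle i≢j)) (suc k) one
    lower-term : ∀ l → fired c 1# 1# (suc (suc k)) - c * fired c 1# 1# (suc k) ≈ - fired c 1# 1# k
    lower-term _ = solve 3 (λ c a b → c :* a :- b :- c :* a := :- b) refl c _ _
    weaken : mat i j ≡ 0 ⊎ suc k ℕ.< mat i j → mat i j ≡ 0 ⊎ k ℕ.< mat i j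
    weaken (inj₁ m≡0) = inj₁ m≡0
    weaken (inj₂ k<m) = inj₂ (ℕ.<-trans ℕ.≤-refl k<m)
    positive : ∀ l → mat i j ≡ 0 ⊎ suc l ℕ.< mat i j → 0# < U (suc l) c
    positive = Angle.positive (angle (mat i j) (offDiagonal i≢j))
    positive-fired : ∀ l → mat i j ≡ 0 ⊎ l ℕ.< mat i j → 0# < fired c 1# 1# l
    positive-fired zero    _ = 0<1
    positive-fired (suc l) h = <-respʳ (sym (trans (fired-U c 1# 1# (suc l)) (+-cong (*-identityʳ _) (*-identityʳ _)))) (next-two h)
      where
      next-two : mat i j ≡ 0 ⊎ suc l ℕ.< mat i j → 0# < U (suc (suc l)) c + U (suc l) c
      next-two (inj₁ m≡0) = +-pos (positive (suc l) (inj₁ m≡0)) (positive l (inj₁ m≡0))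
      -- At the last admissible index the leading term is `U m = 0`, and positivity rests on its
      -- predecessor alone.
      next-two (inj₂ l<m) with ℕ.m≤n⇒m<n∨m≡n l<m
      ... | inj₁ l+2<m = +-pos (positive (suc l) (inj₂ l+2<m)) (positive l (inj₂ l<m))
      ... | inj₂ l+2≡m = <-respʳ (sym (trans (+-congʳ closing) (+-identityˡ _))) (positive l (inj₂ l<m))
        where
        closing : U (suc (suc l)) c ≈ 0#
        closing = trans (reflexive (≡.cong (λ k → U k c) l+2≡m))
          (Angle.closing (angle (mat i j) (offDiagonal i≢j)) λ m≡0 → contradiction (≡.trans l+2≡m m≡0) λ ())

-- Words, the exchange condition and Matsumoto's theorem with signs.

module Vectors {a} {A : Set a} where

  vec : ∀ {k} (u : List A) → length u ≡ k → Vec A k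
  vec {zero}  []      e = []
  vec {suc k} (x ∷ u) e = x ∷ vec u (ℕ.suc-injective e)

  toList-vec : ∀ {k} u (e : length u ≡ k) → toList (vec u e) ≡ u
  toList-vec {zero}  []      e = ≡.refl
  toList-vec {suc k} (x ∷ u) e = ≡.cong (x ∷_) (toList-vec u (ℕ.suc-injective e))

  vec-toList : ∀ {k} (v : Vec A k) e → vec (toList v) e ≡ v
  vec-toList []      e = ≡.refl
  vec-toList (x ∷ v) e = ≡.cong (x ∷_) (vec-toList v (ℕ.suc-injective e))

open Vectors

module Words {c ℓ} (W : CoxeterSystem c ℓ) where
  open CoxeterSystem W
  open Group group public using (assoc; identityˡ; identityʳ; ∙-cong; ∙-congˡ; ∙-congʳ; refl; sym; trans; reflexive; setoid)
  open IsCoxeterMatrix isCoxeterMatrix public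
  open GroupProperties group public using (∙-cancelˡ; ∙-cancelʳ)
  open import Relation.Binary.Reasoning.Setoid setoid

  ⟦⟧-++ : ∀ u v → ⟦ u ++ v ⟧ ≈ ⟦ u ⟧ ∙ ⟦ v ⟧
  ⟦⟧-++ []      v = sym (identityˡ _)
  ⟦⟧-++ (i ∷ u) v = trans (∙-congˡ (⟦⟧-++ u v)) (sym (assoc _ _ _))

  relator : S → S → List S
  relator i j = List.concat (List.replicate (mat i j) (i ∷ j ∷ []))

  relator≈ε : ∀ i j → ⟦ relator i j ⟧ ≈ ε
  relator≈ε i j = Equivalence.from (presentation (relator i j) [])
    (EqClosure.return (≡.subst (λ w → RelatorDeletion mat w []) (List.++-identityʳ (relator i j)) (delete [] i j [])))

  involutive : ∀ i → generator i ∙ generator i ≈ ε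
  involutive i = trans (∙-congˡ (sym (identityʳ _))) (≡.subst
    (λ m → ⟦ List.concat (List.replicate m (i ∷ i ∷ [])) ⟧ ≈ ε) (diagonal i) (relator≈ε i i))

  cancel-generator : ∀ i x → generator i ∙ (generator i ∙ x) ≈ x
  cancel-generator i x = trans (sym (assoc _ _ _)) (trans (∙-congʳ (involutive i)) (identityˡ x))

  record Reduced (u : List S) : Set ℓ where
    constructor isReduced
    field
      minimal : ∀ v → ⟦ v ⟧ ≈ ⟦ u ⟧ → length u ℕ.≤ length v
  open Reduced public

  reduced-prefix : ∀ u v → Reduced (u ++ v) → Reduced u
  reduced-prefix u v red .minimal u′ eq = ℕ.+-cancelʳ-≤ (length v) _ _ (≡.subst₂ ℕ._≤_ (List.length-++ u) (List.length-++ u′)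
    (minimal red (u′ ++ v) (trans (⟦⟧-++ u′ v) (trans (∙-congʳ eq) (sym (⟦⟧-++ u v))))))

  reduced-suffix : ∀ u v → Reduced (u ++ v) → Reduced v
  reduced-suffix u v red .minimal v′ eq = ℕ.+-cancelˡ-≤ (length u) _ _ (≡.subst₂ ℕ._≤_ (List.length-++ u) (List.length-++ u)
    (minimal red (u ++ v′) (trans (⟦⟧-++ u v′) (trans (∙-congˡ eq) (sym (⟦⟧-++ u v))))))

  reduced-≈ : ∀ {u v} → Reduced u → ⟦ v ⟧ ≈ ⟦ u ⟧ → length v ℕ.≤ length u → Reduced v
  reduced-≈ red eq v≤u .minimal w w≈v = ℕ.≤-trans v≤u (minimal red w (trans w≈v eq))

  reduced-length : ∀ {u v} → Reduced u → Reduced v → ⟦ u ⟧ ≈ ⟦ v ⟧ → length u ≡ length v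
  reduced-length {u} {v} ru rv eq = ℕ.≤-antisym (minimal ru v (sym eq)) (minimal rv u eq)

  ∷-cancel : ∀ i u v → ⟦ i ∷ u ⟧ ≈ ⟦ i ∷ v ⟧ → ⟦ u ⟧ ≈ ⟦ v ⟧
  ∷-cancel i u v = ∙-cancelˡ (generator i) ⟦ u ⟧ ⟦ v ⟧

  ++-cancelˡ : ∀ x u v → ⟦ x ++ u ⟧ ≈ ⟦ x ++ v ⟧ → ⟦ u ⟧ ≈ ⟦ v ⟧
  ++-cancelˡ []      u v h = h
  ++-cancelˡ (i ∷ x) u v h = ++-cancelˡ x u v (∷-cancel i (x ++ u) (x ++ v) h)

  ++-cancelʳ : ∀ x y u v → ⟦ x ++ u ++ y ⟧ ≈ ⟦ x ++ v ++ y ⟧ → ⟦ u ⟧ ≈ ⟦ v ⟧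
  ++-cancelʳ x y u v h = ∙-cancelʳ ⟦ y ⟧ ⟦ u ⟧ ⟦ v ⟧
    (trans (sym (⟦⟧-++ u y)) (trans (++-cancelˡ x (u ++ y) (v ++ y) h) (⟦⟧-++ v y)))

  alternating-concat : ∀ k (i j : S) → List.concat (List.replicate k (i ∷ j ∷ [])) ≡ alternating (k ℕ.+ k) i j
  alternating-concat zero    i j = ≡.refl
  alternating-concat (suc k) i j rewrite ℕ.+-suc k k = ≡.cong (λ w → i ∷ j ∷ w) (alternating-concat k i j)

  length-alternating : ∀ {A : Set} k (i j : A) → length (alternating k i j) ≡ k
  length-alternating zero    i j = ≡.refl
  length-alternating (suc k) i j = ≡.cong suc (length-alternating k j i)

  -- Generators are involutions, so letters of a relation can be carried one at a time to the other
  -- side. Both starting letters are treated together because removing one letter exchanges them.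
  braid-sides : ∀ k l i j → ⟦ alternating (k ℕ.+ l) i j ⟧ ≈ ε → ⟦ alternating (k ℕ.+ l) j i ⟧ ≈ ε →
    ⟦ alternating k i j ⟧ ≈ ⟦ alternating l j i ⟧ × ⟦ alternating k j i ⟧ ≈ ⟦ alternating l i j ⟧
  braid-sides zero    l i j h h′ = sym h′ , sym h
  braid-sides (suc k) l i j h h′
    with braid-sides k (suc l) i j (≡.subst (λ m → ⟦ alternating m i j ⟧ ≈ ε) (≡.sym (ℕ.+-suc k l)) h)
                                   (≡.subst (λ m → ⟦ alternating m j i ⟧ ≈ ε) (≡.sym (ℕ.+-suc k l)) h′)
  ... | e , e′ = trans (∙-congˡ e′) (cancel-generator i _) , trans (∙-congˡ e) (cancel-generator j _)

  braid-≈ : ∀ i j → ⟦ alternating (mat i j) i j ⟧ ≈ ⟦ alternating (mat i j) j i ⟧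
  braid-≈ i j = proj₁ (braid-sides (mat i j) (mat i j) i j
    (trans (reflexive (≡.cong ⟦_⟧ (≡.sym (alternating-concat (mat i j) i j)))) (relator≈ε i j))
    (trans (reflexive (≡.cong ⟦_⟧ (≡.trans (≡.cong (λ m → alternating (m ℕ.+ m) j i) (symmetric i j))
      (≡.sym (alternating-concat (mat j i) j i))))) (relator≈ε j i)))

  module Exchange (_≟_ : Decidable₂ _≈_) where

    does-cong : ∀ {a b c d} → (a ≈ b → c ≈ d) → (c ≈ d → a ≈ b) → does (a ≟ b) ≡ does (c ≟ d)
    does-cong {a} {b} {c} {d} f g with a ≟ b | c ≟ d
    ... | yes _ | yes _ = ≡.refl
    ... | no _  | no _  = ≡.refl
    ... | yes p | no q  = contradiction (f p) q
    ... | no p  | yes q = contradiction (g q) p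

    conjugate : S → Element → Element
    conjugate i t = generator i ∙ (t ∙ generator i)

    conjugate-cong : ∀ i {t t′} → t ≈ t′ → conjugate i t ≈ conjugate i t′
    conjugate-cong i eq = ∙-congˡ (∙-congʳ eq)

    conjugate-involutive : ∀ i t → conjugate i (conjugate i t) ≈ t
    conjugate-involutive i t = begin
      s ∙ (s ∙ (t ∙ s) ∙ s)   ≈⟨ ∙-congˡ (assoc _ _ _) ⟩
      s ∙ (s ∙ (t ∙ s ∙ s))   ≈⟨ cancel-generator i _ ⟩
      t ∙ s ∙ s               ≈⟨ assoc _ _ _ ⟩
      t ∙ (s ∙ s)             ≈⟨ ∙-congˡ (involutive i) ⟩
      t ∙ ε                   ≈⟨ identityʳ t ⟩
      t                       ∎
      where s = generator i

    conjugates : List S → Element → Element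
    conjugates []      t = t
    conjugates (i ∷ u) t = conjugates u (conjugate i t)

    -- Thus `conjugates u t` is the conjugate u⁻¹ t u, stated without the inverse.
    conjugates-spec : ∀ u t → ⟦ u ⟧ ∙ conjugates u t ≈ t ∙ ⟦ u ⟧
    conjugates-spec []      t = trans (identityˡ t) (sym (identityʳ t))
    conjugates-spec (i ∷ u) t = begin
      s ∙ ⟦ u ⟧ ∙ conjugates u (conjugate i t)    ≈⟨ assoc _ _ _ ⟩
      s ∙ (⟦ u ⟧ ∙ conjugates u (conjugate i t))  ≈⟨ ∙-congˡ (conjugates-spec u _) ⟩
      s ∙ (s ∙ (t ∙ s) ∙ ⟦ u ⟧)                   ≈⟨ ∙-congˡ (assoc _ _ _) ⟩
      s ∙ (s ∙ (t ∙ s ∙ ⟦ u ⟧))                   ≈⟨ cancel-generator i _ ⟩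
      t ∙ s ∙ ⟦ u ⟧                               ≈⟨ assoc _ _ _ ⟩
      t ∙ (s ∙ ⟦ u ⟧)                             ∎
      where s = generator i

    -- Whether the reflection t occurs an odd number of times in the
    -- sequence s₁, s₁s₂s₁, s₁s₂s₃s₂s₁, … attached to a word s₁s₂s₃….
    crosses : List S → Element → Bool
    crosses []      t = false
    crosses (i ∷ u) t = does (t ≟ generator i) xor crosses u (conjugate i t)

    crosses-cong : ∀ u {t t′} → t ≈ t′ → crosses u t ≡ crosses u t′
    crosses-cong []      eq = ≡.refl
    crosses-cong (i ∷ u) eq = ≡.cong₂ _xor_ (does-cong (trans (sym eq)) (trans eq)) (crosses-cong u (conjugate-cong i eq))

    crosses-++ : ∀ u v t → crosses (u ++ v) t ≡ crosses u t xor crosses v (conjugates u t)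
    crosses-++ []      v t = ≡.refl
    crosses-++ (i ∷ u) v t = ≡.trans (≡.cong (does (t ≟ generator i) xor_) (crosses-++ u v _))
      (≡.sym (Bool.xor-assoc (does (t ≟ generator i)) _ _))

    -- The element (sᵢ sⱼ)ᵏ sᵢ, entry `k` (counted from 0) of the reflection sequence of an
    -- alternating word.
    reflection : ℕ → S → S → Element
    reflection zero    i j = generator i
    reflection (suc k) i j = conjugate i (reflection k j i)

    among : ℕ → ℕ → S → S → Element → Bool
    among k zero    i j t = false
    among k (suc l) i j t = does (t ≟ reflection k i j) xor among (suc k) l i j t

    among-conjugate : ∀ k l i j t → among k l j i (conjugate i t) ≡ among (suc k) l i j t
    among-conjugate k zero    i j t = ≡.refl
    among-conjugate k (suc l) i j t = ≡.cong₂ _xor_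
      (does-cong (λ eq → trans (sym (conjugate-involutive i t)) (conjugate-cong i eq))
                 (λ eq → trans (conjugate-cong i eq) (conjugate-involutive i _)))
      (among-conjugate (suc k) l i j t)

    crosses-alternating : ∀ l i j t → crosses (alternating l i j) t ≡ among 0 l i j t
    crosses-alternating zero    i j t = ≡.refl
    crosses-alternating (suc l) i j t = ≡.cong (does (t ≟ generator i) xor_)
      (≡.trans (crosses-alternating l j i _) (among-conjugate 0 l i j t))

    among-+ : ∀ k l l′ i j t → among k (l ℕ.+ l′) i j t ≡ among k l i j t xor among (k ℕ.+ l) l′ i j t
    among-+ k zero    l′ i j t = ≡.cong (λ k → among k l′ i j t) (≡.sym (ℕ.+-identityʳ k))
    among-+ k (suc l) l′ i j t = ≡.trans (≡.cong (does (t ≟ reflection k i j) xor_) (among-+ (suc k) l l′ i j t))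
      (≡.trans (≡.sym (Bool.xor-assoc (does (t ≟ reflection k i j)) _ _))
        (≡.cong (λ k′ → (does (t ≟ reflection k i j) xor among (suc k) l i j t) xor among k′ l′ i j t) (≡.sym (ℕ.+-suc k l))))

    reflection-suc : ∀ k i j → reflection (suc k) i j ≈ generator i ∙ (generator j ∙ reflection k i j)
    reflection-suc zero    i j = refl
    reflection-suc (suc k) i j = begin
      s ∙ (reflection (suc k) j i ∙ s)              ≈⟨ ∙-congˡ (∙-congʳ (reflection-suc k j i)) ⟩
      s ∙ (r ∙ (s ∙ reflection k j i) ∙ s)          ≈⟨ ∙-congˡ (assoc _ _ _) ⟩
      s ∙ (r ∙ (s ∙ reflection k j i ∙ s))          ≈⟨ ∙-congˡ (∙-congˡ (assoc _ _ _)) ⟩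
      s ∙ (r ∙ (s ∙ (reflection k j i ∙ s)))        ∎
      where
      s = generator i
      r = generator j

    reflection-+ : ∀ m k i j → reflection (m ℕ.+ k) i j ≈ ⟦ List.concat (List.replicate m (i ∷ j ∷ [])) ⟧ ∙ reflection k i j
    reflection-+ zero    k i j = sym (identityˡ _)
    reflection-+ (suc m) k i j = trans (reflection-suc (m ℕ.+ k) i j)
      (trans (∙-congˡ (∙-congˡ (reflection-+ m k i j)))
        (trans (∙-congˡ (sym (assoc _ _ _))) (sym (assoc _ _ _))))

    reflection-period : ∀ i j k → reflection (mat i j ℕ.+ k) i j ≈ reflection k i j
    reflection-period i j k = trans (reflection-+ (mat i j) k i j) (trans (∙-congʳ (relator≈ε i j)) (identityˡ _))

    among-period : ∀ i j k l t → among (mat i j ℕ.+ k) l i j t ≡ among k l i j t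
    among-period i j k zero    t = ≡.refl
    among-period i j k (suc l) t = ≡.cong₂ _xor_
      (does-cong (λ eq → trans eq (reflection-period i j k)) (λ eq → trans eq (sym (reflection-period i j k))))
      (≡.trans (≡.cong (λ k′ → among k′ l i j t) (≡.sym (ℕ.+-suc (mat i j) k))) (among-period i j (suc k) l t))

    -- A relator has length 2m, and the reflections (sᵢ sⱼ)ᵏ sᵢ repeat with period m because (sᵢ
    -- sⱼ)ᵐ = 1. The two halves of the sequence agree and cancel modulo 2.
    crosses-relator : ∀ i j t → crosses (relator i j) t ≡ false
    crosses-relator i j t = ≡.trans (≡.cong (λ w → crosses w t) (alternating-concat m i j))
      (≡.trans (crosses-alternating (m ℕ.+ m) i j t) (≡.trans (among-+ 0 m m i j t)
        (≡.trans (≡.cong (among 0 m i j t xor_)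
            (≡.trans (≡.cong (λ k → among k m i j t) (≡.sym (ℕ.+-identityʳ m))) (among-period i j 0 m t)))
          (Bool.xor-same (among 0 m i j t)))))
      where m = mat i j

    crosses-deletion : ∀ {u v} → RelatorDeletion mat u v → ∀ t → crosses u t ≡ crosses v t
    crosses-deletion (delete u i j v) t = ≡.trans (crosses-++ u (relator i j ++ v) t)
      (≡.trans (≡.cong (crosses u t xor_) (≡.trans (crosses-++ (relator i j) v t′)
          (≡.cong₂ _xor_ (crosses-relator i j t′) (crosses-cong v unmoved))))
        (≡.sym (crosses-++ u v t)))
      where
      t′ = conjugates u t
      unmoved : conjugates (relator i j) t′ ≈ t′
      unmoved = trans (sym (identityˡ _)) (trans (∙-congʳ (sym (relator≈ε i j)))
        (trans (conjugates-spec (relator i j) t′) (trans (∙-congˡ (relator≈ε i j)) (identityʳ t′))))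

    -- The sequence of reflections depends on the word, its parities only on the element: this is
    -- the invariant behind the exchange condition.
    crosses-≈ : ∀ u v → ⟦ u ⟧ ≈ ⟦ v ⟧ → ∀ t → crosses u t ≡ crosses v t
    crosses-≈ u v eq = EqClosure.fold (record
      { refl  = λ t → ≡.refl
      ; sym   = λ h t → ≡.sym (h t)
      ; trans = λ h k t → ≡.trans (h t) (k t)
      }) crosses-deletion (Equivalence.to (presentation u v) eq)

    Deletion : Element → List S → Set ℓ
    Deletion t u = ∃[ A ] ∃[ b ] ∃[ B ] (u ≡ A ++ b ∷ B) × (⟦ A ⟧ ∙ generator b ≈ t ∙ ⟦ A ⟧)

    -- An odd count is at least one occurrence, and where `t` occurs, after a prefix `A` followed by
    -- the letter `b`, it is the conjugate of `b` by `A`.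
    deletion : ∀ u t → crosses u t ≡ true → Deletion t u
    deletion (i ∷ u) t h with t ≟ generator i
    ... | yes t≈s = [] , i , u , ≡.refl , trans (identityˡ _) (trans (sym t≈s) (sym (identityʳ t)))
    ... | no _ with deletion u (conjugate i t) h
    ...   | A , b , B , ≡.refl , eq = i ∷ A , b , B , ≡.refl , (begin
      s ∙ ⟦ A ⟧ ∙ generator b        ≈⟨ assoc _ _ _ ⟩
      s ∙ (⟦ A ⟧ ∙ generator b)      ≈⟨ ∙-congˡ eq ⟩
      s ∙ (s ∙ (t ∙ s) ∙ ⟦ A ⟧)      ≈⟨ ∙-congˡ (assoc _ _ _) ⟩
      s ∙ (s ∙ (t ∙ s ∙ ⟦ A ⟧))      ≈⟨ cancel-generator i _ ⟩
      t ∙ s ∙ ⟦ A ⟧                  ≈⟨ assoc _ _ _ ⟩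
      t ∙ (s ∙ ⟦ A ⟧)                ∎)
      where s = generator i

    deleted : ∀ {i} A b B → ⟦ A ⟧ ∙ generator b ≈ generator i ∙ ⟦ A ⟧ → ⟦ A ++ b ∷ B ⟧ ≈ ⟦ i ∷ A ++ B ⟧
    deleted {i} A b B eq = begin
      ⟦ A ++ b ∷ B ⟧                  ≈⟨ ⟦⟧-++ A (b ∷ B) ⟩
      ⟦ A ⟧ ∙ (generator b ∙ ⟦ B ⟧)   ≈⟨ assoc _ _ _ ⟨
      ⟦ A ⟧ ∙ generator b ∙ ⟦ B ⟧     ≈⟨ ∙-congʳ eq ⟩
      generator i ∙ ⟦ A ⟧ ∙ ⟦ B ⟧     ≈⟨ assoc _ _ _ ⟩
      generator i ∙ (⟦ A ⟧ ∙ ⟦ B ⟧)   ≈⟨ ∙-congˡ (⟦⟧-++ A B) ⟨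
      ⟦ i ∷ A ++ B ⟧                  ∎

    length-deleted : ∀ {X : Set} (A : List X) b B → length (A ++ b ∷ B) ≡ suc (length (A ++ B))
    length-deleted A b B = ≡.trans (List.length-++ A) (≡.trans (ℕ.+-suc (length A) (length B))
      (≡.cong suc (≡.sym (List.length-++ A))))

    -- If `sᵢ` had odd count in `v`, a letter of `v` could be deleted and `u` would not be reduced.
    -- So the count in `v` is even, in `i ∷ v` it is odd, and by invariance it is odd in `u`.
    exchange : ∀ i u v → Reduced u → ⟦ u ⟧ ≈ ⟦ i ∷ v ⟧ → length v ℕ.≤ length u → Deletion (generator i) u
    exchange i u v red eq v≤u with crosses v (generator i) in e
    ... | true with deletion v (generator i) e
    ...   | A , b , B , ≡.refl , h = contradiction (minimal red (A ++ B) (sym (trans eq (trans (∙-congˡ (deleted A b B h)) (cancel-generator i _)))))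
                (ℕ.<⇒≱ (≡.subst (ℕ._≤ length u) (length-deleted A b B) v≤u))
    exchange i u v red eq v≤u | false = deletion u (generator i) (≡.trans (crosses-≈ u (i ∷ v) eq (generator i))
      (≡.cong₂ _xor_ (does-true refl) (≡.trans (crosses-cong v fixed) e)))
      where
      fixed : conjugate i (generator i) ≈ generator i
      fixed = trans (∙-congˡ (involutive i)) (identityʳ _)
      does-true : ∀ {a b} → a ≈ b → does (a ≟ b) ≡ true
      does-true {a} {b} eq with a ≟ b
      ... | yes _ = ≡.refl
      ... | no ¬p = contradiction eq ¬p

    -- Sequences of braid moves, indexed by the sign by which a T-sign function changes along them.
    data Moves : List S → List S → Sign → Set where
      done : ∀ {u} → Moves u u Sign.+
      move : ∀ {w ε′} x i j y → i ≢ j → Moves (x ++ alternating (mat i j) j i ++ y) w ε′ →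
             Moves (x ++ alternating (mat i j) i j ++ y) w (-1^ (mat i j ∸ 1) Sign.* ε′)

    moves-trans : ∀ {u v w δ ε′} → Moves u v δ → Moves v w ε′ → Moves u w (δ Sign.* ε′)
    moves-trans done n = n
    moves-trans {ε′ = ε′} (move {ε′ = δ} x i j y i≢j m) n = ≡.subst (Moves _ _) (≡.sym (Sign.*-assoc (-1^ (mat i j ∸ 1)) δ ε′))
      (move x i j y i≢j (moves-trans m n))

    moves-∷ : ∀ a {u v δ} → Moves u v δ → Moves (a ∷ u) (a ∷ v) δ
    moves-∷ a done = done
    moves-∷ a (move x i j y i≢j m) = move (a ∷ x) i j y i≢j (moves-∷ a m)

    moves-++ˡ : ∀ x {u v δ} → Moves u v δ → Moves (x ++ u) (x ++ v) δ
    moves-++ˡ []      m = m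
    moves-++ˡ (a ∷ x) m = moves-∷ a (moves-++ˡ x m)

    moves-++ʳ : ∀ z {u v δ} → Moves u v δ → Moves (u ++ z) (v ++ z) δ
    moves-++ʳ z done = done
    moves-++ʳ z (move x i j y i≢j m) = ≡.subst (λ u → Moves u _ _) (reassociate i j)
      (move x i j (y ++ z) i≢j (≡.subst (λ u → Moves u _ _) (≡.sym (reassociate j i)) (moves-++ʳ z m)))
      where
      reassociate : ∀ k l → x ++ alternating (mat i j) k l ++ y ++ z ≡ (x ++ alternating (mat i j) k l ++ y) ++ z
      reassociate k l = ≡.sym (≡.trans (List.++-assoc x _ z) (≡.cong (x ++_) (List.++-assoc (alternating (mat i j) k l) y z)))

    module Matsumoto
      (distinct : ∀ {i j} → i ≢ j → ∀ k → mat i j ≡ 0 ⊎ suc k ℕ.< mat i j →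
                  ¬ ⟦ alternating (suc k) i j ⟧ ≈ ⟦ alternating (suc k) j i ⟧) where

      split-alternating : ∀ k (i j : S) x A b B → alternating k i j ++ x ≡ A ++ b ∷ B →
        (∃[ l ] l ℕ.< k × A ≡ alternating l i j × A ++ b ∷ [] ≡ alternating (suc l) i j)
        ⊎ (∃[ A′ ] A ≡ alternating k i j ++ A′ × x ≡ A′ ++ b ∷ B)
      split-alternating zero    i j x A b B eq = inj₂ (A , ≡.refl , eq)
      split-alternating (suc k) i j x [] b B eq =
        inj₁ (0 , ℕ.s≤s ℕ.z≤n , ≡.refl , ≡.cong (_∷ []) (≡.sym (List.∷-injectiveˡ eq)))
      split-alternating (suc k) i j x (a ∷ A) b B eq
        with List.∷-injectiveˡ eq | split-alternating k j i x A b B (List.∷-injectiveʳ eq)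
      ... | ≡.refl | inj₁ (l , l<k , p , q) = inj₁ (suc l , ℕ.s≤s l<k , ≡.cong (i ∷_) p , ≡.cong (i ∷_) q)
      ... | ≡.refl | inj₂ (A′ , p , q)      = inj₂ (A′ , ≡.cong (i ∷_) p , q)

      Starts : Element → ℕ → S → S → Set ℓ
      Starts w k i j = ∃[ x ] Reduced (alternating k i j ++ x) × ⟦ alternating k i j ++ x ⟧ ≈ w

      -- Exchange puts `j` in front at the cost of one letter. A letter lost inside the alternating
      -- prefix would identify two alternating words of equal length below `m`; so the letter comes
      -- from the rest, and the prefix grows by one.
      extend : ∀ {w i j} → i ≢ j → ∀ y → Reduced (j ∷ y) → ⟦ j ∷ y ⟧ ≈ w →
               ∀ k → mat i j ≡ 0 ⊎ k ℕ.< mat i j → Starts w k i j → Starts w (suc k) j i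
      extend {w} {i} {j} i≢j y red-y y≈w k k<m (x , red , x≈w)
        with exchange j (alternating k i j ++ x) y red (trans x≈w (sym y≈w))
               (≡.subst (length y ℕ.≤_) (≡.sym (reduced-length red red-y (trans x≈w (sym y≈w)))) (ℕ.n≤1+n _))
      ... | A , b , B , cut , h with split-alternating k i j x A b B cut
      ...   | inj₁ (l , l<k , ≡.refl , A∷b) = ⊥-elim (distinct i≢j l (bounded k<m)
        (trans (reflexive (≡.cong ⟦_⟧ (≡.sym A∷b))) (trans (⟦⟧-++ A (b ∷ [])) (trans (∙-congˡ (identityʳ _)) h))))
        where
        bounded : mat i j ≡ 0 ⊎ k ℕ.< mat i j → mat i j ≡ 0 ⊎ suc l ℕ.< mat i j
        bounded (inj₁ m≡0) = inj₁ m≡0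
        bounded (inj₂ k<m) = inj₂ (ℕ.≤-<-trans l<k k<m)
      ...   | inj₂ (A′ , ≡.refl , ≡.refl) = A′ ++ B ,
        reduced-≈ red same (ℕ.≤-reflexive same-length) , trans same x≈w
        where
        reassociate : (alternating k i j ++ A′) ++ B ≡ alternating k i j ++ A′ ++ B
        reassociate = List.++-assoc (alternating k i j) A′ B
        same : ⟦ j ∷ alternating k i j ++ A′ ++ B ⟧ ≈ ⟦ alternating k i j ++ A′ ++ b ∷ B ⟧
        same = trans (reflexive (≡.cong (λ v → ⟦ j ∷ v ⟧) (≡.sym reassociate)))
          (trans (sym (deleted A b B h)) (reflexive (≡.cong ⟦_⟧ (≡.sym cut))))
        same-length : length (j ∷ alternating k i j ++ A′ ++ B) ≡ length (alternating k i j ++ A′ ++ b ∷ B)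
        same-length = ≡.trans (≡.cong (suc ∘ length) (≡.sym reassociate))
          (≡.trans (≡.sym (length-deleted A b B)) (≡.cong length (≡.sym cut)))

      Joint : Element → S → S → Set ℓ
      Joint w i j = mat i j ≢ 0 × ∃[ x ] Reduced (alternating (mat i j) i j ++ x) × ⟦ alternating (mat i j) i j ++ x ⟧ ≈ w
                                × Reduced (alternating (mat i j) j i ++ x) × ⟦ alternating (mat i j) j i ++ x ⟧ ≈ w

      -- The reduced words starting with `i` and with `j` serve in turn to lengthen an alternating
      -- prefix to its full length `m`; the braid relation then gives a second word with the same
      -- rest.
      joint : ∀ {w i j} → i ≢ j → ∀ y z → Reduced (i ∷ y) → ⟦ i ∷ y ⟧ ≈ w → Reduced (j ∷ z) → ⟦ j ∷ z ⟧ ≈ w → Joint w i j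
      joint {w} {i} {j} i≢j y z red-y y≈w red-z z≈w = finite (mat i j ℕ.≟ 0)
        where
        m = mat i j
        swap-bound : ∀ {k} → m ≡ 0 ⊎ k ℕ.< m → mat j i ≡ 0 ⊎ k ℕ.< mat j i
        swap-bound = ≡.subst (λ m → m ≡ 0 ⊎ _ ℕ.< m) (symmetric i j)
        starts : ∀ k → m ≡ 0 ⊎ k ℕ.≤ m → Starts w k i j × Starts w k j i
        starts zero    _ = (i ∷ y , red-y , y≈w) , (i ∷ y , red-y , y≈w)
        starts (suc k) h with starts k (weaken h)
          where
          weaken : m ≡ 0 ⊎ suc k ℕ.≤ m → m ≡ 0 ⊎ k ℕ.≤ m
          weaken (inj₁ m≡0) = inj₁ m≡0
          weaken (inj₂ k<m) = inj₂ (ℕ.<⇒≤ k<m)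
        ... | p , q = extend (i≢j ∘ ≡.sym) y red-y y≈w k (swap-bound h) q , extend i≢j z red-z z≈w k h p
        finite : Dec (m ≡ 0) → Joint w i j
        -- For infinite order the prefix could be made longer than the reduced word `i ∷ y` of the
        -- same element.
        finite (yes m≡0) with proj₁ (starts (suc (length (i ∷ y))) (inj₁ m≡0))
        ... | x , red , x≈w = contradiction (minimal red (i ∷ y) (trans y≈w (sym x≈w))) (ℕ.<⇒≱
          (≡.subst (suc (length (i ∷ y)) ℕ.≤_)
            (≡.sym (≡.trans (List.length-++ (alternating l i j)) (≡.cong (ℕ._+ length x) (length-alternating l i j))))
            (ℕ.m≤m+n _ _)))
          where l = suc (length (i ∷ y))
        finite (no m≢0) with proj₁ (starts m (inj₂ ℕ.≤-refl))
        ... | x , red , x≈w = m≢0 , x , red , x≈w , reduced-≈ red same (ℕ.≤-reflexive same-length) , trans same x≈w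
          where
          same : ⟦ alternating m j i ++ x ⟧ ≈ ⟦ alternating m i j ++ x ⟧
          same = trans (⟦⟧-++ (alternating m j i) x) (trans (∙-congʳ (sym (braid-≈ i j))) (sym (⟦⟧-++ (alternating m i j) x)))
          same-length : length (alternating m j i ++ x) ≡ length (alternating m i j ++ x)
          same-length = ≡.trans (List.length-++ (alternating m j i)) (≡.trans
            (≡.cong (ℕ._+ length x) (≡.trans (length-alternating m j i) (≡.sym (length-alternating m i j))))
            (≡.sym (List.length-++ (alternating m i j))))

      braid : ∀ {l} i j → mat i j ≡ l → ∀ x {w δ} → i ≢ j → Moves (alternating l j i ++ x) w δ →
              Moves (alternating l i j ++ x) w (-1^ (l ∸ 1) Sign.* δ)
      braid i j ≡.refl x i≢j n = move [] i j x i≢j n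

      -- If the first letters differ, the two words from `joint` are interposed: one braid move
      -- links them to each other, and each shares its first letter with one of the given words, so
      -- induction applies to the tails.
      matsumoto : ∀ k u v → length u ≡ k → Reduced u → Reduced v → ⟦ u ⟧ ≈ ⟦ v ⟧ → ∃[ δ ] Moves u v δ
      matsumoto k [] [] _ _ _ _ = Sign.+ , done
      matsumoto k [] (_ ∷ _) _ ru rv eq = contradiction (reduced-length ru rv eq) λ ()
      matsumoto k (_ ∷ _) [] _ ru rv eq = contradiction (reduced-length ru rv eq) λ ()
      matsumoto (suc k) (i ∷ u) (j ∷ v) len ru rv eq with i Fin.≟ j
      ... | yes ≡.refl with matsumoto k u v (ℕ.suc-injective len) (reduced-suffix (i ∷ []) u ru) (reduced-suffix (i ∷ []) v rv) (∷-cancel i u v eq)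
      ...   | δ , m = δ , moves-∷ i m
      matsumoto (suc k) (i ∷ u) (j ∷ v) len ru rv eq | no i≢j with joint i≢j u v ru refl rv (sym eq)
      ... | m≢0 , x , ri , i≈ , rj , j≈ with mat i j in em
      ...   | zero  = contradiction ≡.refl m≢0
      ...   | suc m with matsumoto k u (alternating m j i ++ x) (ℕ.suc-injective len) (reduced-suffix (i ∷ []) u ru)
                           (reduced-suffix (i ∷ []) _ ri) (∷-cancel i u (alternating m j i ++ x) (sym i≈))
                       | matsumoto k (alternating m i j ++ x) v
                           (ℕ.suc-injective (≡.trans (reduced-length rj ru j≈) len))
                           (reduced-suffix (j ∷ []) _ rj) (reduced-suffix (j ∷ []) v rv)
                           (∷-cancel j (alternating m i j ++ x) v (trans j≈ eq))
      ...     | δ , n | δ′ , n′ = _ , moves-trans (moves-∷ i n) (braid i j em x i≢j (moves-∷ j n′))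

      moves-sym : ∀ {u v δ} → Moves u v δ → Moves v u δ
      moves-sym done = done
      moves-sym (move {ε′ = δ} x i j y i≢j m) = ≡.subst (Moves _ _) sign
        (moves-trans (moves-sym m) (≡.subst (λ k → Moves (x ++ alternating k j i ++ y) (x ++ alternating (mat i j) i j ++ y) (-1^ (k ∸ 1)))
          (symmetric j i) (≡.subst (Moves _ _) (Sign.*-identityʳ _)
            (move x j i y (i≢j ∘ ≡.sym) (≡.subst (λ k → Moves (x ++ alternating (mat j i) i j ++ y) (x ++ alternating k i j ++ y) Sign.+)
              (symmetric j i) done)))))
        where
        sign : δ Sign.* -1^ (mat i j ∸ 1) ≡ -1^ (mat i j ∸ 1) Sign.* δ
        sign = Sign.*-comm δ _

      -1^-+ : ∀ k l → -1^ (k ℕ.+ l) ≡ -1^ k Sign.* -1^ l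
      -1^-+ zero    l = ≡.refl
      -1^-+ (suc k) l = ≡.trans (≡.cong Sign.opposite (-1^-+ k l)) (≡.sym (opposite-* (-1^ k) (-1^ l)))
        where
        opposite-* : ∀ s t → Sign.opposite s Sign.* t ≡ Sign.opposite (s Sign.* t)
        opposite-* Sign.+ t      = ≡.refl
        opposite-* Sign.- Sign.+ = ≡.refl
        opposite-* Sign.- Sign.- = ≡.refl

      alternating-∷ʳ : ∀ k (i j : S) → ∃[ q ] alternating (suc k) i j ≡ alternating k i j ++ q ∷ []
      alternating-∷ʳ zero    i j = i , ≡.refl
      alternating-∷ʳ (suc k) i j with alternating-∷ʳ k j i
      ... | q , eq = q , ≡.cong (i ∷_) eq

      generator-injective : ∀ {i j} → generator i ≈ generator j → i ≡ j
      generator-injective {i} {j} eq with i Fin.≟ j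
      ... | yes i≡j = i≡j
      ... | no i≢j  = ⊥-elim (distinct i≢j 0 (bounded (mat i j) (offDiagonal i≢j)) (∙-congʳ eq))
        where
        bounded : ∀ m → m ≢ 1 → m ≡ 0 ⊎ 1 ℕ.< m
        bounded 0             _   = inj₁ ≡.refl
        bounded 1             1≢1 = contradiction ≡.refl 1≢1
        bounded (suc (suc m)) _   = inj₂ (ℕ.s≤s (ℕ.s≤s ℕ.z≤n))

      -- Let `r` be the first letter of `y`. Both `i` and `r` start reduced words of this element,
      -- so `y` can be rewritten as `a ++ x`, where `a` alternates and has length mᵢᵣ - 1. One braid
      -- move takes `i ∷ a ++ x` to `a ++ q ∷ x`, and induction carries `q` through `x`. The
      -- rewriting of `y` is undone at the end, so its sign `δ` occurs twice and (-1)^(|a| + |x|)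
      -- remains.
      moves-flip : ∀ k y i j → length y ℕ.≤ k → Reduced (i ∷ y) → Reduced (y ++ j ∷ []) →
        ⟦ i ∷ y ⟧ ≈ ⟦ y ++ j ∷ [] ⟧ → Moves (i ∷ y) (y ++ j ∷ []) (-1^ (length y))
      moves-flip k [] i j _ _ _ eq
        with ≡.refl ← generator-injective (trans (sym (identityʳ _)) (trans eq (identityʳ _))) = done
      moves-flip (suc k) (r ∷ y) i j (ℕ.s≤s y≤k) red red′ eq with i Fin.≟ r
      ... | yes ≡.refl = contradiction (minimal red y (sym (cancel-generator i _))) (ℕ.<⇒≱ (ℕ.n≤1+n _))
      ... | no i≢r with joint i≢r (r ∷ y) (y ++ j ∷ []) red refl red′ (sym eq)
      ...   | m≢0 , x , ri , i≈ , rr , r≈ with mat i r in em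
      ...     | 0           = contradiction ≡.refl m≢0
      ...     | 1           = contradiction em (offDiagonal i≢r)
      ...     | suc (suc m) with alternating-∷ʳ (suc m) r i
                               | matsumoto (length (r ∷ y)) (r ∷ y) (alternating (suc m) r i ++ x) ≡.refl
                                   (reduced-suffix (i ∷ []) _ red) (reduced-suffix (i ∷ []) _ ri) (∷-cancel i (r ∷ y) (alternating (suc m) r i ++ x) (sym i≈))
      ...       | q , snoc | δ , n = ≡.subst (Moves _ _) sign
        (moves-trans (moves-∷ i n) (braid i r em x i≢r
          (≡.subst (λ u → Moves u (r ∷ y ++ j ∷ []) (-1^ (length x) Sign.* δ)) (≡.sym rr≡)
            (moves-trans (moves-++ˡ a (moves-flip k x q j x≤k red-qx red-xj qx≈xj))
              (≡.subst (λ u → Moves u (r ∷ y ++ j ∷ []) δ) (List.++-assoc a x _) (moves-++ʳ (j ∷ []) (moves-sym n)))))))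
        where
        a = alternating (suc m) r i
        rr≡ : alternating (suc (suc m)) r i ++ x ≡ a ++ q ∷ x
        rr≡ = ≡.trans (≡.cong (_++ x) snoc) (List.++-assoc a (q ∷ []) x)
        y≈ax : ⟦ r ∷ y ⟧ ≈ ⟦ a ++ x ⟧
        y≈ax = ∷-cancel i (r ∷ y) (a ++ x) (sym i≈)
        length-y : length (r ∷ y) ≡ suc m ℕ.+ length x
        length-y = ≡.trans (reduced-length (reduced-suffix (i ∷ []) _ red) (reduced-suffix (i ∷ []) _ ri) y≈ax)
          (≡.trans (List.length-++ a) (≡.cong (ℕ._+ length x) (length-alternating (suc m) r i)))
        x≤k : length x ℕ.≤ k
        x≤k = ℕ.≤-trans (ℕ.m≤n+m (length x) m) (≡.subst (ℕ._≤ k) (ℕ.suc-injective length-y) y≤k)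
        red-qx : Reduced (q ∷ x)
        red-qx = reduced-suffix a (q ∷ x) (≡.subst Reduced rr≡ rr)
        axj≈ : ⟦ a ++ x ++ j ∷ [] ⟧ ≈ ⟦ (r ∷ y) ++ j ∷ [] ⟧
        axj≈ = trans (reflexive (≡.cong ⟦_⟧ (≡.sym (List.++-assoc a x _)))) (trans (⟦⟧-++ (a ++ x) _)
          (trans (∙-congʳ (sym y≈ax)) (sym (⟦⟧-++ (r ∷ y) _))))
        red-xj : Reduced (x ++ j ∷ [])
        red-xj = reduced-suffix a _ (reduced-≈ red′ axj≈ (ℕ.≤-reflexive (≡.trans
          (≡.cong length (≡.sym (List.++-assoc a x (j ∷ []))))
          (≡.trans (List.length-++ (a ++ x)) (≡.trans
            (≡.cong (ℕ._+ 1) (reduced-length (reduced-suffix (i ∷ []) _ ri) (reduced-suffix (i ∷ []) _ red) (sym y≈ax)))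
            (≡.sym (List.length-++ (r ∷ y))))))))
        qx≈xj : ⟦ q ∷ x ⟧ ≈ ⟦ x ++ j ∷ [] ⟧
        qx≈xj = ++-cancelˡ a (q ∷ x) (x ++ j ∷ []) (trans (reflexive (≡.cong ⟦_⟧ (≡.sym rr≡))) (trans r≈ (trans eq (sym axj≈))))
        sign : δ Sign.* (-1^ (suc m) Sign.* (-1^ (length x) Sign.* δ)) ≡ -1^ (length (r ∷ y))
        sign = ≡.trans (≡.cong (δ Sign.*_) (≡.sym (Sign.*-assoc (-1^ (suc m)) (-1^ (length x)) δ)))
          (≡.trans (Sign.*-comm δ _) (≡.trans (Sign.*-assoc (-1^ (suc m) Sign.* -1^ (length x)) δ δ)
            (≡.trans (≡.cong ((-1^ (suc m) Sign.* -1^ (length x)) Sign.*_) (Sign.s*s≡+ δ))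
              (≡.trans (Sign.*-identityʳ _) (≡.trans (≡.sym (-1^-+ (suc m) (length x))) (≡.cong -1^ (≡.sym length-y)))))))

      module LongestElement (w : Element) {N : ℕ} (hasLength : HasLength w N) where
        open TSign W

        reduced : ∀ u → length u ≡ N → ⟦ u ⟧ ≈ w → Reduced u
        reduced u ≡.refl u≈w .minimal v v≈u = proj₂ hasLength v (trans v≈u u≈w)

        reducedWord : ∀ u e → ⟦ u ⟧ ≈ w → ReducedWord w (vec u e)
        reducedWord u e u≈w = hasLength , trans (reflexive (≡.cong ⟦_⟧ (toList-vec u e))) u≈w

        module _ {τ : Vec S N → Sign} (isTSign : IsTSign w τ) where

          τ-moves : ∀ {u v δ} → Moves u v δ → ⟦ u ⟧ ≈ w → ∀ eu ev → τ (vec u eu) ≡ δ Sign.* τ (vec v ev)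
          τ-moves {u} done _ eu ev = ≡.cong (λ e → τ (vec u e)) (ℕ.≡-irrelevant eu ev)
          τ-moves {v = v} (move {ε′ = δ} x i j y i≢j m) u≈w eu ev = ≡.trans
            (proj₁ isTSign (reducedWord (x ++ alternating (mat i j) i j ++ y) eu u≈w) (reducedWord u′ eu′ u′≈w)
              (i≢j , x , y , toList-vec _ eu , toList-vec _ eu′))
            (≡.trans (≡.cong (-1^ (mat i j ∸ 1) Sign.*_) (τ-moves m u′≈w eu′ ev))
              (≡.sym (Sign.*-assoc (-1^ (mat i j ∸ 1)) δ _)))
            where
            u′ = x ++ alternating (mat i j) j i ++ y
            u′≈w : ⟦ u′ ⟧ ≈ w
            u′≈w = trans (trans (⟦⟧-++ x _) (∙-congˡ (trans (⟦⟧-++ (alternating (mat i j) j i) y)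
              (trans (∙-congʳ (sym (braid-≈ i j))) (sym (⟦⟧-++ (alternating (mat i j) i j) y))))))
              (trans (sym (⟦⟧-++ x _)) u≈w)
            eu′ : length u′ ≡ N
            eu′ = ≡.trans (≡.trans (List.length-++ x) (≡.trans (≡.cong (length x ℕ.+_) (≡.trans (List.length-++ (alternating (mat i j) j i))
              (≡.trans (≡.cong (ℕ._+ length y) (≡.trans (length-alternating (mat i j) j i) (≡.sym (length-alternating (mat i j) i j))))
                (≡.sym (List.length-++ (alternating (mat i j) i j)))))) (≡.sym (List.length-++ x)))) eu

          τ-flip : ∀ x i y j z eu ev → ⟦ x ++ i ∷ y ++ z ⟧ ≈ w → ⟦ x ++ y ++ j ∷ z ⟧ ≈ w →
            τ (vec (x ++ i ∷ y ++ z) eu) ≡ -1^ (length y) Sign.* τ (vec (x ++ y ++ j ∷ z) ev)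
          τ-flip x i y j z eu ev u≈w v≈w = τ-moves moves u≈w eu ev
            where
            assoc-v : x ++ (y ++ j ∷ []) ++ z ≡ x ++ y ++ j ∷ z
            assoc-v = ≡.cong (x ++_) (List.++-assoc y (j ∷ []) z)
            red-u : Reduced (i ∷ y)
            red-u = reduced-prefix (i ∷ y) z (reduced-suffix x _ (reduced _ eu u≈w))
            red-v : Reduced (y ++ j ∷ [])
            red-v = reduced-prefix (y ++ j ∷ []) z (reduced-suffix x _ (≡.subst Reduced (≡.sym assoc-v) (reduced _ ev v≈w)))
            equal : ⟦ i ∷ y ⟧ ≈ ⟦ y ++ j ∷ [] ⟧
            equal = ++-cancelʳ x z (i ∷ y) (y ++ j ∷ []) (trans u≈w (sym (trans (reflexive (≡.cong ⟦_⟧ assoc-v)) v≈w)))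
            moves : Moves (x ++ i ∷ y ++ z) (x ++ y ++ j ∷ z) (-1^ (length y))
            moves = ≡.subst (λ v → Moves (x ++ i ∷ y ++ z) v _) assoc-v
              (moves-++ˡ x (moves-++ʳ z (moves-flip (length y) y i j ℕ.≤-refl red-u red-v equal)))

open Filters

-- Flips between occurrences.

module Sublists where
  private variable
    x y p : Level
    X : Set x
    Y : Set y

  map-split : ∀ (f : X → Y) zs {as b bs} → map f zs ≡ as ++ b ∷ bs →
    ∃[ as′ ] ∃[ b′ ] ∃[ bs′ ] zs ≡ as′ ++ b′ ∷ bs′ × map f as′ ≡ as × f b′ ≡ b × map f bs′ ≡ bs
  map-split f (z ∷ zs) {[]}     eq = [] , z , zs , ≡.refl , ≡.refl , List.∷-injectiveˡ eq , List.∷-injectiveʳ eq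
  map-split f (z ∷ zs) {a ∷ as} eq with map-split f zs (List.∷-injectiveʳ eq)
  ... | as′ , b′ , bs′ , ≡.refl , p , q , r = z ∷ as′ , b′ , bs′ , ≡.refl , ≡.cong₂ _∷_ (List.∷-injectiveˡ eq) p , q , r

  ⊆-remove : ∀ as {b : X} {bs zs} → as ++ b ∷ bs ⊆ zs → as ++ bs ⊆ zs
  ⊆-remove []       τ        = Sublist.∷ˡ⁻ τ
  ⊆-remove (a ∷ as) (z ∷ʳ τ) = z ∷ʳ ⊆-remove (a ∷ as) τ
  ⊆-remove (a ∷ as) (eq ∷ τ) = eq ∷ ⊆-remove as τ

  AllPairs-⊆ : ∀ {R : X → X → Set p} {xs ys} → xs ⊆ ys → AllPairs R ys → AllPairs R xs
  AllPairs-⊆ []           _        = []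
  AllPairs-⊆ (y ∷ʳ τ)     (_ ∷ ps) = AllPairs-⊆ τ ps
  AllPairs-⊆ (≡.refl ∷ τ) (h ∷ ps) = Sublist.All-resp-⊆ τ h ∷ AllPairs-⊆ τ ps

  ascending-⊆ : ∀ {m} {zs ys : List (Fin m)} → AllPairs Fin._<_ zs → AllPairs Fin._<_ ys → All (_∈ ys) zs → zs ⊆ ys
  ascending-⊆ {ys = []}     [] _ _ = []
  ascending-⊆ {ys = []}     (_ ∷ _) _ (() ∷ _)
  ascending-⊆ {ys = y ∷ ys} [] _ _ = Sublist.minimum (y ∷ ys)
  ascending-⊆ {zs = z ∷ zs} {y ∷ ys} (h ∷ hs) (k ∷ ks) (here ≡.refl ∷ es) = ≡.refl ∷ ascending-⊆ hs ks (All.zipWith later (h , es))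
    where
    later : ∀ {x} → (z Fin.< x) × (x ∈ z ∷ ys) → x ∈ ys
    later (z<z , here ≡.refl) = contradiction z<z (ℕ.<-irrefl ≡.refl)
    later (_ , there x∈)      = x∈
  ascending-⊆ {zs = z ∷ zs} {y ∷ ys} (h ∷ hs) (k ∷ ks) (there z∈ ∷ es) =
    y ∷ʳ ascending-⊆ (h ∷ hs) ks (z∈ ∷ All.zipWith later (h , es))
    where
    y<z : y Fin.< z
    y<z = All.lookup k z∈
    later : ∀ {x} → (z Fin.< x) × (x ∈ y ∷ ys) → x ∈ ys
    later (z<y , here ≡.refl) = contradiction z<y (ℕ.<-asym y<z)
    later (_ , there x∈)      = x∈

open Sublists

-- Any two occurrences of reduced words of w are connected by flips, as the
-- subword complex is vertex decomposable: occurrences which both use, or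
-- both avoid, the first position q are treated by induction, and an
-- occurrence avoiding q can be exchanged for one using q.
module Flips {c ℓ} (W : CoxeterSystem c ℓ) (_≟_ : Decidable₂ (CoxeterSystem._≈_ W))
  (w : CoxeterSystem.Element W) {N : ℕ} (hasLength : CoxeterSystem.HasLength W w N)
  {m : ℕ} (f : Fin m → CoxeterSystem.S W) where
  open CoxeterSystem W
  open Words W
  open Exchange _≟_

  record IsWord (z : List (Fin m)) : Set ℓ where
    constructor word
    field
      length≡ : length z ≡ N
      value≈  : ⟦ map f z ⟧ ≈ w
  open IsWord

  record Flip (z z′ : List (Fin m)) : Set ℓ where
    constructor flips
    field
      {pre mid post} : List (Fin m)
      {a b} : Fin m
      ascending : AllPairs Fin._<_ (pre ++ a ∷ mid ++ b ∷ post)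
      z≡  : z ≡ pre ++ a ∷ mid ++ post
      z′≡ : z′ ≡ pre ++ mid ++ b ∷ post
      isWord  : IsWord z
      isWord′ : IsWord z′

  -- The prefix cancels in the group, so `z′` spells a reduced word of the same element as `q ∷ z`,
  -- and the exchange condition trades one of its letters for `q`.
  exchange-first : ∀ pre q z z′ → IsWord (pre ++ q ∷ z) → IsWord (pre ++ z′) →
    ∃[ A ] ∃[ b ] ∃[ B ] z′ ≡ A ++ b ∷ B × IsWord (pre ++ q ∷ A ++ B)
  exchange-first pre q z z′ (word len eq) (word len′ eq′)
    with exchange (f q) (map f z′) (map f z) reduced′ same (ℕ.<⇒≤ (≡.subst₂ ℕ._<_ (≡.sym (List.length-map f z)) (≡.sym (List.length-map f z′)) z<z′))
    where
    decompose : ∀ y → ⟦ map f (pre ++ y) ⟧ ≈ ⟦ map f pre ++ map f y ⟧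
    decompose y = reflexive (≡.cong ⟦_⟧ (List.map-++ f pre y))
    same : ⟦ map f z′ ⟧ ≈ ⟦ f q ∷ map f z ⟧
    same = ++-cancelˡ (map f pre) (map f z′) (f q ∷ map f z)
      (trans (sym (decompose z′)) (trans eq′ (trans (sym eq) (decompose (q ∷ z)))))
    z<z′ : length z ℕ.< length z′
    z<z′ = ℕ.≤-reflexive (ℕ.+-cancelˡ-≡ (length pre) _ _ (≡.trans (≡.sym (List.length-++ pre {q ∷ z}))
      (≡.trans (≡.trans len (≡.sym len′)) (List.length-++ pre))))
    reduced′ : Reduced (map f z′)
    reduced′ = reduced-suffix (map f pre) (map f z′) (isReduced λ v v≈ → ≡.subst (ℕ._≤ length v)
      (≡.trans (≡.sym len′) (≡.trans (≡.sym (List.length-map f (pre ++ z′))) (≡.cong length (List.map-++ f pre z′))))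
      (proj₂ hasLength v (trans v≈ (trans (sym (decompose z′)) eq′))))
  ... | A , b , B , cut , h with map-split f z′ cut
  ...   | A′ , b′ , B′ , ≡.refl , ≡.refl , ≡.refl , ≡.refl = A′ , b′ , B′ , ≡.refl , word
    (≡.trans (List.length-++ pre) (≡.trans (≡.cong (length pre ℕ.+_) (≡.sym (length-deleted A′ b′ B′)))
      (≡.trans (≡.sym (List.length-++ pre)) len′)))
    (trans (reflexive (≡.cong ⟦_⟧ (List.map-++ f pre (q ∷ A′ ++ B′)))) (trans (⟦⟧-++ (map f pre) _)
      (trans (∙-congˡ (trans (reflexive (≡.cong (λ u → ⟦ f q ∷ u ⟧) (List.map-++ f A′ B′)))
        (trans (sym (deleted (map f A′) (f b′) (map f B′) h)) (reflexive (≡.cong ⟦_⟧ (≡.sym (List.map-++ f A′ (b′ ∷ B′))))))))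
        (trans (sym (⟦⟧-++ (map f pre) _)) (trans (reflexive (≡.cong ⟦_⟧ (≡.sym (List.map-++ f pre _)))) eq′)))))

  module _ {g} (Good : List (Fin m) → Set g)
           (forward : ∀ {z z′} → Flip z z′ → Good z → Good z′)
           (backward : ∀ {z z′} → Flip z z′ → Good z′ → Good z) where

    -- Connectedness takes the form of an induction principle: a property preserved by flips in both
    -- directions passes from any occurrence to any other, without a path being recorded.
    connected-from : ∀ ps pre {z z′} → AllPairs Fin._<_ (pre ++ ps) → z ⊆ ps → z′ ⊆ ps →
      IsWord (pre ++ z) → IsWord (pre ++ z′) → Good (pre ++ z) → Good (pre ++ z′)
    both-first : ∀ q ps pre {z z′} → AllPairs Fin._<_ (pre ++ q ∷ ps) → z ⊆ ps → z′ ⊆ ps →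
      IsWord (pre ++ q ∷ z) → IsWord (pre ++ q ∷ z′) → Good (pre ++ q ∷ z) → Good (pre ++ q ∷ z′)

    connected-from [] pre asc [] [] w₁ w₂ good = good
    connected-from (q ∷ ps) pre asc (_ ∷ʳ τ) (_ ∷ʳ τ′) w₁ w₂ good =
      connected-from ps pre (AllPairs-remove pre asc) τ τ′ w₁ w₂ good
    connected-from (q ∷ ps) pre asc (≡.refl ∷ τ) (≡.refl ∷ τ′) w₁ w₂ good =
      both-first q ps pre asc τ τ′ w₁ w₂ good
    connected-from (q ∷ ps) pre {_ ∷ z} {z′} asc (≡.refl ∷ τ) (_ ∷ʳ τ′) w₁ w₂ good
      with exchange-first pre q z z′ w₁ w₂
    ... | A , b , B , ≡.refl , w₃ = forward (flips (AllPairs-⊆ (Sublist.++⁺ Sublist.⊆-refl (≡.refl ∷ τ′)) asc) ≡.refl ≡.refl w₃ w₂)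
      (both-first q ps pre asc τ (⊆-remove A τ′) w₁ w₃ good)
    connected-from (q ∷ ps) pre {z} {_ ∷ z′} asc (_ ∷ʳ τ) (≡.refl ∷ τ′) w₁ w₂ good
      with exchange-first pre q z′ z w₂ w₁
    ... | A , b , B , ≡.refl , w₃ = both-first q ps pre asc (⊆-remove A τ) τ′ w₃ w₂
      (backward (flips (AllPairs-⊆ (Sublist.++⁺ Sublist.⊆-refl (≡.refl ∷ τ)) asc) ≡.refl ≡.refl w₃ w₁) good)

    both-first q ps pre {z} {z′} asc τ τ′ w₁ w₂ good =
      ≡.subst Good (List.++-assoc pre (q ∷ []) z′) (connected-from ps (pre ++ q ∷ [])
        (≡.subst (AllPairs Fin._<_) (≡.sym (List.++-assoc pre (q ∷ []) ps)) asc) τ τ′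
        (≡.subst IsWord (≡.sym (List.++-assoc pre (q ∷ []) z)) w₁)
        (≡.subst IsWord (≡.sym (List.++-assoc pre (q ∷ []) z′)) w₂)
        (≡.subst Good (≡.sym (List.++-assoc pre (q ∷ []) z)) good))

    connected : ∀ {z z′} → AllPairs Fin._<_ z → AllPairs Fin._<_ z′ → IsWord z → IsWord z′ → Good z → Good z′
    connected asc asc′ = connected-from (List.allFin m) [] all (sub asc) (sub asc′)
      where
      all : AllPairs Fin._<_ (List.allFin m)
      all = AllPairs.tabulate⁺-< id
      sub : ∀ {z} → AllPairs Fin._<_ z → z ⊆ List.allFin m
      sub {z} asc = ascending-⊆ asc all (All.universal ∈-allFin z)

-- Minors and simplicial cones.

module Cones {a ℓ₁ ℓ₂} (ℝ : CompleteOrderedField a ℓ₁ ℓ₂) where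
  open CompleteOrderedField ℝ hiding (zero)
  open OrderedField ℝ
  open LinearAlgebra ℝ
  open Determinants ℝ
  open BlockDeterminants ℝ
  open SchurExpansion ℝ
  open Chebyshev ℝ
  open import Relation.Binary.Reasoning.Setoid setoid

  private variable
    x : Level
    X : Set x

  choose-length : ∀ (xs : List X) → choose xs (length xs) ≡ xs ∷ []
  choose-length []       = ≡.refl
  choose-length (x ∷ xs) = ≡.cong₂ (λ l r → map (x ∷_) l ++ r) (choose-length xs) (too-many xs ℕ.≤-refl)
    where
    too-many : ∀ (xs : List X) {k} → length xs ℕ.< k → choose xs k ≡ []
    too-many []       {suc k} _         = ≡.refl
    too-many (x ∷ xs) {suc k} (ℕ.s≤s h) = ≡.cong₂ (λ l r → map (x ∷_) l ++ r) (too-many xs h) (too-many xs (ℕ.m<n⇒m<1+n h))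

  indicator : ∀ {k} → Fin k → Fin k → Carrier
  indicator i j with i Fin.≟ j
  ... | yes _ = 1#
  ... | no _  = 0#

  indicator-≡ : ∀ {k} (i : Fin k) → indicator i i ≈ 1#
  indicator-≡ i with i Fin.≟ i
  ... | yes _  = refl
  ... | no i≢i = contradiction ≡.refl i≢i

  indicator-≢ : ∀ {k} {i j : Fin k} → i ≢ j → indicator i j ≈ 0#
  indicator-≢ {i = i} {j} i≢j with i Fin.≟ j
  ... | yes i≡j = contradiction i≡j i≢j
  ... | no _    = refl

  ∑-indicator : ∀ {k} (i : Fin k) (f : Fin k → Carrier) → ∑ (allFin k) (λ j → indicator i j * f j) ≈ f i
  ∑-indicator i f = trans (∑-allFin (λ j → indicator i j * f j))
    (trans (sum-single i (λ j → indicator i j * f j) (λ j j≢i → trans (*-congʳ (indicator-≢ (j≢i ∘ ≡.sym))) (zeroˡ _)))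
      (trans (*-congʳ (indicator-≡ i)) (*-identityˡ _)))

  module _ {N m : ℕ} (B : Matrix N m) where

    minor : List (Fin N) → List (Fin m) → Carrier
    minor = D (λ r k → B r k)

    maximalMinor : List (Fin m) → Carrier
    maximalMinor = minor (allFin N)

    IndependentOn : List (Fin m) → Set _
    IndependentOn z = ∀ (c : Fin m → Carrier) → (∀ k → k ∉ z → c k ≈ 0#) →
      (∀ r → columnCombination B c r ≈ 0#) → ∀ k → c k ≈ 0#

    -- The cofactors of a minor with one more row give a linear relation
    -- between the columns, once all minors with that many rows vanish.
    minors-nonzero : ∀ z → AllPairs Fin._<_ z → IndependentOn z →
      ¬ (∀ rs → length rs ≡ length z → minor rs z ≈ 0#)
    minors-nonzero []      _        _           vanish = contradiction (vanish [] ≡.refl) (pos⇒≉0 0<1)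
    minors-nonzero (j ∷ z) (h ∷ hs) independent vanish = minors-nonzero z hs
      (λ c support → independent c λ k k∉ → support k (k∉ ∘ there)) λ rs len →
        trans (sym (first-coefficient rs)) (independent (cofactor rs) (supported rs) (relation rs len) j)
      where
      term : List (Fin N) → Fin m → Fin m → List (Fin m) → Carrier
      term rs k k′ z′ = indicator k′ k * minor rs z′
      cofactor : List (Fin N) → Fin m → Carrier
      cofactor rs k = alt (term rs k) (j ∷ z)
      vanishing : ∀ rs k zs → All (_≢ k) zs → ∀ (g : List (Fin m) → List (Fin m)) → alt (λ k′ z′ → term rs k k′ (g z′)) zs ≈ 0#
      vanishing rs k []       []       g = refl
      vanishing rs k (x ∷ zs) (≢k ∷ hs) g = trans
        (+-cong (trans (*-congʳ (indicator-≢ ≢k)) (zeroˡ _)) (-‿cong (vanishing rs k zs hs (g ∘ (x ∷_)))))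
        (-‿inverseʳ 0#)
      supported : ∀ rs k → k ∉ j ∷ z → cofactor rs k ≈ 0#
      supported rs k k∉ = vanishing rs k (j ∷ z) (All.tabulate λ x∈ x≡k → k∉ (≡.subst (_∈ j ∷ z) x≡k x∈)) id
      first-coefficient : ∀ rs → cofactor rs j ≈ minor rs z
      first-coefficient rs = trans
        (+-cong (trans (*-congʳ (indicator-≡ j)) (*-identityˡ _))
                (-‿cong (vanishing rs j z (All.map (λ j<x x≡j → ℕ.<-irrefl (≡.cong Fin.toℕ (≡.sym x≡j)) j<x) h) (j ∷_))))
        (solve 1 (λ x → x :- con (ℤ.+ 0) := x) refl _)
      relation : ∀ rs → length rs ≡ length z → ∀ r → columnCombination B (cofactor rs) r ≈ 0#
      relation rs len r = begin
        sum (λ k → cofactor rs k * B r k)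
          ≈⟨ ∑-allFin (λ k → cofactor rs k * B r k) ⟨
        ∑ (allFin m) (λ k → cofactor rs k * B r k)
          ≈⟨ ∑-cong (allFin m) (λ k → trans (*-comm _ _) (alt-* (B r k) (term rs k) (j ∷ z))) ⟩
        ∑ (allFin m) (λ k → alt (λ k′ z′ → B r k * term rs k k′ z′) (j ∷ z))
          ≈⟨ alt-∑ (allFin m) (λ k k′ z′ → B r k * term rs k k′ z′) (j ∷ z) ⟨
        alt (λ k′ z′ → ∑ (allFin m) (λ k → B r k * term rs k k′ z′)) (j ∷ z)
          ≈⟨ alt-cong (j ∷ z) (λ k′ z′ → trans
               (∑-cong (allFin m) λ k → solve 3 (λ a b c → a :* (b :* c) := b :* (a :* c)) refl (B r k) _ _)
               (∑-indicator k′ (λ k → B r k * minor rs z′))) ⟩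
        minor (r ∷ rs) (j ∷ z)
          ≈⟨ vanish (r ∷ rs) (≡.cong suc len) ⟩
        0# ∎

    -- The lists of N rows in `minors-nonzero` may repeat or permute rows. By Cauchy-Binet with an
    -- identity matrix as one factor, each such minor is a multiple of the maximal one, as there is
    -- only one N-element set of rows.
    maximalMinor-nonzero : ∀ z → length z ≡ N → AllPairs Fin._<_ z → IndependentOn z → ¬ maximalMinor z ≈ 0#
    maximalMinor-nonzero z len ascending independent ≈0 = minors-nonzero z ascending independent λ rs len′ → begin
      minor rs z
        ≈⟨ D-transpose (λ r k → B r k) rs z ⟩
      D (λ k r → B r k) z rs
        ≈⟨ cauchyBinet (allFin N) indicator (λ r k → B r k) (λ r k → B r k)
             (λ r k → sym (∑-indicator r (λ r → B r k))) z rs ⟩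
      ∑ (choose (allFin N) (length rs)) (λ 𝔷 → D (λ k r → B r k) z 𝔷 * D indicator rs 𝔷)
        ≡⟨ ≡.cong (λ zs → ∑ zs (λ 𝔷 → D (λ k r → B r k) z 𝔷 * D indicator rs 𝔷))
             (≡.trans (≡.cong (choose (allFin N)) (≡.trans len′ (≡.trans len (≡.sym (List.length-tabulate {n = N} id)))))
                      (choose-length (allFin N))) ⟩
      D (λ k r → B r k) z (allFin N) * D indicator rs (allFin N) + 0#
        ≈⟨ +-congʳ (trans (*-congʳ (trans (sym (D-transpose (λ r k → B r k) (allFin N) z)) ≈0)) (zeroˡ _)) ⟩
      0# + 0#
        ≈⟨ +-identityˡ 0# ⟩
      0# ∎

    column : Fin m → Fin N → Carrier
    column k r = B r k

    module _ (rest : List (Fin m)) where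

      -- The signed height over the span of the columns `rest`; it compares cones that differ in a
      -- single generator.
      functional : (Fin N → Carrier) → Carrier
      functional x = columnD (allFin N) (x ∷ map column rest)

      functional-column : ∀ k → functional (column k) ≈ maximalMinor (k ∷ rest)
      functional-column k = trans (reflexive (≡.cong (λ rs → columnD rs (column k ∷ map column rest)) (≡.sym (List.map-id (allFin N)))))
        (D-map (λ r c → c r) id column (allFin N) (k ∷ rest))

      functional-combination : ∀ {k} c → (∀ l → l ∉ rest → l ≢ k → c l ≈ 0#) →
        ∀ {x} → (∀ r → x r ≈ columnCombination B c r) → functional x ≈ c k * maximalMinor (k ∷ rest)
      functional-combination {k} c support {x} h = begin
        functional x
          ≈⟨ D-linear-head (λ r c → c r) (allFin m) c column x
               (λ r → trans (h r) (sym (∑-allFin (λ l → c l * B r l)))) (allFin N) (map column rest) ⟩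
        ∑ (allFin m) (λ l → c l * functional (column l))
          ≈⟨ ∑-allFin (λ l → c l * functional (column l)) ⟩
        sum (λ l → c l * functional (column l))
          ≈⟨ sum-single k (λ l → c l * functional (column l)) other ⟩
        c k * functional (column k)
          ≈⟨ *-congˡ (functional-column k) ⟩
        c k * maximalMinor (k ∷ rest) ∎
        where
        open import Data.List.Membership.DecPropositional Fin._≟_ using (_∈?_)
        other : ∀ l → l ≢ k → c l * functional (column l) ≈ 0#
        other l l≢k with l ∈? rest
        ... | yes l∈ = trans (*-congˡ (trans (functional-column l)
                         (alternating-∈ (D-alternating (λ r k → B r k) (allFin N)) l∈))) (zeroʳ _)
        ... | no l∉  = trans (*-congʳ (support l l∉ l≢k)) (zeroˡ _)

      Cone : Fin m → (Fin N → Carrier) → Set _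
      Cone k x = ∃[ c ] (∀ l → 0# ≤ c l) × (∀ l → l ∉ rest → l ≢ k → c l ≈ 0#)
                      × (∀ r → x r ≈ columnCombination B c r)

      column-bound : ∀ k → ∃[ b ] 0# < b × (∀ r → B r k <∣ b ∣)
      column-bound k = bounds N (λ r → B r k)
        where
        widen : ∀ {z β γ} → 0# < γ → z <∣ β ∣ → z <∣ β + γ ∣
        widen 0<γ (p , q) =
          <-respʳ (solve 3 (λ z b g → b :- z :+ g := b :+ g :- z) refl _ _ _) (+-pos p 0<γ) ,
          <-respʳ (solve 3 (λ z b g → b :+ z :+ g := b :+ g :+ z) refl _ _ _) (+-pos q 0<γ)
        widen′ : ∀ {z β γ} → 0# < γ → z <∣ β ∣ → z <∣ γ + β ∣
        widen′ 0<γ h = <-respʳ (+-congʳ (+-comm _ _)) (proj₁ (widen 0<γ h)) , <-respʳ (+-congʳ (+-comm _ _)) (proj₂ (widen 0<γ h))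
        bounds : ∀ K (f : Fin K → Carrier) → ∃[ b ] 0# < b × (∀ r → f r <∣ b ∣)
        bounds zero    f = 1# , 0<1 , λ ()
        bounds (suc K) f = extend (bound (f Fin.zero)) (bounds K (f ∘ Fin.suc))
          where
          extend : ∃[ b ] f Fin.zero <∣ b ∣ → ∃[ d ] 0# < d × (∀ r → f (Fin.suc r) <∣ d ∣) → ∃[ b ] 0# < b × (∀ r → f r <∣ b ∣)
          extend (b , h) (d , 0<d , hs) = b + d , +-pos (bounded-pos h) 0<d ,
            λ { Fin.zero → widen 0<d h ; (Fin.suc r) → widen′ (bounded-pos h) (hs r) }

      box-centre : ∀ {ε} → 0# < ε → (x : Fin N → Carrier) → ∀ r → x r - ε < x r × x r < x r + ε
      box-centre {ε} 0<ε x r = 0<y-x⇒x<y (<-respʳ (solve 2 (λ x e → e := x :- (x :- e)) refl (x r) ε) 0<ε) ,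
                               0<y-x⇒x<y (<-respʳ (solve 2 (λ x e → e := (x :+ e) :- x) refl (x r) ε) 0<ε)

      -- Pushing an interior point of the cone of k ∷ rest away from the
      -- k-th column would leave the half-space of the k-th column.
      interior-sign : ∀ s {k x} → Interior (Cone k) x → HasSign s (maximalMinor (k ∷ rest)) → HasSign s (functional x)
      interior-sign s {k} {x} (ε , 0<ε , box) 0<sμ = push (column-bound k) (box x (box-centre 0<ε x))
        where
        μ = maximalMinor (k ∷ rest)
        push : ∃[ b ] 0# < b × (∀ r → B r k <∣ b ∣) → Cone k x → HasSign s (functional x)
        push (b , 0<b , bounded) (c , 0≤c , support , combination) = pushed (box y inside)
          where
          -- As `b` bounds the entries of column `k`, subtracting `η` times this column moves each
          -- coordinate by less than `ε`.
          η = ε * b ⁻¹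
          0<η = *-pos 0<ε (⁻¹-pos 0<b)
          ηb≈ε : η * b ≈ ε
          ηb≈ε = trans (*-assoc _ _ _) (trans (*-congˡ (trans (*-comm _ _) (⁻¹-inverseʳ (pos⇒≉0 0<b)))) (*-identityʳ ε))
          y : Fin N → Carrier
          y r = x r - η * B r k
          inside : ∀ r → x r - ε < y r × y r < x r + ε
          inside r =
            0<y-x⇒x<y (<-respʳ (trans (solve 4 (λ η b β x → η :* (b :- β) := (x :- η :* β) :- (x :- η :* b)) refl η b (B r k) (x r))
              (+-congˡ (-‿cong (+-congˡ (-‿cong ηb≈ε))))) (*-pos 0<η (proj₁ (bounded r)))) ,
            0<y-x⇒x<y (<-respʳ (trans (solve 4 (λ η b β x → η :* (b :+ β) := (x :+ η :* b) :- (x :- η :* β)) refl η b (B r k) (x r))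
              (+-congʳ (+-congˡ ηb≈ε))) (*-pos 0<η (proj₂ (bounded r))))
          functional-x : functional x ≈ c k * μ
          functional-x = functional-combination c support combination
          functional-shift : functional y ≈ functional x - η * μ
          functional-shift = trans (D-linear-head (λ r c → c r) ((1# , x) ∷ (- η , column k) ∷ []) proj₁ proj₂ y
              (λ r → solve 3 (λ x h β → x :- h :* β := con 1ℤ :* x :+ ((:- h) :* β :+ con (ℤ.+ 0))) refl (x r) η (B r k))
              (allFin N) (map column rest))
            (trans (+-congˡ (+-congʳ (*-congˡ (functional-column k))))
              (solve 3 (λ x h μ → con 1ℤ :* x :+ ((:- h) :* μ :+ con (ℤ.+ 0)) := x :- h :* μ) refl (functional x) η μ))
          pushed : Cone k y → HasSign s (functional x)
          pushed (c′ , 0≤c′ , support′ , combination′) = conclude (compare 0# (c k))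
            where
            positive-sum : Tri (0# < c′ k) (0# ≈ c′ k) (c′ k < 0#) → 0# < η + c′ k
            positive-sum (tri< 0<c′ _ _) = +-pos 0<η 0<c′
            positive-sum (tri≈ _ 0≈c′ _) = <-respʳ (trans (sym (+-identityʳ η)) (+-congˡ 0≈c′)) 0<η
            positive-sum (tri> _ _ c′<0) = contradiction c′<0 (0≤c′ k)
            -- Were `c k` zero, `x` would have height 0 and the pushed point height `- η μ`. Lying
            -- in the cone, that point has height `c′ k * μ` with `c′ k` nonnegative, so a positive
            -- multiple of `μ` would vanish.
            vanishes : 0# ≈ c k → (η + c′ k) * μ ≈ 0#
            vanishes 0≈c = begin
              (η + c′ k) * μ                  ≈⟨ solve 3 (λ h c μ → (h :+ c) :* μ := c :* μ :+ h :* μ) refl η (c′ k) μ ⟩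
              c′ k * μ + η * μ                ≈⟨ +-congʳ (trans (sym (functional-combination c′ support′ combination′)) functional-shift) ⟩
              functional x - η * μ + η * μ    ≈⟨ solve 2 (λ x z → x :- z :+ z := x) refl (functional x) (η * μ) ⟩
              functional x                    ≈⟨ functional-x ⟩
              c k * μ                         ≈⟨ *-congʳ (sym 0≈c) ⟩
              0# * μ                          ≈⟨ zeroˡ μ ⟩
              0#                              ∎
            conclude : Tri (0# < c k) (0# ≈ c k) (c k < 0#) → HasSign s (functional x)
            conclude (tri< 0<c _ _) = <-respʳ (trans (solve 3 (λ s c μ → c :* (s :* μ) := s :* (c :* μ)) refl (sgn s) (c k) μ)
              (*-congˡ (sym functional-x))) (*-pos 0<c 0<sμ)
            conclude (tri> _ _ c<0) = contradiction c<0 (0≤c k)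
            conclude (tri≈ _ 0≈c _) = contradiction
              (trans (*-congˡ (*-cancelˡ-0 (pos⇒≉0 (positive-sum (compare 0# (c′ k)))) (vanishes 0≈c))) (zeroʳ (sgn s)))
              (pos⇒≉0 0<sμ)

      cone-sign : ∀ s {k x} → Cone k x → HasSign s (functional x) → HasSign s (maximalMinor (k ∷ rest))
      cone-sign s {k} {x} (c , 0≤c , support , combination) 0<sx = conclude (compare 0# (c k))
        where
        functional-x = functional-combination c support combination
        conclude : Tri (0# < c k) (0# ≈ c k) (c k < 0#) → HasSign s (maximalMinor (k ∷ rest))
        conclude (tri< 0<c _ _) = *-cancel-pos 0<c (<-respʳ (trans (*-congˡ functional-x)
                                    (solve 3 (λ s c μ → s :* (c :* μ) := c :* (s :* μ)) refl (sgn s) (c k) _)) 0<sx)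
        conclude (tri≈ _ 0≈c _) = contradiction (trans (*-congˡ (trans functional-x
                                    (trans (*-congʳ (sym 0≈c)) (zeroˡ _)))) (zeroʳ _)) (pos⇒≉0 0<sx)
        conclude (tri> _ _ c<0) = contradiction c<0 (0≤c k)

      -- At the common point `functional` is a positive multiple of each of the two minors.
      interiors-sign : ∀ s {k l} → (∃[ x ] Interior (Cone k) x × Interior (Cone l) x) →
        HasSign s (maximalMinor (k ∷ rest)) → HasSign s (maximalMinor (l ∷ rest))
      interiors-sign s (x , inner , ε , 0<ε , box) h =
        cone-sign s (box x (box-centre 0<ε x)) (interior-sign s inner h)

open Filters
open Lists
open Vectors

-- Polynomial interpolation through the columns.

module Interpolation {a ℓ₁ ℓ₂} (ℝ : CompleteOrderedField a ℓ₁ ℓ₂) where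
  open CompleteOrderedField ℝ hiding (zero)
  open OrderedField ℝ
  open SchurExpansion ℝ
  open IntegerCoefficients using (nat; nat-suc)
  open import Relation.Binary.Reasoning.Setoid setoid

  node : ∀ {m} → Fin m → Carrier
  node j = nat (suc (toℕ j))

  nat-mono-< : ∀ {k l} → k ℕ.< l → nat k < nat l
  nat-mono-< {k} {suc l} (ℕ.s≤s k≤l) with ℕ.m≤n⇒m<n∨m≡n k≤l
  ... | inj₁ k<l    = <-trans (nat-mono-< k<l) (nat-step l)
    where
    nat-step : ∀ l → nat l < nat (suc l)
    nat-step l = <-respˡ (+-identityˡ _) (<-respʳ (sym (nat-suc l)) (+-monoˡ-< (nat l) 0<1))
  ... | inj₂ ≡.refl = <-respˡ (+-identityˡ _) (<-respʳ (sym (nat-suc l)) (+-monoˡ-< (nat l) 0<1))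

  node-pos : ∀ {m} (j : Fin m) → 0# < node j
  node-pos j = nat-mono-< {0} {suc (toℕ j)} (ℕ.s≤s ℕ.z≤n)

  node-mono : ∀ {m} {i j : Fin m} → i Fin.< j → node i < node j
  node-mono i<j = nat-mono-< (ℕ.s≤s i<j)

  horner : ∀ {r} → (Fin r → Carrier) → Carrier → Carrier
  horner {zero}  f t = 0#
  horner {suc r} f t = f Fin.zero + t * horner (f ∘ Fin.suc) t

  horner-sum : ∀ {r} (f : Fin r → Carrier) t → horner f t ≈ sum (λ k → t ^ toℕ k * f k)
  horner-sum {zero}  f t = refl
  horner-sum {suc r} f t = +-cong (sym (*-identityˡ _)) (begin
    t * horner (f ∘ Fin.suc) t
      ≈⟨ *-congˡ (horner-sum (f ∘ Fin.suc) t) ⟩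
    t * sum (λ k → t ^ toℕ k * f (Fin.suc k))
      ≈⟨ SemiringSum.*-distribˡ-sum semiring t (λ k → t ^ toℕ k * f (Fin.suc k)) ⟩
    sum (λ k → t * (t ^ toℕ k * f (Fin.suc k)))
      ≈⟨ Sum.sum-cong-≋ {n = r} (λ k → sym (*-assoc t _ _)) ⟩
    sum (λ k → t ^ suc (toℕ k) * f (Fin.suc k)) ∎)

  -- The coefficients of b + (X - u) f.
  newton : ∀ {r} → Carrier → Carrier → (Fin r → Carrier) → Fin (suc r) → Carrier
  newton {zero}  u b f _           = b
  newton {suc r} u b f Fin.zero    = b - u * f Fin.zero
  newton {suc r} u b f (Fin.suc k) = newton u (f Fin.zero) (f ∘ Fin.suc) k

  horner-newton : ∀ {r} u b (f : Fin r → Carrier) t → horner (newton u b f) t ≈ b + (t - u) * horner f t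
  horner-newton {zero}  u b f t = solve 3 (λ u b t → b :+ t :* con (ℤ.+ 0) := b :+ (t :- u) :* con (ℤ.+ 0)) refl u b t
  horner-newton {suc r} u b f t = trans (+-congˡ (*-congˡ (horner-newton u (f Fin.zero) (f ∘ Fin.suc) t)))
    (solve 5 (λ u b t c h → b :- u :* c :+ t :* (c :+ (t :- u) :* h) := b :+ (t :- u) :* (c :+ t :* h)) refl
      u b t (f Fin.zero) (horner (f ∘ Fin.suc) t))

  -- Newton's scheme: the remaining nodes are interpolated for the divided differences with respect
  -- to the first node. Starting from the constant 0 leaves one coefficient more than nodes, so
  -- there is at least one even without nodes, as `d ≥ 1` demands.
  interpolate : ∀ {r} (t b : Fin r → Carrier) → (∀ {i j} → i Fin.< j → t i < t j) →
    Σ[ f ∈ (Fin (suc r) → Carrier) ] ∀ j → horner f (t j) ≈ b j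
  interpolate {zero}  t b ascending = (λ _ → 0#) , λ ()
  interpolate {suc r} t b ascending = extend (interpolate (t ∘ Fin.suc) quotient (ascending ∘ ℕ.s≤s))
    where
    u = t Fin.zero
    quotient : Fin r → Carrier
    quotient j = (b (Fin.suc j) - b Fin.zero) * (t (Fin.suc j) - u) ⁻¹
    extend : Σ[ f ∈ (Fin (suc r) → Carrier) ] (∀ j → horner f (t (Fin.suc j)) ≈ quotient j) →
             Σ[ f ∈ (Fin (suc (suc r)) → Carrier) ] ∀ j → horner f (t j) ≈ b j
    extend (f , h) = newton u (b Fin.zero) f , values
      where
      values : ∀ j → horner (newton u (b Fin.zero) f) (t j) ≈ b j
      values Fin.zero = trans (horner-newton u (b Fin.zero) f u)
        (solve 3 (λ b u h → b :+ (u :- u) :* h := b) refl (b Fin.zero) u _)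
      values (Fin.suc j) = trans (horner-newton u (b Fin.zero) f (t (Fin.suc j)))
        (trans (+-congˡ (*-congˡ (h j))) (trans
          (solve 4 (λ b c d i → b :+ d :* ((c :- b) :* i) := b :+ (c :- b) :* (d :* i)) refl
            (b Fin.zero) (b (Fin.suc j)) (t (Fin.suc j) - u) ((t (Fin.suc j) - u) ⁻¹))
          (trans (+-congˡ (trans (*-congˡ (⁻¹-inverseʳ (pos⇒≉0 (x<y⇒0<y-x (ascending (ℕ.s≤s ℕ.z≤n)))))) (*-identityʳ _)))
            (solve 2 (λ b c → b :+ (c :- b) := c) refl (b Fin.zero) (b (Fin.suc j))))))

-- Facets, ridges and the sign of the minors along flips.

module Positions {m : ℕ} where

  union : List (Fin m) → Subset m
  union z = ⋃ (map ⁅_⁆ z)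

  ∈-union⁺ : ∀ {j z} → j ∈ z → j Subset.∈ union z
  ∈-union⁺ {z = i ∷ z} (here ≡.refl) = Subset.x∈p∪q⁺ (inj₁ (Subset.x∈⁅x⁆ i))
  ∈-union⁺ {z = i ∷ z} (there j∈z)   = Subset.x∈p∪q⁺ {p = ⁅ i ⁆} (inj₂ (∈-union⁺ j∈z))

  ∈-union⁻ : ∀ {j} z → j Subset.∈ union z → j ∈ z
  ∈-union⁻ []      h = contradiction h Subset.∉⊥
  ∈-union⁻ (i ∷ z) h with Subset.x∈p∪q⁻ ⁅ i ⁆ (union z) h
  ... | inj₁ j∈i = here (Subset.x∈⁅y⁆⇒x≡y i j∈i)
  ... | inj₂ j∈z = there (∈-union⁻ z j∈z)

  facet : List (Fin m) → Subset m
  facet z = ∁ (union z)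

  ∈-facet⁺ : ∀ {j} z → j ∉ z → j Subset.∈ facet z
  ∈-facet⁺ z j∉z = Subset.x∉p⇒x∈∁p (j∉z ∘ ∈-union⁻ z)

  ∈-facet⁻ : ∀ {j z} → j Subset.∈ facet z → j ∉ z
  ∈-facet⁻ h j∈z = Subset.x∈∁p⇒x∉p h (∈-union⁺ j∈z)

  ∉-∁facet : ∀ {j} z → j ∉ z → j Subset.∉ ∁ (facet z)
  ∉-∁facet z j∉z = Subset.x∈p⇒x∉∁p (∈-facet⁺ z j∉z)

  ∈-∁facet : ∀ {j z} → j ∈ z → j Subset.∈ ∁ (facet z)
  ∈-∁facet j∈z = Subset.x∉p⇒x∈∁p (λ h → ∈-facet⁻ h j∈z)

  ∣⁅x⁆∪p∣ : ∀ {k} (x : Fin k) (p : Subset k) → x Subset.∉ p → ∣ ⁅ x ⁆ ∪ p ∣ ≡ suc ∣ p ∣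
  ∣⁅x⁆∪p∣ Fin.zero    (Subset.inside ∷ p)  x∉p = contradiction Vec.here x∉p
  ∣⁅x⁆∪p∣ Fin.zero    (Subset.outside ∷ p) x∉p = ≡.cong (suc ∘ ∣_∣) (Subset.∪-identityˡ p)
  ∣⁅x⁆∪p∣ (Fin.suc x) (Subset.inside ∷ p)  x∉p = ≡.cong suc (∣⁅x⁆∪p∣ x p (x∉p ∘ Vec.there))
  ∣⁅x⁆∪p∣ (Fin.suc x) (Subset.outside ∷ p) x∉p = ∣⁅x⁆∪p∣ x p (x∉p ∘ Vec.there)

  -- A position outside `z` is either `b` or also outside `z′`, so the first facet is the common
  -- part with `b` added.
  ridge : ∀ {z z′ : List (Fin m)} {b} → b ∉ z → b ∈ z′ → (∀ {j} → j ∈ z′ → j ≡ b ⊎ j ∈ z) →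
    suc ∣ facet z ∩ facet z′ ∣ ≡ ∣ facet z ∣
  ridge {z} {z′} {b} b∉z b∈z′ new = ≡.trans
    (≡.sym (∣⁅x⁆∪p∣ b (facet z ∩ facet z′) λ h → ∈-facet⁻ (proj₂ (Subset.x∈p∩q⁻ (facet z) (facet z′) h)) b∈z′))
    (≡.cong ∣_∣ (Subset.⊆-antisym into from))
    where
    into : ⁅ b ⁆ ∪ (facet z ∩ facet z′) Subset.⊆ facet z
    into h with Subset.x∈p∪q⁻ ⁅ b ⁆ (facet z ∩ facet z′) h
    ... | inj₁ j∈b with ≡.refl ← Subset.x∈⁅y⁆⇒x≡y b j∈b = ∈-facet⁺ z b∉z
    ... | inj₂ j∈ = proj₁ (Subset.x∈p∩q⁻ (facet z) (facet z′) j∈)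
    from : facet z Subset.⊆ ⁅ b ⁆ ∪ (facet z ∩ facet z′)
    from {j} h with j Fin.≟ b
    ... | yes ≡.refl = Subset.x∈p∪q⁺ (inj₁ (Subset.x∈⁅x⁆ b))
    ... | no j≢b = Subset.x∈p∪q⁺ {p = ⁅ b ⁆} (inj₂ (Subset.x∈p∩q⁺ (h , ∈-facet⁺ z′ outside′)))
      where
      outside′ : j ∉ z′
      outside′ j∈z′ with new j∈z′
      ... | inj₁ j≡b = j≢b j≡b
      ... | inj₂ j∈z = ∈-facet⁻ h j∈z

open Positions

any-vec? : ∀ {m k p} {P : Vec (Fin m) k → Set p} → Decidable P → Dec (∃ P)
any-vec? {k = zero}  P? = map′ ([] ,_) (λ { ([] , p) → p }) (P? [])
any-vec? {k = suc k} P? = map′ (λ (x , v , p) → x ∷ v , p) (λ { (x ∷ v , p) → x , v , p })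
  (Fin.any? λ x → any-vec? λ v → P? (x ∷ v))

module Realization {a ℓ₁ ℓ₂ c ℓ} (ℝ : CompleteOrderedField a ℓ₁ ℓ₂) (W : CoxeterSystem c ℓ)
  (finite : CoxeterSystem.IsFinite W) (w∘ : CoxeterSystem.Element W)
  {N : ℕ} (hasLength : CoxeterSystem.HasLength W w∘ N)
  {τ : Vec (CoxeterSystem.S W) N → Sign} (isTSign : TSign.IsTSign W w∘ τ)
  {m : ℕ} (p : Vec (CoxeterSystem.S W) m) where
  open CoxeterSystem W
  open CompleteOrderedField ℝ hiding (zero; _≈_) renaming (refl to reflᵣ; sym to symᵣ; trans to transᵣ; reflexive to reflexiveᵣ)
  open CompleteOrderedField ℝ using () renaming (_≈_ to _≈ᵣ_)
  open OrderedField ℝ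
  open LinearAlgebra ℝ
  open Determinants ℝ
  open Cones ℝ
  open Subword W
  open NumbersGame ℝ isCoxeterMatrix using (alternating-distinct)

  private
    f : Fin m → S
    f = lookup p

    encode : Element → Fin (proj₁ finite)
    encode = Inverse.from (proj₂ finite)

  -- Elements are compared through their codes in the finite enumeration of the group.
  _≟_ : Decidable₂ _≈_
  x ≟ y = map′ (λ eq → trans (sym (strict x)) (trans (Inverse.to-cong (proj₂ finite) eq) (strict y)))
               (Inverse.from-cong (proj₂ finite)) (encode x Fin.≟ encode y)
    where
    open Group group using (sym; trans)
    strict = Inverse.strictlyInverseˡ (proj₂ finite)

  distinct : ∀ {i j} → i ≢ j → ∀ k → mat i j ≡ 0 ⊎ suc k ℕ.< mat i j →
             ¬ ⟦ alternating (suc k) i j ⟧ ≈ ⟦ alternating (suc k) j i ⟧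
  distinct i≢j k k<m eq = alternating-distinct i≢j k k<m (Equivalence.to (presentation _ _) eq)

  open Words W
  open Exchange _≟_
  open Matsumoto distinct
  open LongestElement w∘ hasLength
  open Flips W _≟_ w∘ hasLength f

  τ-list : (z : List (Fin m)) → length (map f z) ≡ N → Sign
  τ-list z e = τ (vec (map f z) e)

  τ-vec : ∀ {u u′} → u ≡ u′ → ∀ e e′ → τ (vec u e) ≡ τ (vec u′ e′)
  τ-vec {u} ≡.refl e e′ = ≡.cong (λ e → τ (vec u e)) (ℕ.≡-irrelevant e e′)

  τ-list-flip : ∀ pre a mid b post e e′ → IsWord (pre ++ a ∷ mid ++ post) → IsWord (pre ++ mid ++ b ∷ post) →
    τ-list (pre ++ a ∷ mid ++ post) e ≡ -1^ (length mid) Sign.* τ-list (pre ++ mid ++ b ∷ post) e′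
  τ-list-flip pre a mid b post e e′ w w′ = ≡.trans (τ-vec eq e (≡.trans (≡.cong length (≡.sym eq)) e))
    (≡.trans (τ-flip isTSign (map f pre) (f a) (map f mid) (f b) (map f post) _ (≡.trans (≡.cong length (≡.sym eq′)) e′)
        (trans (reflexive (≡.cong ⟦_⟧ (≡.sym eq))) (IsWord.value≈ w))
        (trans (reflexive (≡.cong ⟦_⟧ (≡.sym eq′))) (IsWord.value≈ w′)))
      (≡.cong₂ Sign._*_ (≡.cong -1^ (List.length-map f mid)) (≡.sym (τ-vec eq′ e′ _))))
    where
    eq : map f (pre ++ a ∷ mid ++ post) ≡ map f pre ++ f a ∷ map f mid ++ map f post
    eq = ≡.trans (List.map-++ f pre _) (≡.cong (λ u → map f pre ++ f a ∷ u) (List.map-++ f mid post))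
    eq′ : map f (pre ++ mid ++ b ∷ post) ≡ map f pre ++ map f mid ++ f b ∷ map f post
    eq′ = ≡.trans (List.map-++ f pre _) (≡.cong (map f pre ++_) (List.map-++ f mid _))

  AllPairs⇒Linked : ∀ {k} {z : Vec (Fin m) k} → AllPairs Fin._<_ (toList z) → Linked Fin._<_ z
  AllPairs⇒Linked {z = []}         _                    = []
  AllPairs⇒Linked {z = _ ∷ []}     _                    = [-]
  AllPairs⇒Linked {z = _ ∷ _ ∷ _} ((h ∷ _) ∷ hs)       = h ∷ AllPairs⇒Linked hs

  isFacet : ∀ {z} → AllPairs Fin._<_ z → IsWord z → IsFacet w∘ N p (facet z)
  isFacet {z} ascending (word len value) = vec z len ,
    (AllPairs⇒Linked (≡.subst (AllPairs Fin._<_) (≡.sym (toList-vec z len)) ascending) ,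
     hasLength , trans (reflexive (≡.cong ⟦_⟧ (≡.trans (Vec.toList-map f (vec z len)) (≡.cong (map f) (toList-vec z len))))) value) ,
    ≡.cong (λ zs → ∁ (⋃ zs)) (≡.sym (≡.trans (Vec.toList-map ⁅_⁆ (vec z len)) (≡.cong (map ⁅_⁆) (toList-vec z len))))

  ascending : ∀ {z : Vec (Fin m) N} → IsOccurrence w∘ p z → AllPairs Fin._<_ (toList z)
  ascending (linked , _) = Linked⇒AllPairs Fin.<-trans linked

  isWord : ∀ {z : Vec (Fin m) N} → IsOccurrence w∘ p z → IsWord (toList z)
  isWord {z} (_ , _ , value) = word (Vec.length-toList z) (trans (reflexive (≡.cong ⟦_⟧ (≡.sym (Vec.toList-map f z)))) value)

  -- The global sign is read off at a reference occurrence. Whether there is one at all is settled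
  -- by a search through finitely many position vectors.
  occurrence? : Dec (∃ (IsOccurrence w∘ {N = N} p))
  occurrence? = any-vec? λ z → linked? Fin._<?_ z ×-dec (yes hasLength ×-dec (⟦ toList (subword p z) ⟧ ≟ w∘))

  module _ (B : Matrix N m)
    (independent : ∀ C → IsFacet w∘ N p C → IndependentColumns B (∁ C))
    (flips-meet : ∀ C C′ → IsFacet w∘ N p C → IsFacet w∘ N p C′ → MeetInRidge C C′ →
      ∃[ x ] Interior (InCone B (∁ C)) x × Interior (InCone B (∁ C′)) x) where

    minor≉0 : ∀ {z} → AllPairs Fin._<_ z → IsWord z → ¬ maximalMinor B z ≈ᵣ 0#
    minor≉0 {z} asc w = maximalMinor-nonzero B z (IsWord.length≡ w) asc λ c support relation →
      independent (facet z) (isFacet asc w) c (λ j j∉ → support j (j∉ ∘ ∈-∁facet)) relation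

    Good : Sign → List (Fin m) → Set ℓ₂
    Good κ z = ∀ e → HasSign (κ Sign.* τ-list z e) (maximalMinor B z)

    cone⇒Cone : ∀ pre a post {x} → Interior (InCone B (∁ (facet (pre ++ a ∷ post)))) x → Interior (Cone B (pre ++ post) a) x
    cone⇒Cone pre a post (ε , 0<ε , box) = ε , 0<ε , λ y near → convert (box y near)
      where
      convert : ∀ {y} → InCone B (∁ (facet (pre ++ a ∷ post))) y → Cone B (pre ++ post) a y
      convert (c , 0≤c , support , combination) = c , 0≤c , (λ l l∉ l≢a → support l (∉-∁facet _ (absent l∉ l≢a))) , combination
        where
        absent : ∀ {l} → l ∉ pre ++ post → l ≢ a → l ∉ pre ++ a ∷ post
        absent l∉ l≢a l∈ with ∈-++⁻ pre l∈
        ... | inj₁ l∈pre           = l∉ (∈-++⁺ˡ l∈pre)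
        ... | inj₂ (here l≡a)      = l≢a l≡a
        ... | inj₂ (there l∈post)  = l∉ (∈-++⁺ʳ pre l∈post)

    HasSign-* : ∀ s t {x} → HasSign s x → HasSign (s Sign.* t) (sgn t * x)
    HasSign-* s t {x} = <-respʳ (transᵣ
      (transᵣ (*-congʳ (transᵣ (symᵣ (*-identityʳ _)) (*-congˡ (symᵣ (sgn-square t)))))
        (solve 3 (λ s t x → s :* (t :* t) :* x := s :* t :* (t :* x)) reflᵣ (sgn s) (sgn t) x))
      (*-congʳ (symᵣ (sgn-* s t))))

    HasSign-*⁻ : ∀ s t {x} → HasSign (s Sign.* t) (sgn t * x) → HasSign s x
    HasSign-*⁻ s t {x} h = ≡.subst (λ r → HasSign r x) (≡.trans (Sign.*-assoc s t t) (≡.trans (≡.cong (s Sign.*_) (Sign.s*s≡+ t)) (Sign.*-identityʳ s)))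
      (HasSign-resp ((s Sign.* t) Sign.* t)
        (transᵣ (symᵣ (*-assoc _ _ _)) (transᵣ (*-congʳ (sgn-square t)) (*-identityˡ x))) (HasSign-* (s Sign.* t) t h))

    module _ (pre : List (Fin m)) (a : Fin m) (mid : List (Fin m)) (b : Fin m) (post : List (Fin m))
             (asc : AllPairs Fin._<_ (pre ++ a ∷ mid ++ b ∷ post))
             (w : IsWord (pre ++ a ∷ mid ++ post)) (w′ : IsWord (pre ++ mid ++ b ∷ post)) where
      private
        z  = pre ++ a ∷ mid ++ post
        z′ = pre ++ mid ++ b ∷ post
        rest = pre ++ mid ++ post
        P = -1^ (length pre)
        M = -1^ (length mid)

        regroup : ∀ (mid ys : List (Fin m)) → (pre ++ mid) ++ ys ≡ pre ++ mid ++ ys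
        regroup mid ys = List.++-assoc pre mid ys

        regroup-a : ∀ (ys : List (Fin m)) → (pre ++ a ∷ mid) ++ ys ≡ pre ++ a ∷ mid ++ ys
        regroup-a ys = List.++-assoc pre (a ∷ mid) ys

        asc-z : AllPairs Fin._<_ z
        asc-z = ≡.subst (AllPairs Fin._<_) (regroup-a post)
          (AllPairs-remove (pre ++ a ∷ mid) (≡.subst (AllPairs Fin._<_) (≡.sym (regroup-a (b ∷ post))) asc))

        asc-z′ : AllPairs Fin._<_ z′
        asc-z′ = AllPairs-remove pre asc

        separated : ∀ (xs : List (Fin m)) {y ys} → AllPairs Fin._<_ (xs ++ y ∷ ys) → y ∉ xs ++ ys
        separated []       (h ∷ _) y∈          = ℕ.<-irrefl ≡.refl (All.lookup h y∈)
        separated (x ∷ xs) (h ∷ _) (here ≡.refl) = ℕ.<-irrefl ≡.refl (All.head (All.++⁻ʳ xs h))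
        separated (x ∷ xs) (_ ∷ s) (there y∈)  = separated xs s y∈

        b∉z : b ∉ z
        b∉z b∈ = separated (pre ++ a ∷ mid) (≡.subst (AllPairs Fin._<_) (≡.sym (regroup-a (b ∷ post))) asc)
          (≡.subst (b ∈_) (≡.sym (regroup-a post)) b∈)

        b∈z′ : b ∈ z′
        b∈z′ = ∈-++⁺ʳ pre (∈-insert mid)

        new : ∀ {j} → j ∈ z′ → j ≡ b ⊎ j ∈ z
        new j∈ with ∈-++⁻ pre j∈
        ... | inj₁ j∈pre = inj₂ (∈-++⁺ˡ j∈pre)
        ... | inj₂ j∈′ with ∈-++⁻ mid j∈′
        ...   | inj₁ j∈mid          = inj₂ (∈-++⁺ʳ pre (there (∈-++⁺ˡ j∈mid)))
        ...   | inj₂ (here j≡b)     = inj₁ j≡b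
        ...   | inj₂ (there j∈post) = inj₂ (∈-++⁺ʳ pre (there (∈-++⁺ʳ mid j∈post)))

        meet : ∃[ x ] Interior (Cone B rest a) x × Interior (Cone B rest b) x
        meet with flips-meet (facet z) (facet z′) (isFacet asc-z w) (isFacet asc-z′ w′) (ridge b∉z b∈z′ new)
        ... | x , i , i′ = x , cone⇒Cone pre a (mid ++ post) i ,
              ≡.subst (λ ys → Interior (Cone B ys b) x) (regroup mid post)
                (cone⇒Cone (pre ++ mid) b post (≡.subst (λ ys → Interior (InCone B (∁ (facet ys))) x) (≡.sym (regroup mid (b ∷ post))) i′))

        alternating′ = D-alternating (λ r k → B r k) (allFin N)

        move-a : maximalMinor B (a ∷ rest) ≈ᵣ sgn P * maximalMinor B z
        move-a = alternating-move alternating′ [] a pre (mid ++ post)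

        move-b : maximalMinor B (b ∷ rest) ≈ᵣ sgn (P Sign.* M) * maximalMinor B z′
        move-b = transᵣ (reflexiveᵣ (≡.cong (λ ys → maximalMinor B (b ∷ ys)) (≡.sym (regroup mid post))))
          (transᵣ (alternating-move alternating′ [] b (pre ++ mid) post)
            (reflexiveᵣ (≡.cong₂ (λ s ys → sgn s * maximalMinor B ys)
              (≡.trans (≡.cong -1^ (List.length-++ pre)) (1^-+ (length pre) (length mid))) (regroup mid (b ∷ post)))))
          where 1^-+ = -1^-+

        signs : ∀ κ t → (κ Sign.* (M Sign.* t)) Sign.* P ≡ (κ Sign.* t) Sign.* (P Sign.* M)
        signs κ t = SignSolver.solve 4 (λ k m t p → ((k ⊕ (m ⊕ t)) ⊕ p) SignSolver.⊜ ((k ⊕ t) ⊕ (p ⊕ m))) ≡.refl κ M t P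
          where
          module SignSolver = CommutativeMonoidSolver Sign.*-commutativeMonoid
          open SignSolver using (_⊕_)

      -- With `a` and `b` moved in front of the common `rest`, the two minors have equal sign by
      -- `interiors-sign`. The moves cost `P` and `P * M`, so the original minors differ by `M`, the
      -- sign that `τ` also acquires in the flip.
      good-forward : ∀ κ → Good κ z → Good κ z′
      good-forward κ good e′ = HasSign-*⁻ (κ Sign.* t′) (P Sign.* M) (HasSign-resp ((κ Sign.* t′) Sign.* (P Sign.* M)) move-b
        (≡.subst (λ s → HasSign s (maximalMinor B (b ∷ rest))) (signs κ t′)
          (interiors-sign B rest ((κ Sign.* (M Sign.* t′)) Sign.* P) meet
            (HasSign-resp ((κ Sign.* (M Sign.* t′)) Sign.* P) (symᵣ move-a)
              (HasSign-* (κ Sign.* (M Sign.* t′)) P (≡.subst (λ s → HasSign (κ Sign.* s) (maximalMinor B z))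
                (τ-list-flip pre a mid b post e e′ w w′) (good e)))))))
        where
        t′ = τ-list z′ e′
        e = ≡.trans (List.length-map f z) (IsWord.length≡ w)

      good-backward : ∀ κ → Good κ z′ → Good κ z
      good-backward κ good e = ≡.subst (λ s → HasSign (κ Sign.* s) (maximalMinor B z)) (≡.sym (τ-list-flip pre a mid b post e e′ w w′))
        (HasSign-*⁻ (κ Sign.* (M Sign.* t′)) P (HasSign-resp ((κ Sign.* (M Sign.* t′)) Sign.* P) move-a
          (interiors-sign B rest ((κ Sign.* (M Sign.* t′)) Sign.* P) (proj₁ meet , proj₂ (proj₂ meet) , proj₁ (proj₂ meet))
            (≡.subst (λ s → HasSign s (maximalMinor B (b ∷ rest))) (≡.sym (signs κ t′))
              (HasSign-resp ((κ Sign.* t′) Sign.* (P Sign.* M)) (symᵣ move-b) (HasSign-* (κ Sign.* t′) (P Sign.* M) (good e′)))))))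
        where
        e′ = ≡.trans (List.length-map f z′) (IsWord.length≡ w′)
        t′ = τ-list z′ e′

    flip-forward : ∀ κ {z z′} → Flip z z′ → Good κ z → Good κ z′
    flip-forward κ (flips {pre} {mid} {post} {a} {b} asc ≡.refl ≡.refl w w′) = good-forward pre a mid b post asc w w′ κ

    flip-backward : ∀ κ {z z′} → Flip z z′ → Good κ z′ → Good κ z
    flip-backward κ (flips {pre} {mid} {post} {a} {b} asc ≡.refl ≡.refl w w′) = good-backward pre a mid b post asc w w′ κ

    τ-subword : ∀ z (e : length (map f (toList z)) ≡ N) → τ-list (toList z) e ≡ τ (subword p z)
    τ-subword z e = ≡.trans (τ-vec (≡.sym (Vec.toList-map f z)) e (Vec.length-toList (subword p z)))
      (≡.cong τ (vec-toList (subword p z) (Vec.length-toList (subword p z))))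

    consistent-sign : ∃[ κ ] ∀ z → IsOccurrence w∘ p z → HasSign (κ Sign.* τ (subword p z)) (maximalMinor B (toList z))
    consistent-sign = search occurrence?
      where
      Result = ∃[ κ ] ∀ z → IsOccurrence w∘ p z → HasSign (κ Sign.* τ (subword p z)) (maximalMinor B (toList z))
      search : Dec (∃ (IsOccurrence w∘ {N = N} p)) → Result
      search (no none)       = Sign.+ , λ z occ → contradiction (z , occ) none
      search (yes (z₀ , o₀)) = κ , λ z o → ≡.subst (λ s → HasSign (κ Sign.* s) (maximalMinor B (toList z))) (τ-subword z _)
        (connected (Good κ) (flip-forward κ) (flip-backward κ) (ascending o₀) (ascending o) (isWord o₀) (isWord o) start
          (≡.trans (List.length-map f (toList z)) (Vec.length-toList z)))
        where
        μ≉0 = minor≉0 (ascending o₀) (isWord o₀)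
        t₀ = τ (subword p z₀)
        -- Chosen so that `κ` times `t₀` is the sign of the reference minor, since `t₀` squares to
        -- +.
        κ = signOf μ≉0 Sign.* t₀
        start : Good κ (toList z₀)
        start e = ≡.subst (λ s → HasSign s (maximalMinor B (toList z₀)))
          (≡.sym (≡.trans (≡.cong (κ Sign.*_) (τ-subword z₀ e)) (≡.trans (Sign.*-assoc (signOf μ≉0) t₀ t₀)
            (≡.trans (≡.cong (signOf μ≉0 Sign.*_) (Sign.s*s≡+ t₀)) (Sign.*-identityʳ (signOf μ≉0))))))
          (signOf-hasSign μ≉0)

-- Absorbing the global sign, and the theorem.

module SignedMatrices {a ℓ₁ ℓ₂} (ℝ : CompleteOrderedField a ℓ₁ ℓ₂) where
  open CompleteOrderedField ℝ hiding (zero)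
  open OrderedField ℝ
  open LinearAlgebra ℝ
  open Determinants ℝ
  open Cones ℝ

  scaleFirstRow : ∀ {N m} → Sign → Matrix N m → Matrix N m
  scaleFirstRow κ B Fin.zero    k = sgn κ * B Fin.zero k
  scaleFirstRow κ B (Fin.suc r) k = B (Fin.suc r) k

  maximalMinor-scale : ∀ {N m} κ (B : Matrix (suc N) m) z →
    maximalMinor (scaleFirstRow κ B) z ≈ sgn κ * maximalMinor B z
  maximalMinor-scale {N} {m} κ B z = trans
    (alt-cong z λ k ks → trans (*-assoc (sgn κ) _ _) (*-congˡ (*-congˡ (trans (lower (scaleFirstRow κ B) ks) (sym (lower B ks))))))
    (sym (alt-* (sgn κ) (λ k ks → B Fin.zero k * D (λ r k → B r k) (List.tabulate Fin.suc) ks) z))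
    where
    lower : ∀ (B : Matrix (suc N) m) ks → D (λ r k → B r k) (List.tabulate Fin.suc) ks ≈ D (λ r k → B (Fin.suc r) k) (allFin N) ks
    lower B ks = trans (reflexive (≡.cong₂ (D (λ r k → B r k)) (≡.sym (List.map-tabulate id Fin.suc)) (≡.sym (List.map-id ks))))
      (D-map (λ r k → B r k) Fin.suc id (allFin N) ks)

  module _ {c ℓ} (W : CoxeterSystem c ℓ) (finite : CoxeterSystem.IsFinite W) (w∘ : CoxeterSystem.Element W) where
    open CoxeterSystem W
    open TSign W
    open Subword W

    signedMatrix : ∀ N → HasLength w∘ N → (τ : Vec S N → Sign) → IsTSign w∘ τ → ∀ {m} (p : Vec S m) (B : Matrix N m) →
      (∀ C → IsFacet w∘ N p C → IndependentColumns B (∁ C)) →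
      (∀ C C′ → IsFacet w∘ N p C → IsFacet w∘ N p C′ → MeetInRidge C C′ →
        ∃[ x ] Interior (InCone B (∁ C)) x × Interior (InCone B (∁ C′)) x) →
      Σ[ B′ ∈ Matrix N m ] ∀ z → IsOccurrence w∘ p z → HasSign (τ (subword p z)) (maximalMinor B′ (toList z))
    -- Without rows there is nothing to absorb a sign: the only minor is the empty one, equal to 1.
    -- The empty word is the first reduced word, so the normalisation of `τ` gives the matching +.
    signedMatrix zero _ τ isTSign p B _ _ = B , λ { [] (_ , reduced) → ≡.subst (λ s → HasSign s 1#)
      (≡.sym (proj₂ isTSign [] (reduced , [] , ([] , λ ()) , λ { [] [] _ _ → base tt }))) (<-respʳ (sym (*-identityˡ 1#)) 0<1) }
    signedMatrix (suc N) hasLength τ isTSign p B independent meet = rescale (consistent-sign B independent meet)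
      where
      open Realization ℝ W finite w∘ hasLength isTSign p using (consistent-sign)
      rescale : ∃[ κ ] (∀ z → IsOccurrence w∘ p z → HasSign (κ Sign.* τ (subword p z)) (maximalMinor B (toList z))) →
        Σ[ B′ ∈ Matrix (suc N) _ ] ∀ z → IsOccurrence w∘ p z → HasSign (τ (subword p z)) (maximalMinor B′ (toList z))
      rescale (κ , h) = scaleFirstRow κ B , λ z o → <-respʳ (trans (*-congʳ (sgn-* κ (τ (subword p z))))
        (trans (solve 3 (λ k t μ → k :* t :* μ := t :* (k :* μ)) refl (sgn κ) (sgn (τ (subword p z))) (maximalMinor B (toList z)))
          (*-congˡ (sym (maximalMinor-scale κ B (toList z)))))) (h z o)

theorem3 :
    ∀ {a ℓ₁ ℓ₂ c ℓ} (ℝ : CompleteOrderedField a ℓ₁ ℓ₂) (W : CoxeterSystem c ℓ) →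
    let open CompleteOrderedField ℝ
        open LinearAlgebra ℝ
        open Parameters ℝ
        open CoxeterSystem W
        open TSign W
        open Subword W
    in
    IsFinite → IsIrreducible →
    (w∘ : Element) (N : ℕ) → IsLongestElement w∘ N →
    (τ : Vec S N → Sign) → IsTSign w∘ τ →
    (m : ℕ) (p : Vec S m) (A : Matrix (m ∸ N) m) →
    IsChirotopalRealization ℝ w∘ N p A →
    ∃[ d ] (1 ℕ.≤ d) ×
    (Σ[ P ∈ ParameterTensor N n d ] Σ[ x ∈ (Fin m → Carrier) ]
      (∀ i → 0# < x i)
      × (∀ i j → i Fin.< j → lookup p i ≡ lookup p j → x i < x j)
      × (∀ (z : Vec (Fin m) N) → IsOccurrence w∘ p z →
           let v = subword p z
               y = λ j → x (lookup z j)
           in sign (sumList (map (λ 𝔷 → det (columns P 𝔷) * partialSchur (Λ 𝔷) (Ω v) y)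
                                 (ℨ d (α v))))
              ≡ (σ v Sign.* τ v) ◃ 1))
theorem3 ℝ W finite _ w∘ N (hasLength , _) τ isTSign m p A (_ , B , _ , independent , meet) =
  conclude (signedMatrix W finite w∘ N hasLength τ isTSign p B independent meet)
  where
  open CompleteOrderedField ℝ hiding (zero)
  open OrderedField ℝ
  open LinearAlgebra ℝ
  open Parameters ℝ
  open CoxeterSystem W using (S; n)
  open Subword W
  open Determinants ℝ
  open Cones ℝ
  open SchurExpansion ℝ
  open Interpolation ℝ
  open SignedMatrices ℝ
  open import Relation.Binary.Reasoning.Setoid setoid

  conclude : (Σ[ B′ ∈ Matrix N m ] ∀ z → IsOccurrence w∘ p z → HasSign (τ (subword p z)) (maximalMinor B′ (toList z))) → _
  -- Each row of `B′` is interpolated at the m nodes by `suc m` coefficients, whence the value of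
  -- `d`.
  conclude (B′ , signs) = suc m , ℕ.s≤s ℕ.z≤n , P , node , node-pos , (λ i j i<j _ → node-mono i<j) , λ z o →
    HasSign⇒sign (σ (subword p z) Sign.* τ (subword p z)) (expand z o (schurExpansion (subword p z) (λ j → node (lookup z j))
      (λ i<j _ → node-mono (Linked.lookup⁺ Fin.<-trans (proj₁ o) i<j)) P (λ j r → B′ r (lookup z j))
      (λ j r → trans (sym (proj₂ (polynomial r) (lookup z j))) (horner-sum (proj₁ (polynomial r)) (node (lookup z j))))))
    where
    polynomial : ∀ r → Σ[ f ∈ (Fin (suc m) → Carrier) ] ∀ j → horner f (node j) ≈ B′ r j
    polynomial r = interpolate node (B′ r) node-mono
    -- One curve through all columns of B′ serves every letter.
    P : ParameterTensor N n (suc m)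
    P r s = proj₁ (polynomial r)
    expand : ∀ z → IsOccurrence w∘ p z → ∀ {Σ} →
      ∃[ κ ] 0# < κ × Σ ≈ κ * (sgn (σ (subword p z)) * D (λ r j → B′ r (lookup z j)) (allFin N) (allFin N)) →
      HasSign (σ (subword p z) Sign.* τ (subword p z)) Σ
    expand z o {Σ} (κ , 0<κ , eq) = <-respʳ (sym (begin
      sgn (s Sign.* t) * Σ
        ≈⟨ *-cong (sgn-* s t) eq ⟩
      sgn s * sgn t * (κ * (sgn s * D (λ r j → B′ r (lookup z j)) (allFin N) (allFin N)))
        ≈⟨ *-congˡ (*-congˡ (*-congˡ restrict)) ⟩
      sgn s * sgn t * (κ * (sgn s * μ))
        -- The sign σ enters once from the claim and once from the expansion; its square disappears,
        -- leaving the positive `κ` times the signed minor.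
        ≈⟨ solve 4 (λ s t k μ → s :* t :* (k :* (s :* μ)) := s :* s :* (k :* (t :* μ))) refl (sgn s) (sgn t) κ μ ⟩
      sgn s * sgn s * (κ * (sgn t * μ))
        ≈⟨ trans (*-congʳ (sgn-square s)) (*-identityˡ _) ⟩
      κ * (sgn t * μ) ∎)) (*-pos 0<κ (signs z o))
      where
      s = σ (subword p z)
      t = τ (subword p z)
      μ = maximalMinor B′ (toList z)
      restrict : D (λ r j → B′ r (lookup z j)) (allFin N) (allFin N) ≈ μ
      restrict = trans (sym (D-map (λ r k → B′ r k) id (lookup z) (allFin N) (allFin N)))
        (reflexive (≡.cong₂ (D (λ r k → B′ r k)) (List.map-id (allFin N)) (map-lookup-allFin z)))
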